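{- For all nonnegative integers $a_1,\dots,a_n$, \[F(a_2,\dots,a_n)=\sum_{M}\prod_{i=1}^{n-1}B(m_{i,i+1})\prod_{j>i+1}A(m_{ij}),\] where the sum is over all Tesler matrices $M=(m_{ij})$ associated to $(a_1,\dots,a_n)$.
   Context: Let $q,t$ be indeterminates. A standard Young tableau $T$ with $n$ boxes is a bijective filling of the Young diagram of a partition of $n$ by $1,\dots,n$, increasing along rows (left to right) and columns (bottom to top); rows $r$ counted from the bottom, columns $c$ from the left, starting at $1$. Let $z_i=q^{c-1}t^{r-1}$ where $i$ sits in row $r$, column $c$. Define \[\mathrm{wt}(T)=\prod_{i=2}^{n}\frac{1}{(1-z_i^{ -1})(1-qtz_{i-1}/z_i)}\prod_{1\leqslant i<j\leqslant n}\frac{(1-z_i/z_j)(1-qtz_i/z_j)}{(1-qz_i/z_j)(1-tz_i/z_j)},\] omitting any individual factor that vanishes, and $F(a_2,\dots,a_n)=\sum_T z_2^{a_2}\cdots z_n^{a_n}\mathrm{wt}(T)$ over all standard Young tableaux with $n$ boxes. A Tesler matrix associated to $(a_1,\dots,a_n)$ is an upper-triangular matrix $(m_{ij})_{1\leqslant i\leqslant j\leqslant n}$ with nonnegative integer entries satisfying $m_{ii}+\sum_{j<i}m_{ji}-\sum_{j>i}m_{ij}=a_i$ for all $i$. With $[m]_{q,t}=q^{m-1}+q^{m-2}t+\cdots+t^{m-1}$ (and $[0]_{q,t}=0$), the coefficients $A(m),B(m)$ are defined by \[\sum_{m\geqslant0}A(m)z^m=\frac{(1-z)(1-qtz)}{(1-qz)(1-tz)},\qquad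 \sum_{m\geqslant 0}B(m)z^m=\frac{1-z}{(1-qz)(1-tz)},\] i.e. $A(0)=1$, $A(m)=-(1-q)(1-t)[m]_{q,t}$ for $m\geqslant1$, and $B(m)=[m+1]_{q,t}-[m]_{q,t}$. -}

module Defs where

open import Data.Nat as ℕ using (ℕ; zero; suc; _∸_; _≡ᵇ_; _<ᵇ_)
open import Data.Integer as ℤ using (ℤ; +_)
open import Data.Integer.Properties using () renaming (_≟_ to _≟ℤ_)
open import Data.Bool using (Bool; true; false; _∧_; _∨_; not; if_then_else_)
open import Data.List using (List; []; _∷_; [_]; map; concatMap; _++_; foldr; upTo; allFin; filterᵇ; cartesianProduct)
open import Data.Bool.ListAction using (all; any)
open import Data.Fin using (Fin; toℕ)
open import Data.Vec using (Vec; lookup; toList) renaming ([] to []ᵥ; _∷_ to _∷ᵥ_)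
open import Data.Product using (_×_; _,_; proj₁; proj₂)
open import Relation.Nullary.Decidable using (does)
open import Relation.Binary.PropositionalEquality using (_≡_)

-- a Laurent monomial q^e₁ t^e₂ is stored as its exponent pair (e₁ , e₂)
Mono : Set
Mono = ℤ × ℤ

monoMul : Mono → Mono → Mono
monoMul (a , b) (c , d) = (a ℤ.+ c , b ℤ.+ d)

monoInv : Mono → Mono
monoInv (a , b) = (ℤ.- a , ℤ.- b)

mono1 monoQ monoT monoQT : Mono
mono1  = (+ 0 , + 0)
monoQ  = (+ 1 , + 0)
monoT  = (+ 0 , + 1)
monoQT = (+ 1 , + 1)

isOneMono : Mono → Bool
isOneMono (a , b) = does (a ≟ℤ + 0) ∧ does (b ≟ℤ + 0)

eqMono : Mono → Mono → Bool
eqMono (a , b) (c , d) = does (a ≟ℤ c) ∧ does (b ≟ℤ d)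

-- a Laurent polynomial is a formal finite sum of terms  coeff · monomial
LPoly : Set
LPoly = List (ℤ × Mono)

coeff : LPoly → Mono → ℤ
coeff []             e = + 0
coeff ((c , m) ∷ p) e = (if eqMono m e then c else + 0) ℤ.+ coeff p e

_≈ₚ_ : LPoly → LPoly → Set
p ≈ₚ p' = ∀ (e : Mono) → coeff p e ≡ coeff p' e

monoP : Mono → LPoly
monoP m = [ (+ 1 , m) ]

0ₚ 1ₚ : LPoly
0ₚ = []
1ₚ = monoP mono1

_+ₚ_ : LPoly → LPoly → LPoly
p +ₚ p' = p ++ p'

-ₚ_ : LPoly → LPoly
-ₚ p = map (λ { (c , m) → (ℤ.- c , m) }) p

_*ₚ_ : LPoly → LPoly → LPoly
p *ₚ p' = concatMap (λ { (c , m) → map (λ { (c' , m') → (c ℤ.* c' , monoMul m m') }) p' }) p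

prodₚ : List LPoly → LPoly
prodₚ = foldr _*ₚ_ 1ₚ

sumₚ : List LPoly → LPoly
sumₚ = foldr _+ₚ_ 0ₚ

oneMinus : Mono → LPoly
oneMinus m = 1ₚ +ₚ (-ₚ monoP m)

-- Rational functions in q,t : fractions num/den of Laurent polynomials
-- (all denominators occurring below are products of nonzero factors 1 - m)

record Frac : Set where
  constructor _/ₓ_
  field
    num : LPoly
    den : LPoly
open Frac public

_≈F_ : Frac → Frac → Set
x ≈F y = (num x *ₚ den y) ≈ₚ (num y *ₚ den x)

fromPoly : LPoly → Frac
fromPoly p = p /ₓ 1ₚ

0F 1F : Frac
0F = 0ₚ /ₓ 1ₚ
1F = 1ₚ /ₓ 1ₚ

_*F_ : Frac → Frac → Frac
(a /ₓ b) *F (c /ₓ d) = (a *ₚ c) /ₓ (b *ₚ d)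

_+F_ : Frac → Frac → Frac
(a /ₓ b) +F (c /ₓ d) = ((a *ₚ d) +ₚ (c *ₚ b)) /ₓ (b *ₚ d)

prodF : List Frac → Frac
prodF = foldr _*F_ 1F

sumF : List Frac → Frac
sumF = foldr _+F_ 0F

-- the factor (1 - m), omitted (replaced by 1) when it vanishes, i.e. m = 1
factor : Mono → Frac
factor m = if isOneMono m then 1F else fromPoly (oneMinus m)

invFactor : Mono → Frac
invFactor m = if isOneMono m then 1F else (1ₚ /ₓ oneMinus m)

allVecs : {A : Set} (n : ℕ) → List A → List (Vec A n)
allVecs zero    L = [ []ᵥ ]
allVecs (suc n) L = concatMap (λ x → map (x ∷ᵥ_) (allVecs n L)) L

pairsLt : (n : ℕ) → List (Fin n × Fin n)
pairsLt n = filterᵇ (λ { (i , j) → toℕ i <ᵇ toℕ j }) (cartesianProduct (allFin n) (allFin n))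

pairsSucc : (n : ℕ) → List (Fin n × Fin n)
pairsSucc n = filterᵇ (λ { (i , j) → toℕ j ≡ᵇ suc (toℕ i) }) (cartesianProduct (allFin n) (allFin n))

sumℕ : List ℕ → ℕ
sumℕ = foldr ℕ._+_ 0

-- Standard Young tableaux with n boxes.
-- A filling is a vector pos of length n; entry number k (Fin index k,
-- i.e. the label k+1) sits in the box pos k = (r , c)  (row r from the
-- bottom, column c from the left, both starting at 1).

Cell : Set
Cell = ℕ × ℕ

eqCell : Cell → Cell → Bool
eqCell (r , c) (r' , c') = (r ≡ᵇ r') ∧ (c ≡ᵇ c')

-- pos is a standard Young tableau iff
--  * all rows/columns are ≥ 1,
--  * distinct labels sit in distinct boxes (bijective filling),
--  * for every label, the box to its left (if c > 1) and the box below
--    it (if r > 1) are occupied by a smaller label.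
-- (These force the set of boxes to be the diagram of a partition and
--  the labels to increase along rows and columns, and conversely.)
isSYT : {n : ℕ} → Vec Cell n → Bool
isSYT {n} pos =
  all (λ i → positive (lookup pos i)) (allFin n)
  ∧ all (λ { (i , j) → not (eqCell (lookup pos i) (lookup pos j)) ∨ (toℕ i ≡ᵇ toℕ j) })
        (cartesianProduct (allFin n) (allFin n))
  ∧ all (λ i → supported i (lookup pos i)) (allFin n)
  where
  positive : Cell → Bool
  positive (r , c) = not (r ≡ᵇ 0) ∧ not (c ≡ᵇ 0)
  occupiedBelow : Fin n → Cell → Bool
  occupiedBelow i x = any (λ j → (toℕ j <ᵇ toℕ i) ∧ eqCell (lookup pos j) x) (allFin n)
  supported : Fin n → Cell → Bool
  supported i (r , c) = ((c ≡ᵇ 1) ∨ occupiedBelow i (r , c ∸ 1))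
                      ∧ ((r ≡ᵇ 1) ∨ occupiedBelow i (r ∸ 1 , c))

-- every box of a tableau with n boxes has row, column ≤ n
cellsUpTo : ℕ → List Cell
cellsUpTo n = cartesianProduct (map suc (upTo n)) (map suc (upTo n))

SYTs : (n : ℕ) → List (Vec Cell n)
SYTs n = filterᵇ isSYT (allVecs n (cellsUpTo n))

zMono : Cell → Mono
zMono (r , c) = (+ (c ∸ 1) , + (r ∸ 1))

wt : {n : ℕ} → Vec Cell n → Frac
wt {n} pos =
  prodF (map (λ { (i , j) →
      invFactor (monoInv (z j)) *F invFactor (monoMul monoQT (monoMul (z i) (monoInv (z j)))) })
    (pairsSucc n))
  *F
  prodF (map (λ { (i , j) → let w = monoMul (z i) (monoInv (z j)) in
      (factor w *F factor (monoMul monoQT w))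
      *F (invFactor (monoMul monoQ w) *F invFactor (monoMul monoT w)) })
    (pairsLt n))
  where
  z : Fin n → Mono
  z k = zMono (lookup pos k)

-- z_2^{a_2} ⋯ z_n^{a_n}   (the Fin index 0 corresponds to label 1)
zPow : {n : ℕ} → Vec ℕ n → Vec Cell n → Mono
zPow {n} a pos =
  foldr monoMul mono1
    (map (λ i → let (e₁ , e₂) = zMono (lookup pos i) in
                (+ lookup a i ℤ.* e₁ , + lookup a i ℤ.* e₂))
         (filterᵇ (λ i → not (toℕ i ≡ᵇ 0)) (allFin n)))

-- F(a_2,…,a_n) for a = (a_1,…,a_n)  (a_1 is not used)
F : {n : ℕ} → Vec ℕ n → Frac
F {n} a = sumF (map (λ T → fromPoly (monoP (zPow a T)) *F wt T) (SYTs n))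

qtInt : ℕ → LPoly
qtInt m = map (λ k → (+ 1 , (+ (m ∸ 1 ∸ k) , + k))) (upTo m)

A : ℕ → LPoly
A zero    = 1ₚ
A (suc m) = -ₚ ((oneMinus monoQ *ₚ oneMinus monoT) *ₚ qtInt (suc m))

B : ℕ → LPoly
B m = qtInt (suc m) +ₚ (-ₚ qtInt m)

-- Tesler matrices.  A matrix is a Vec of rows; entry (i , j) is
-- lookup (lookup M i) j (0-based indices).  Entries below the diagonal
-- are not part of a Tesler matrix and are required to be 0.

entry : {n : ℕ} → Vec (Vec ℕ n) n → Fin n → Fin n → ℕ
entry M i j = lookup (lookup M i) j

isTesler : {n : ℕ} → Vec ℕ n → Vec (Vec ℕ n) n → Bool
isTesler {n} a M =
  all (λ { (i , j) → not (toℕ j <ᵇ toℕ i) ∨ (entry M i j ≡ᵇ 0) })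
      (cartesianProduct (allFin n) (allFin n))
  ∧ all (λ i →
      (entry M i i ℕ.+ sumℕ (map (λ j → entry M j i) (filterᵇ (λ j → toℕ j <ᵇ toℕ i) (allFin n))))
      ≡ᵇ (lookup a i ℕ.+ sumℕ (map (λ j → entry M i j) (filterᵇ (λ j → toℕ i <ᵇ toℕ j) (allFin n)))))
    (allFin n)

-- Every entry of a Tesler matrix for a is ≤ a_1 + ⋯ + a_n (the diagonal
-- sums to a_1+⋯+a_n, and the entries m_ij, j > i, are part of the flow
-- out of {1..i}, which equals Σ_{k≤i} (m_kk - a_k)).  Hence this list
-- contains every Tesler matrix associated to a, each exactly once.
teslers : {n : ℕ} → Vec ℕ n → List (Vec (Vec ℕ n) n)
teslers {n} a = filterᵇ (isTesler a) (allVecs n (allVecs n (upTo (suc (sumℕ (toList a))))))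

teslerWeight : {n : ℕ} → Vec (Vec ℕ n) n → LPoly
teslerWeight {n} M =
  prodₚ (map (λ { (i , j) → if toℕ j ≡ᵇ suc (toℕ i) then B (entry M i j) else A (entry M i j) })
             (pairsLt n))

teslerSum : {n : ℕ} → Vec ℕ n → LPoly
teslerSum a = sumₚ (map teslerWeight (teslers a))

{-# OPTIONS --safe #-}

-- Removing the largest entry of a tableau multiplies its weight by a function of the position z of
-- that entry: by Φ(z) = Π_{i<n} ω(z_i/z) / ((1 - 1/z)(1 - qt z_{n-1}/z)), where
-- ω(x) = (1 - x)(1 - qtx) / ((1 - qx)(1 - tx)) and vanishing factors are omitted. The product
-- telescopes over the cells of the plane: with u = 1/z only a pole 1 - s u for each cell s that can
-- be added, and a zero 1 - r u for each removable corner r/(qt) other than z_{n-1}, survive, and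
-- there are two more poles than zeros. By partial fractions the sum of s^a times the residue at s is
-- therefore the coefficient of u^a in the power series Φ. Expanding Φ as the product of the series of
-- B for z_{n-1}, of A for the other z_i, and of 1/(1 - u), one gets F(a_1,…,a_n) as a sum over vectors
-- m with |m| ≤ a_n of the products of the coefficients times F(a_1 + m_1, …, a_{n-1} + m_{n-1}).
-- The sum over Tesler matrices satisfies the same recursion, m being the last column. The bounds on
-- cells and matrix entries in the enumerations are kept fixed throughout the induction.
module Submission where

open import Defs
open import Data.Nat using (ℕ; _≤_)
open import Data.Vec using (Vec)

open import Algebra.Bundles using (CommutativeRing; CommutativeMonoid)
import Algebra.Solver.Ring
import Algebra.Solver.Ring.AlmostCommutativeRing as ACR
open import Data.Bool using (Bool; true; false; if_then_else_; _∧_; _∨_; not; T?)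
open import Data.Bool.ListAction using (any; all)
open import Data.Bool.Properties
  using (T-≡; ∨-identityʳ; ∨-zeroʳ; ∧-identityʳ; ∧-commutativeMonoid; ∨-commutativeMonoid)
open import Data.Empty using (⊥; ⊥-elim)
open import Data.Fin using (Fin; zero; suc; toℕ; inject₁; fromℕ)
import Data.Fin.Properties as FinP
open import Data.Integer as ℤ using (ℤ; +_; -[1+_]; +[1+_])
import Data.Integer.Properties as ℤP
open import Data.Integer.Tactic.RingSolver using (solve-∀)
open import Data.List
  using (List; []; _∷_; map; _++_; concatMap; foldr; filterᵇ; cartesianProduct; allFin; upTo; applyUpTo; length)
open import Data.List.Membership.Propositional using (_∈_)
open import Data.List.Membership.Propositional.Properties
  using (∈-allFin; ∈-cartesianProduct⁺; ∈-cartesianProduct⁻; ∈-map⁺; ∈-map⁻; ∈-upTo⁺)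
open import Data.List.Properties using (map-applyUpTo; map-tabulate; length-map; ++-assoc; ++-identityʳ)
open import Data.List.Relation.Unary.All as All using (All; []; _∷_)
import Data.List.Relation.Unary.All.Properties as AllP
open import Data.List.Relation.Unary.AllPairs using ([]; _∷_)
open import Data.List.Relation.Unary.Any using (here; there)
open import Data.List.Relation.Unary.Unique.Propositional using (Unique)
import Data.List.Relation.Unary.Unique.Propositional.Properties as UniqueP
open import Data.Maybe using (Maybe; just; nothing)
open import Data.Nat as ℕ using (zero; suc; z≤n; s≤s; _<_; _≡ᵇ_; _<ᵇ_)
import Data.Nat.Properties as ℕP
open import Data.Product using (_×_; _,_; proj₁; proj₂; Σ; ∃)
open import Data.Product.Properties using (,-injectiveˡ; ,-injectiveʳ)
open import Data.Vec using ([]; _∷_; lookup; _∷ʳ_; zipWith; initLast; toList)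
open import Data.Vec.Properties using (lookup-zipWith)
open import Function using (_∘_; Equivalence)
import Level
open import Relation.Binary.PropositionalEquality as ≡ using (_≡_; _≢_; cong; cong₂; module ≡-Reasoning)
import Relation.Binary.Reasoning.Setoid
open import Relation.Nullary using (yes; no)

-- The telescoping is proved once, for maps `f` and `g` into a commutative monoid with
-- `f x ∙ g x ≈ ε`, and is used in three monoids. In the ring, at a fixed s, it gives the residue;
-- omitting vanishing factors does no harm there, because an omitted factor and its omitted inverse
-- are both 1. In the power series under the Cauchy product it gives Φ. In the integers under
-- addition, with `f` = 1 and `g` = -1, it counts zeros minus poles, the degree condition of the
-- partial fractions.
--
-- Cross multiplication is transitive only across a denominator that can be cancelled. Fractions are
-- therefore paired with a proof that their denominator is no zero divisor, and these pairs form a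
-- commutative ring. From the partial fractions to the recursions everything is done over any
-- commutative ring with a `Torus`.
--
-- The recursion replaces the arguments by a_i + m_i, so the induction on n is over all vectors; |m|
-- ≤ a_n keeps their total from growing. Since z_1 = 1, the exponent a_1 can be kept on the tableau
-- side as well. The factor 1/(1 - u) of Φ corresponds to the diagonal entry m_nn.

-- A ring solver with integer coefficients for any commutative ring

module IntegerSolver {c ℓ} (R : CommutativeRing c ℓ) where
  open CommutativeRing R
  open import Algebra.Properties.Semiring.Mult.TCOptimised semiring
    using (×-homo-+; ×1-homo-*; 1+×) renaming (_×_ to _×′_)
  open import Algebra.Properties.Ring ring using (-‿distribˡ-*; -‿distribʳ-*; -‿involutive; -0#≈0#; -‿+-comm)
  open Relation.Binary.Reasoning.Setoid setoid

  -- Equality of integers is decidable, so coefficients taken in ℤ can cancel although equality in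
  -- the ring cannot be tested. With these multiples 0 and 1 evaluate to `0#` and `1#` by
  -- computation.
  ⟦_⟧ℤ : ℤ → Carrier
  ⟦ + n ⟧ℤ = n ×′ 1#
  ⟦ -[1+ n ] ⟧ℤ = - (suc n ×′ 1#)

  neg-homo : ∀ i → ⟦ ℤ.- i ⟧ℤ ≈ - ⟦ i ⟧ℤ
  neg-homo (+ zero) = sym -0#≈0#
  neg-homo +[1+ n ] = refl
  neg-homo -[1+ n ] = sym (-‿involutive _)

  ⊖-homo : ∀ m n → ⟦ m ℤ.⊖ n ⟧ℤ ≈ m ×′ 1# - n ×′ 1#
  ⊖-homo m zero = sym (trans (+-congˡ -0#≈0#) (+-identityʳ _))
  ⊖-homo zero (suc n) = sym (+-identityˡ _)
  ⊖-homo (suc m) (suc n) = begin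
    ⟦ suc m ℤ.⊖ suc n ⟧ℤ ≡⟨ ≡.cong ⟦_⟧ℤ (ℤP.[1+m]⊖[1+n]≡m⊖n m n) ⟩
    ⟦ m ℤ.⊖ n ⟧ℤ ≈⟨ ⊖-homo m n ⟩
    m ×′ 1# - n ×′ 1# ≈⟨ +-congˡ (+-identityˡ _) ⟨
    m ×′ 1# + (0# - n ×′ 1#) ≈⟨ +-congˡ (+-congʳ (-‿inverseʳ 1#)) ⟨
    m ×′ 1# + (1# - 1# - n ×′ 1#) ≈⟨ +-congˡ (+-assoc _ _ _) ⟩
    m ×′ 1# + (1# + (- 1# - n ×′ 1#)) ≈⟨ +-assoc _ _ _ ⟨
    m ×′ 1# + 1# + (- 1# - n ×′ 1#) ≈⟨ +-cong (trans (+-comm _ _) (sym (1+× m 1#))) (trans (-‿+-comm _ _) (-‿cong (sym (1+× n 1#)))) ⟩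
    suc m ×′ 1# - suc n ×′ 1# ∎

  plus-homo : ∀ i j → ⟦ i ℤ.+ j ⟧ℤ ≈ ⟦ i ⟧ℤ + ⟦ j ⟧ℤ
  plus-homo (+ m) (+ n) = ×-homo-+ 1# m n
  plus-homo (+ m) -[1+ n ] = ⊖-homo m (suc n)
  plus-homo -[1+ m ] (+ n) = trans (⊖-homo n (suc m)) (+-comm _ _)
  plus-homo -[1+ m ] -[1+ n ] = begin
    - (suc (suc (m ℕ.+ n)) ×′ 1#) ≡⟨ ≡.cong (λ k → - (suc k ×′ 1#)) (≡.sym (ℕP.+-suc m n)) ⟩
    - ((suc m ℕ.+ suc n) ×′ 1#) ≈⟨ -‿cong (×-homo-+ 1# (suc m) (suc n)) ⟩
    - (suc m ×′ 1# + suc n ×′ 1#) ≈⟨ -‿+-comm _ _ ⟨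
    _ ∎

  pos-*-homo : ∀ m j → ⟦ + m ℤ.* j ⟧ℤ ≈ ⟦ + m ⟧ℤ * ⟦ j ⟧ℤ
  pos-*-homo m (+ n) = begin
    ⟦ + m ℤ.* + n ⟧ℤ ≡⟨ ≡.cong ⟦_⟧ℤ (≡.sym (ℤP.pos-* m n)) ⟩
    (m ℕ.* n) ×′ 1# ≈⟨ ×1-homo-* m n ⟩
    _ ∎
  pos-*-homo m -[1+ n ] = begin
    ⟦ + m ℤ.* -[1+ n ] ⟧ℤ ≡⟨ ≡.cong ⟦_⟧ℤ (≡.sym (ℤP.neg-distribʳ-* (+ m) +[1+ n ])) ⟩
    ⟦ ℤ.- (+ m ℤ.* +[1+ n ]) ⟧ℤ ≈⟨ neg-homo (+ m ℤ.* +[1+ n ]) ⟩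
    - ⟦ + m ℤ.* +[1+ n ] ⟧ℤ ≈⟨ -‿cong (pos-*-homo m +[1+ n ]) ⟩
    - (m ×′ 1# * (suc n ×′ 1#)) ≈⟨ -‿distribʳ-* _ _ ⟩
    _ ∎

  times-homo : ∀ i j → ⟦ i ℤ.* j ⟧ℤ ≈ ⟦ i ⟧ℤ * ⟦ j ⟧ℤ
  times-homo (+ m) j = pos-*-homo m j
  times-homo -[1+ m ] j = begin
    ⟦ -[1+ m ] ℤ.* j ⟧ℤ ≡⟨ ≡.cong ⟦_⟧ℤ (≡.sym (ℤP.neg-distribˡ-* +[1+ m ] j)) ⟩
    ⟦ ℤ.- (+[1+ m ] ℤ.* j) ⟧ℤ ≈⟨ neg-homo (+[1+ m ] ℤ.* j) ⟩
    - ⟦ +[1+ m ] ℤ.* j ⟧ℤ ≈⟨ -‿cong (pos-*-homo (suc m) j) ⟩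
    - ((suc m ×′ 1#) * ⟦ j ⟧ℤ) ≈⟨ -‿distribˡ-* _ _ ⟩
    _ ∎

  private
    morphism : ℤ.+-*-rawRing ACR.-Raw-AlmostCommutative⟶ ACR.fromCommutativeRing R
    morphism = record
      { ⟦_⟧ = ⟦_⟧ℤ ; +-homo = plus-homo ; *-homo = times-homo
      ; -‿homo = neg-homo ; 0-homo = refl ; 1-homo = refl }

    coeff≟ : ∀ i j → Maybe (⟦ i ⟧ℤ ≈ ⟦ j ⟧ℤ)
    coeff≟ i j with i ℤP.≟ j
    ... | yes i≡j = just (reflexive (≡.cong ⟦_⟧ℤ i≡j))
    ... | no _ = nothing

  open Algebra.Solver.Ring ℤ.+-*-rawRing (ACR.fromCommutativeRing R) morphism coeff≟ public
    using (solve; _:=_; _:+_; _:*_; :-_; _:-_; con; Polynomial)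

  :1 : ∀ {n} → Polynomial n
  :1 = con (+ 1)

-- Laurent polynomials

monoMul-assoc : ∀ a b c → monoMul (monoMul a b) c ≡ monoMul a (monoMul b c)
monoMul-assoc (a , a′) (b , b′) (c , c′) = cong₂ _,_ (ℤP.+-assoc a b c) (ℤP.+-assoc a′ b′ c′)

monoMul-comm : ∀ a b → monoMul a b ≡ monoMul b a
monoMul-comm (a , a′) (b , b′) = cong₂ _,_ (ℤP.+-comm a b) (ℤP.+-comm a′ b′)

monoMul-identityˡ : ∀ a → monoMul mono1 a ≡ a
monoMul-identityˡ (a , a′) = cong₂ _,_ (ℤP.+-identityˡ a) (ℤP.+-identityˡ a′)

monoMul-inverseʳ : ∀ a → monoMul a (monoInv a) ≡ mono1
monoMul-inverseʳ (a , a′) = cong₂ _,_ (ℤP.+-inverseʳ a) (ℤP.+-inverseʳ a′)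

infixl 6 _⊘_
_⊘_ : Mono → Mono → Mono
e ⊘ m = monoMul e (monoInv m)

⊘-monoMul : ∀ e m m′ → e ⊘ monoMul m m′ ≡ e ⊘ m ⊘ m′
⊘-monoMul (a , a′) (b , b′) (c , c′) = cong₂ _,_ (lem a b c) (lem a′ b′ c′)
  where
  lem : ∀ a b c → a ℤ.+ (ℤ.- (b ℤ.+ c)) ≡ a ℤ.+ (ℤ.- b) ℤ.+ (ℤ.- c)
  lem = solve-∀

⊘-mono1 : ∀ e → e ⊘ mono1 ≡ e
⊘-mono1 (a , a′) = cong₂ _,_ (ℤP.+-identityʳ a) (ℤP.+-identityʳ a′)

monoMul-⊘ : ∀ m e → monoMul m (e ⊘ m) ≡ e
monoMul-⊘ (a , a′) (b , b′) = cong₂ _,_ (lem a b) (lem a′ b′)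
  where
  lem : ∀ a b → a ℤ.+ (b ℤ.+ (ℤ.- a)) ≡ b
  lem = solve-∀

true-⇔⇒≡ : ∀ {x y : Bool} → (x ≡ true → y ≡ true) → (y ≡ true → x ≡ true) → x ≡ y
true-⇔⇒≡ {false} {false} f g = ≡.refl
true-⇔⇒≡ {false} {true} f g = g ≡.refl
true-⇔⇒≡ {true} f g = ≡.sym (f ≡.refl)

eqMono-sound : ∀ a b → eqMono a b ≡ true → a ≡ b
eqMono-sound (a , a′) (b , b′) h with a ℤP.≟ b | a′ ℤP.≟ b′
... | yes p | yes p′ = cong₂ _,_ p p′
eqMono-sound (a , a′) (b , b′) () | yes p | no _
eqMono-sound (a , a′) (b , b′) () | no p | _

eqMono-refl : ∀ a → eqMono a a ≡ true
eqMono-refl (a , a′) with a ℤP.≟ a | a′ ℤP.≟ a′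
... | yes _ | yes _ = ≡.refl
... | no a≢a | _ = ⊥-elim (a≢a ≡.refl)
... | yes _ | no a≢a = ⊥-elim (a≢a ≡.refl)

eqMono-complete : ∀ {a b} → a ≡ b → eqMono a b ≡ true
eqMono-complete {a} ≡.refl = eqMono-refl a

eqMono-shift : ∀ m m′ e → eqMono (monoMul m m′) e ≡ eqMono m′ (e ⊘ m)
eqMono-shift m m′ e = true-⇔⇒≡
  (λ h → eqMono-complete (≡.trans (≡.sym (≡.trans (cong (_⊘ m) (monoMul-comm m m′)) (cancel m′ m)))
                                  (cong (_⊘ m) (eqMono-sound (monoMul m m′) e h))))
  (λ h → eqMono-complete (≡.trans (cong (monoMul m) (eqMono-sound m′ _ h)) (monoMul-⊘ m e)))
  where
  cancel : ∀ a b → monoMul a b ⊘ b ≡ a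
  cancel a b = ≡.trans (monoMul-assoc a b (monoInv b))
    (≡.trans (cong (monoMul a) (monoMul-inverseʳ b)) (≡.trans (monoMul-comm a mono1) (monoMul-identityˡ a)))

eqMono-swap : ∀ m m′ e → eqMono m (e ⊘ m′) ≡ eqMono m′ (e ⊘ m)
eqMono-swap m m′ e = ≡.trans (≡.sym (eqMono-shift m′ m e))
  (≡.trans (cong (λ x → eqMono x e) (monoMul-comm m′ m)) (eqMono-shift m m′ e))

private
  scale : ℤ → Mono → LPoly → LPoly
  scale c m = map (λ { (c′ , m′) → (c ℤ.* c′ , monoMul m m′) })

coeff-++ : ∀ p p′ e → coeff (p ++ p′) e ≡ coeff p e ℤ.+ coeff p′ e
coeff-++ [] p′ e = ≡.sym (ℤP.+-identityˡ _)
coeff-++ ((c , m) ∷ p) p′ e =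
  ≡.trans (cong (ℤ._+_ (if eqMono m e then c else + 0)) (coeff-++ p p′ e)) (≡.sym (ℤP.+-assoc (if eqMono m e then c else + 0) _ _))

ℤ-*-if : ∀ c b (x : ℤ) → (if b then c ℤ.* x else + 0) ≡ c ℤ.* (if b then x else + 0)
ℤ-*-if c true x = ≡.refl
ℤ-*-if c false x = ≡.sym (ℤP.*-zeroʳ c)

coeff-scale : ∀ c m p e → coeff (scale c m p) e ≡ c ℤ.* coeff p (e ⊘ m)
coeff-scale c m [] e = ≡.sym (ℤP.*-zeroʳ c)
coeff-scale c m ((c′ , m′) ∷ p) e = begin
  (if eqMono (monoMul m m′) e then c ℤ.* c′ else + 0) ℤ.+ coeff (scale c m p) e
    ≡⟨ cong₂ ℤ._+_ (≡.trans (cong (if_then c ℤ.* c′ else + 0) (eqMono-shift m m′ e)) (ℤ-*-if c (eqMono m′ (e ⊘ m)) c′))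
                   (coeff-scale c m p e) ⟩
  c ℤ.* (if eqMono m′ (e ⊘ m) then c′ else + 0) ℤ.+ c ℤ.* coeff p (e ⊘ m)
    ≡⟨ ℤP.*-distribˡ-+ c _ _ ⟨
  c ℤ.* coeff ((c′ , m′) ∷ p) (e ⊘ m) ∎
  where open ≡-Reasoning

-- The functional h ↦ Σ c h(m) over the terms of `p`. The coefficient of a product at e is the
-- pairing of one factor with m ↦ coeff p′ (e / m), so that convolutions become sums over a list of
-- terms.
pairing : LPoly → (Mono → ℤ) → ℤ
pairing [] h = + 0
pairing ((c , m) ∷ p) h = c ℤ.* h m ℤ.+ pairing p h

pairing-cong : ∀ p {h h′} → (∀ m → h m ≡ h′ m) → pairing p h ≡ pairing p h′
pairing-cong [] eq = ≡.refl
pairing-cong ((c , m) ∷ p) eq = cong₂ ℤ._+_ (cong (c ℤ.*_) (eq m)) (pairing-cong p eq)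

pairing-zero : ∀ p → pairing p (λ _ → + 0) ≡ + 0
pairing-zero [] = ≡.refl
pairing-zero ((c , m) ∷ p) = cong₂ ℤ._+_ (ℤP.*-zeroʳ c) (pairing-zero p)

pairing-+ : ∀ p h h′ → pairing p (λ m → h m ℤ.+ h′ m) ≡ pairing p h ℤ.+ pairing p h′
pairing-+ [] h h′ = ≡.refl
pairing-+ ((c , m) ∷ p) h h′ =
  ≡.trans (cong (ℤ._+_ (c ℤ.* (h m ℤ.+ h′ m))) (pairing-+ p h h′)) (lem c (h m) (h′ m) (pairing p h) (pairing p h′))
  where
  lem : ∀ c x y u v → c ℤ.* (x ℤ.+ y) ℤ.+ (u ℤ.+ v) ≡ c ℤ.* x ℤ.+ u ℤ.+ (c ℤ.* y ℤ.+ v)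
  lem = solve-∀

pairing-++ : ∀ p p′ h → pairing (p ++ p′) h ≡ pairing p h ℤ.+ pairing p′ h
pairing-++ [] p′ h = ≡.sym (ℤP.+-identityˡ _)
pairing-++ ((c , m) ∷ p) p′ h = ≡.trans (cong (ℤ._+_ (c ℤ.* h m)) (pairing-++ p p′ h)) (≡.sym (ℤP.+-assoc (c ℤ.* h m) _ _))

pairing-scale : ∀ c m p h → pairing (scale c m p) h ≡ c ℤ.* pairing p (λ m′ → h (monoMul m m′))
pairing-scale c m [] h = ≡.sym (ℤP.*-zeroʳ c)
pairing-scale c m ((c′ , m′) ∷ p) h =
  ≡.trans (cong₂ ℤ._+_ (ℤP.*-assoc c c′ _) (pairing-scale c m p h)) (≡.sym (ℤP.*-distribˡ-+ c _ _))

-- Commutativity for a single term: the term m of one factor meets the term m′ of the other where m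
-- m′ = e, a condition symmetric in m and m′.
pairing-if : ∀ c m p e → pairing p (λ m′ → if eqMono m (e ⊘ m′) then c else + 0) ≡ c ℤ.* coeff p (e ⊘ m)
pairing-if c m [] e = ≡.sym (ℤP.*-zeroʳ c)
pairing-if c m ((c′ , m′) ∷ p) e =
  ≡.trans (cong₂ ℤ._+_
            (≡.trans (cong (λ b → c′ ℤ.* (if b then c else + 0)) (eqMono-swap m m′ e)) (swap (eqMono m′ (e ⊘ m))))
            (pairing-if c m p e))
          (≡.sym (ℤP.*-distribˡ-+ c _ _))
  where
  swap : ∀ b → c′ ℤ.* (if b then c else + 0) ≡ c ℤ.* (if b then c′ else + 0)
  swap true = ℤP.*-comm c′ c
  swap false = ≡.trans (ℤP.*-zeroʳ c′) (≡.sym (ℤP.*-zeroʳ c))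

coeff-* : ∀ p p′ e → coeff (p *ₚ p′) e ≡ pairing p (λ m → coeff p′ (e ⊘ m))
coeff-* [] p′ e = ≡.refl
coeff-* ((c , m) ∷ p) p′ e =
  ≡.trans (coeff-++ (scale c m p′) (p *ₚ p′) e) (cong₂ ℤ._+_ (coeff-scale c m p′ e) (coeff-* p p′ e))

*ₚ-comm : ∀ p p′ → (p *ₚ p′) ≈ₚ (p′ *ₚ p)
*ₚ-comm p p′ e = ≡.trans (coeff-* p p′ e) (≡.trans (swap p) (≡.sym (coeff-* p′ p e)))
  where
  swap : ∀ p → pairing p (λ m → coeff p′ (e ⊘ m)) ≡ pairing p′ (λ m → coeff p (e ⊘ m))
  swap [] = ≡.sym (pairing-zero p′)
  swap ((c , m) ∷ p) = ≡.trans (cong₂ ℤ._+_ (≡.sym (pairing-if c m p′ e)) (swap p))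
    (≡.sym (pairing-+ p′ (λ m′ → if eqMono m (e ⊘ m′) then c else + 0) (λ m′ → coeff p (e ⊘ m′))))

-- Through `pairing` the right factor enters only by its coefficients. The left factor enters as a
-- list, so congruence in it is derived by commutativity.
*ₚ-congˡ : ∀ p {p′ p″} → p′ ≈ₚ p″ → (p *ₚ p′) ≈ₚ (p *ₚ p″)
*ₚ-congˡ p {p′} {p″} eq e =
  ≡.trans (coeff-* p p′ e) (≡.trans (pairing-cong p (λ m → eq (e ⊘ m))) (≡.sym (coeff-* p p″ e)))

*ₚ-congʳ : ∀ p {p′ p″} → p′ ≈ₚ p″ → (p′ *ₚ p) ≈ₚ (p″ *ₚ p)
*ₚ-congʳ p {p′} {p″} eq e =
  ≡.trans (*ₚ-comm p′ p e) (≡.trans (*ₚ-congˡ p {p′} {p″} eq e) (*ₚ-comm p p″ e))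

*ₚ-distribʳ : ∀ r p p′ → ((p +ₚ p′) *ₚ r) ≈ₚ ((p *ₚ r) +ₚ (p′ *ₚ r))
*ₚ-distribʳ r p p′ e =
  ≡.trans (coeff-* (p ++ p′) r e)
  (≡.trans (pairing-++ p p′ _)
  (≡.trans (cong₂ ℤ._+_ (≡.sym (coeff-* p r e)) (≡.sym (coeff-* p′ r e)))
  (≡.sym (coeff-++ (p *ₚ r) (p′ *ₚ r) e))))

*ₚ-assoc : ∀ p p′ p″ → ((p *ₚ p′) *ₚ p″) ≈ₚ (p *ₚ (p′ *ₚ p″))
*ₚ-assoc [] p′ p″ e = ≡.refl
*ₚ-assoc ((c , m) ∷ p) p′ p″ e = begin
  coeff ((scale c m p′ ++ (p *ₚ p′)) *ₚ p″) e
    ≡⟨ *ₚ-distribʳ p″ (scale c m p′) (p *ₚ p′) e ⟩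
  coeff ((scale c m p′ *ₚ p″) ++ ((p *ₚ p′) *ₚ p″)) e
    ≡⟨ coeff-++ (scale c m p′ *ₚ p″) _ e ⟩
  coeff (scale c m p′ *ₚ p″) e ℤ.+ coeff ((p *ₚ p′) *ₚ p″) e
    ≡⟨ cong₂ ℤ._+_ scaled (*ₚ-assoc p p′ p″ e) ⟩
  coeff (scale c m (p′ *ₚ p″)) e ℤ.+ coeff (p *ₚ (p′ *ₚ p″)) e
    ≡⟨ coeff-++ (scale c m (p′ *ₚ p″)) _ e ⟨
  _ ∎
  where
  open ≡-Reasoning
  scaled : coeff (scale c m p′ *ₚ p″) e ≡ coeff (scale c m (p′ *ₚ p″)) e
  scaled = begin
    coeff (scale c m p′ *ₚ p″) e ≡⟨ coeff-* (scale c m p′) p″ e ⟩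
    pairing (scale c m p′) (λ m′ → coeff p″ (e ⊘ m′)) ≡⟨ pairing-scale c m p′ _ ⟩
    c ℤ.* pairing p′ (λ m′ → coeff p″ (e ⊘ monoMul m m′))
      ≡⟨ cong (c ℤ.*_) (pairing-cong p′ (λ m′ → cong (coeff p″) (⊘-monoMul e m m′))) ⟩
    c ℤ.* pairing p′ (λ m′ → coeff p″ (e ⊘ m ⊘ m′)) ≡⟨ cong (c ℤ.*_) (coeff-* p′ p″ (e ⊘ m)) ⟨
    c ℤ.* coeff (p′ *ₚ p″) (e ⊘ m) ≡⟨ coeff-scale c m (p′ *ₚ p″) e ⟨
    _ ∎

monoP-* : ∀ m p e → coeff (monoP m *ₚ p) e ≡ coeff p (e ⊘ m)
monoP-* m p e = ≡.trans (coeff-* (monoP m) p e) (≡.trans (ℤP.+-identityʳ _) (ℤP.*-identityˡ _))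

*ₚ-identityˡ : ∀ p → (1ₚ *ₚ p) ≈ₚ p
*ₚ-identityˡ p e = ≡.trans (monoP-* mono1 p e) (cong (coeff p) (⊘-mono1 e))

coeff-neg : ∀ p e → coeff (-ₚ p) e ≡ ℤ.- coeff p e
coeff-neg [] e = ≡.refl
coeff-neg ((c , m) ∷ p) e =
  ≡.trans (cong₂ ℤ._+_ (if-neg (eqMono m e)) (coeff-neg p e)) (≡.sym (ℤP.neg-distrib-+ (if eqMono m e then c else + 0) _))
  where
  if-neg : ∀ b → (if b then ℤ.- c else + 0) ≡ ℤ.- (if b then c else + 0)
  if-neg true = ≡.refl
  if-neg false = ≡.refl

laurentRing : CommutativeRing _ _
laurentRing = record
  { Carrier = LPoly
  ; _≈_ = _≈ₚ_ ; _+_ = _+ₚ_ ; _*_ = _*ₚ_ ; -_ = -ₚ_ ; 0# = 0ₚ ; 1# = 1ₚ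
  ; isCommutativeRing = record
    { isRing = record
      { +-isAbelianGroup = record
        { isGroup = record
          { isMonoid = record
            { isSemigroup = record
              { isMagma = record
                { isEquivalence = record
                  { refl = λ _ → ≡.refl ; sym = λ eq e → ≡.sym (eq e) ; trans = λ eq eq′ e → ≡.trans (eq e) (eq′ e) }
                ; ∙-cong = λ {p} {p′} {r} {r′} eq eq′ e →
                    ≡.trans (coeff-++ p r e) (≡.trans (cong₂ ℤ._+_ (eq e) (eq′ e)) (≡.sym (coeff-++ p′ r′ e))) }
              ; assoc = λ p p′ p″ e → cong (λ l → coeff l e) (++-assoc p p′ p″) }
            ; identity = (λ p e → ≡.refl) , (λ p e → cong (λ l → coeff l e) (++-identityʳ p)) }
          ; inverse =
              (λ p e → ≡.trans (coeff-++ (-ₚ p) p e) (≡.trans (cong (λ z → z ℤ.+ coeff p e) (coeff-neg p e)) (ℤP.+-inverseˡ (coeff p e)))) ,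
              (λ p e → ≡.trans (coeff-++ p (-ₚ p) e) (≡.trans (cong (ℤ._+_ (coeff p e)) (coeff-neg p e)) (ℤP.+-inverseʳ (coeff p e))))
          ; ⁻¹-cong = λ {p} {p′} eq e → ≡.trans (coeff-neg p e) (≡.trans (cong (ℤ.-_) (eq e)) (≡.sym (coeff-neg p′ e))) }
        ; comm = λ p p′ e → ≡.trans (coeff-++ p p′ e) (≡.trans (ℤP.+-comm (coeff p e) _) (≡.sym (coeff-++ p′ p e))) }
      ; *-cong = λ {p} {p′} {r} {r′} eq eq′ e → ≡.trans (*ₚ-congʳ r {p} {p′} eq e) (*ₚ-congˡ p′ {r} {r′} eq′ e)
      ; *-assoc = *ₚ-assoc
      ; *-identity = *ₚ-identityˡ , (λ p e → ≡.trans (*ₚ-comm p 1ₚ e) (*ₚ-identityˡ p e))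
      ; distrib =
          (λ p p′ p″ e → ≡.trans (*ₚ-comm p (p′ +ₚ p″) e) (≡.trans (*ₚ-distribʳ p p′ p″ e)
            (≡.trans (coeff-++ (p′ *ₚ p) (p″ *ₚ p) e)
            (≡.trans (cong₂ ℤ._+_ (*ₚ-comm p′ p e) (*ₚ-comm p″ p e)) (≡.sym (coeff-++ (p *ₚ p′) (p *ₚ p″) e)))))) ,
          *ₚ-distribʳ }
    ; *-comm = *ₚ-comm } }

-- Adding the norms |a| + |b| of all exponents bounds each one of them, crudely but without a
-- maximum.
bound : LPoly → ℕ
bound [] = 0
bound ((_ , (a , b)) ∷ p) = ℤ.∣ a ∣ ℕ.+ ℤ.∣ b ∣ ℕ.+ bound p

coeff-vanishes : ∀ p a b → bound p ℕ.< ℤ.∣ a ∣ ℕ.+ ℤ.∣ b ∣ → coeff p (a , b) ≡ + 0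
coeff-vanishes [] a b _ = ≡.refl
coeff-vanishes ((c , m@(x , y)) ∷ p) a b lt with eqMono m (a , b) in eq
... | true with eqMono-sound m (a , b) eq
... | ≡.refl = ⊥-elim (ℕP.<⇒≱ lt (ℕP.m≤m+n _ _))
coeff-vanishes ((c , m@(x , y)) ∷ p) a b lt | false =
  ≡.trans (ℤP.+-identityˡ _) (coeff-vanishes p a b (ℕP.≤-<-trans (ℕP.m≤n+m _ (ℤ.∣ x ∣ ℕ.+ ℤ.∣ y ∣)) lt))

-- Non-zero-divisors. They contain 1 and every 1 - m with m ≠ 1 and are closed under products, which
-- covers all denominators that arise.
Regular : LPoly → Set
Regular d = ∀ p → (d *ₚ p) ≈ₚ 0ₚ → p ≈ₚ 0ₚ

oneMinus-* : ∀ m p e → coeff (oneMinus m *ₚ p) e ≡ coeff p e ℤ.- coeff p (e ⊘ m)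
oneMinus-* m p e = begin
  coeff (oneMinus m *ₚ p) e ≡⟨ coeff-* (oneMinus m) p e ⟩
  + 1 ℤ.* coeff p (e ⊘ mono1) ℤ.+ ((ℤ.- + 1) ℤ.* coeff p (e ⊘ m) ℤ.+ + 0)
    ≡⟨ cong₂ (λ x y → x ℤ.+ (y ℤ.+ + 0)) (≡.trans (ℤP.*-identityˡ _) (cong (coeff p) (⊘-mono1 e))) (ℤP.-1*i≡-i (coeff p (e ⊘ m))) ⟩
  coeff p e ℤ.+ (ℤ.- coeff p (e ⊘ m) ℤ.+ + 0) ≡⟨ cong (ℤ._+_ (coeff p e)) (ℤP.+-identityʳ _) ⟩
  _ ∎
  where open ≡-Reasoning

private
  iterate⊘ : ℕ → Mono → Mono → Mono
  iterate⊘ zero m e = e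
  iterate⊘ (suc k) m e = iterate⊘ k m (e ⊘ m)

  -- A nonzero exponent (a , b) has |a| + |b| ≥ 1, so k translations cover a distance of at least k;
  -- by the triangle inequality the norms of the two end points add up to at least that.
  far : ∀ k a b x y → (a , b) ≢ mono1 →
        k ℕ.≤ ℤ.∣ x ∣ ℕ.+ ℤ.∣ y ∣ ℕ.+ (ℤ.∣ proj₁ (iterate⊘ k (a , b) (x , y)) ∣ ℕ.+ ℤ.∣ proj₂ (iterate⊘ k (a , b) (x , y)) ∣)
  far k a b x y m≢1 = ℕP.≤-trans step₁ (ℕP.≤-trans step₂ (ℕP.≤-reflexive (shuffle ℤ.∣ x ∣ _ ℤ.∣ y ∣ _)))
    where
    shuffle : ∀ p q r s → (p ℕ.+ q) ℕ.+ (r ℕ.+ s) ≡ p ℕ.+ r ℕ.+ (q ℕ.+ s)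
    shuffle p q r s = CM.interchange p q r s
      where import Algebra.Properties.CommutativeSemigroup ℕP.+-commutativeSemigroup as CM
    iter₁ : ∀ k x y → proj₁ (iterate⊘ k (a , b) (x , y)) ≡ x ℤ.- + k ℤ.* a
    iter₁ zero x y = ≡.sym (lem x a) where
      lem : ∀ x a → x ℤ.- + 0 ℤ.* a ≡ x
      lem = solve-∀
    iter₁ (suc k) x y = ≡.trans (iter₁ k _ _) (lem x a (+ k)) where
      lem : ∀ x a k → x ℤ.+ (ℤ.- a) ℤ.- k ℤ.* a ≡ x ℤ.- (+ 1 ℤ.+ k) ℤ.* a
      lem = solve-∀
    iter₂ : ∀ k x y → proj₂ (iterate⊘ k (a , b) (x , y)) ≡ y ℤ.- + k ℤ.* b
    iter₂ zero x y = ≡.sym (lem y b) where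
      lem : ∀ x a → x ℤ.- + 0 ℤ.* a ≡ x
      lem = solve-∀
    iter₂ (suc k) x y = ≡.trans (iter₂ k _ _) (lem y b (+ k)) where
      lem : ∀ x a k → x ℤ.+ (ℤ.- a) ℤ.- k ℤ.* a ≡ x ℤ.- (+ 1 ℤ.+ k) ℤ.* a
      lem = solve-∀
    size : ∀ x a → k ℕ.* ℤ.∣ a ∣ ℕ.≤ ℤ.∣ x ∣ ℕ.+ ℤ.∣ x ℤ.- + k ℤ.* a ∣
    size x a = ≡.subst (λ z → z ℕ.≤ ℤ.∣ x ∣ ℕ.+ ℤ.∣ x ℤ.- + k ℤ.* a ∣) (≡.trans (cong ℤ.∣_∣ (lem x (+ k ℤ.* a))) (ℤP.abs-* (+ k) a))
                 (ℤP.∣i-j∣≤∣i∣+∣j∣ x (x ℤ.- + k ℤ.* a))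
      where
      lem : ∀ x y → x ℤ.- (x ℤ.- y) ≡ y
      lem = solve-∀
    nonzero : 1 ℕ.≤ ℤ.∣ a ∣ ℕ.+ ℤ.∣ b ∣
    nonzero with ℤ.∣ a ∣ in eqa | ℤ.∣ b ∣ in eqb
    ... | suc _ | _ = s≤s z≤n
    ... | zero | suc _ = s≤s z≤n
    ... | zero | zero = ⊥-elim (m≢1 (cong₂ _,_ (ℤP.∣i∣≡0⇒i≡0 eqa) (ℤP.∣i∣≡0⇒i≡0 eqb)))
    step₁ : k ℕ.≤ k ℕ.* ℤ.∣ a ∣ ℕ.+ k ℕ.* ℤ.∣ b ∣
    step₁ = ≡.subst₂ ℕ._≤_ (ℕP.*-identityʳ k) (ℕP.*-distribˡ-+ k _ _) (ℕP.*-monoʳ-≤ k nonzero)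
    step₂ : k ℕ.* ℤ.∣ a ∣ ℕ.+ k ℕ.* ℤ.∣ b ∣ ℕ.≤
            (ℤ.∣ x ∣ ℕ.+ ℤ.∣ proj₁ (iterate⊘ k (a , b) (x , y)) ∣) ℕ.+ (ℤ.∣ y ∣ ℕ.+ ℤ.∣ proj₂ (iterate⊘ k (a , b) (x , y)) ∣)
    step₂ rewrite iter₁ k x y | iter₂ k x y = ℕP.+-mono-≤ (size x a) (size y b)

-- If (1 - m) p = 0 then p is invariant under translation by m, which moves every exponent out of
-- the finite support of p.
oneMinus-regular : ∀ m → m ≢ mono1 → Regular (oneMinus m)
oneMinus-regular m@(a , b) m≢1 p zero-prod e@(x , y) =
  ≡.trans (invariant k e) (coeff-vanishes p (proj₁ (iterate⊘ k m e)) (proj₂ (iterate⊘ k m e)) (ℕP.+-cancelˡ-< (ℤ.∣ x ∣ ℕ.+ ℤ.∣ y ∣) _ _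
    (ℕP.<-≤-trans (ℕP.≤-reflexive (ℕP.+-comm 1 _)) (ℕP.≤-trans (ℕP.≤-reflexive (ℕP.+-assoc (ℤ.∣ x ∣ ℕ.+ ℤ.∣ y ∣) _ 1)) (far k a b x y m≢1)))))
  where
  -- By `far`, this many translations leave the final exponent with norm at least `bound p` + 1,
  -- whatever the norm of e.
  k = ℤ.∣ x ∣ ℕ.+ ℤ.∣ y ∣ ℕ.+ (bound p ℕ.+ 1)
  invariant : ∀ k e → coeff p e ≡ coeff p (iterate⊘ k m e)
  invariant zero e = ≡.refl
  invariant (suc k) e = ≡.trans (ℤP.i-j≡0⇒i≡j (coeff p e) (coeff p (e ⊘ m)) (≡.trans (≡.sym (oneMinus-* m p e)) (zero-prod e))) (invariant k (e ⊘ m))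

-- Fractions with regular denominators

module CrossMultiplication {c ℓ} (R : CommutativeRing c ℓ) where
  open CommutativeRing R
  open IntegerSolver R
  open Relation.Binary.Reasoning.Setoid setoid

  -- The middle denominator d₂ annihilates n₁ d₃ - n₃ d₁. Cancelling it is what regularity of
  -- denominators is for.
  cross-trans : ∀ {n₁ d₁ n₂ d₂ n₃ d₃} → (∀ p → d₂ * p ≈ 0# → p ≈ 0#) →
                n₁ * d₂ ≈ n₂ * d₁ → n₂ * d₃ ≈ n₃ * d₂ → n₁ * d₃ ≈ n₃ * d₁
  cross-trans {n₁} {d₁} {n₂} {d₂} {n₃} {d₃} regular eq eq′ = begin
    n₁ * d₃ ≈⟨ solve 2 (λ x y → x := x :- y :+ y) refl _ _ ⟩
    n₁ * d₃ - n₃ * d₁ + n₃ * d₁ ≈⟨ +-congʳ (regular _ difference) ⟩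
    0# + n₃ * d₁ ≈⟨ +-identityˡ _ ⟩
    n₃ * d₁ ∎
    where
    difference : d₂ * (n₁ * d₃ - n₃ * d₁) ≈ 0#
    difference = begin
      d₂ * (n₁ * d₃ - n₃ * d₁)
        ≈⟨ solve 5 (λ n₁ d₁ d₂ n₃ d₃ → d₂ :* (n₁ :* d₃ :- n₃ :* d₁) := n₁ :* d₂ :* d₃ :- n₃ :* d₂ :* d₁) refl n₁ d₁ d₂ n₃ d₃ ⟩
      n₁ * d₂ * d₃ - n₃ * d₂ * d₁ ≈⟨ +-cong (*-congʳ eq) (-‿cong (*-congʳ (sym eq′))) ⟩
      n₂ * d₁ * d₃ - n₂ * d₃ * d₁
        ≈⟨ solve 3 (λ n d e → n :* d :* e :- n :* e :* d := con (ℤ.+ 0)) refl n₂ d₁ d₃ ⟩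
      0# ∎

  cross-+ : ∀ {a b a′ b′ c d c′ d′} → a * b′ ≈ a′ * b → c * d′ ≈ c′ * d →
            (a * d + c * b) * (b′ * d′) ≈ (a′ * d′ + c′ * b′) * (b * d)
  cross-+ {a} {b} {a′} {b′} {c} {d} {c′} {d′} eq eq′ = begin
    (a * d + c * b) * (b′ * d′)
      ≈⟨ solve 6 (λ a b b′ c d d′ → (a :* d :+ c :* b) :* (b′ :* d′) := a :* b′ :* (d :* d′) :+ c :* d′ :* (b :* b′))
           refl a b b′ c d d′ ⟩
    a * b′ * (d * d′) + c * d′ * (b * b′) ≈⟨ +-cong (*-congʳ eq) (*-congʳ eq′) ⟩
    a′ * b * (d * d′) + c′ * d * (b * b′)
      ≈⟨ solve 6 (λ a′ b b′ c′ d d′ → a′ :* b :* (d :* d′) :+ c′ :* d :* (b :* b′) := (a′ :* d′ :+ c′ :* b′) :* (b :* d))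
           refl a′ b b′ c′ d d′ ⟩
    _ ∎

  cross-* : ∀ {a b a′ b′ c d c′ d′} → a * b′ ≈ a′ * b → c * d′ ≈ c′ * d →
            (a * c) * (b′ * d′) ≈ (a′ * c′) * (b * d)
  cross-* {a} {b} {a′} {b′} {c} {d} {c′} {d′} eq eq′ = begin
    (a * c) * (b′ * d′) ≈⟨ interchange _ _ _ _ ⟩
    (a * b′) * (c * d′) ≈⟨ *-cong eq eq′ ⟩
    (a′ * b) * (c′ * d) ≈⟨ interchange _ _ _ _ ⟩
    _ ∎
    where
    interchange : ∀ x y z w → (x * y) * (z * w) ≈ (x * z) * (y * w)
    interchange = solve 4 (λ x y z w → (x :* y) :* (z :* w) := (x :* z) :* (y :* w)) refl

  cross-neg : ∀ {a b a′ b′} → a * b′ ≈ a′ * b → (- a) * b′ ≈ (- a′) * b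
  cross-neg {a} {b} {a′} {b′} eq = begin
    (- a) * b′ ≈⟨ solve 2 (λ a b → (:- a) :* b := :- (a :* b)) refl _ _ ⟩
    - (a * b′) ≈⟨ -‿cong eq ⟩
    - (a′ * b) ≈⟨ solve 2 (λ a b → (:- a) :* b := :- (a :* b)) refl _ _ ⟨
    (- a′) * b ∎

  cross-+-assoc : ∀ a b c d e f → ((a * d + c * b) * f + e * (b * d)) * (b * (d * f)) ≈ (a * (d * f) + (c * f + e * d) * b) * (b * d * f)
  cross-+-assoc = solve 6 (λ a b c d e f → ((a :* d :+ c :* b) :* f :+ e :* (b :* d)) :* (b :* (d :* f)) := (a :* (d :* f) :+ (c :* f :+ e :* d) :* b) :* (b :* d :* f)) refl

  cross-+-comm : ∀ a b c d → (a * d + c * b) * (d * b) ≈ (c * b + a * d) * (b * d)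
  cross-+-comm = solve 4 (λ a b c d → (a :* d :+ c :* b) :* (d :* b) := (c :* b :+ a :* d) :* (b :* d)) refl

  cross-+-identityˡ : ∀ a b → (0# * b + a * 1#) * b ≈ a * (1# * b)
  cross-+-identityˡ = solve 2 (λ a b → (con (ℤ.+ 0) :* b :+ a :* :1) :* b := a :* (:1 :* b)) refl

  cross-inverseˡ : ∀ a b → ((- a) * b + a * b) * 1# ≈ 0# * (b * b)
  cross-inverseˡ = solve 2 (λ a b → ((:- a) :* b :+ a :* b) :* :1 := con (ℤ.+ 0) :* (b :* b)) refl

  cross-*-assoc : ∀ a b c d e f → ((a * c) * e) * (b * (d * f)) ≈ (a * (c * e)) * ((b * d) * f)
  cross-*-assoc = solve 6 (λ a b c d e f → ((a :* c) :* e) :* (b :* (d :* f)) := (a :* (c :* e)) :* ((b :* d) :* f)) refl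

  cross-*-comm : ∀ a b c d → (a * c) * (d * b) ≈ (c * a) * (b * d)
  cross-*-comm = solve 4 (λ a b c d → (a :* c) :* (d :* b) := (c :* a) :* (b :* d)) refl

  cross-*-identityˡ : ∀ a b → (1# * a) * b ≈ a * (1# * b)
  cross-*-identityˡ = solve 2 (λ a b → (:1 :* a) :* b := a :* (:1 :* b)) refl

  cross-distribʳ : ∀ e f a b c d → ((a * d + c * b) * e) * ((b * f) * (d * f)) ≈ ((a * e) * (d * f) + (c * e) * (b * f)) * (b * d * f)
  cross-distribʳ = solve 6 (λ e f a b c d → ((a :* d :+ c :* b) :* e) :* ((b :* f) :* (d :* f)) := ((a :* e) :* (d :* f) :+ (c :* e) :* (b :* f)) :* (b :* d :* f)) refl

  cross-embed-+ : ∀ a b → (a * 1# + b * 1#) * 1# ≈ (a + b) * (1# * 1#)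
  cross-embed-+ = solve 2 (λ a b → (a :* :1 :+ b :* :1) :* :1 := (a :+ b) :* (:1 :* :1)) refl

  cross-embed-* : ∀ a b → (a * b) * 1# ≈ (a * b) * (1# * 1#)
  cross-embed-* = solve 2 (λ a b → (a :* b) :* :1 := (a :* b) :* (:1 :* :1)) refl

  cross-inverse : ∀ a → (a * 1#) * 1# ≈ 1# * (1# * a)
  cross-inverse = solve 1 (λ a → (a :* :1) :* :1 := :1 :* (:1 :* a)) refl

private
  module L = CommutativeRing laurentRing
  module Cross = CrossMultiplication laurentRing

*ₚ-regular : ∀ {d d′} → Regular d → Regular d′ → Regular (d *ₚ d′)
*ₚ-regular {d} {d′} reg reg′ p eq =
  reg′ p (reg (d′ *ₚ p) (L.trans {d *ₚ (d′ *ₚ p)} {(d *ₚ d′) *ₚ p} {0ₚ} (L.sym {(d *ₚ d′) *ₚ p} {d *ₚ (d′ *ₚ p)} (L.*-assoc d d′ p)) eq))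

1ₚ-regular : Regular 1ₚ
1ₚ-regular p eq = L.trans {p} {1ₚ *ₚ p} {0ₚ} (L.sym {1ₚ *ₚ p} {p} (*ₚ-identityˡ p)) eq

RegularFrac : Set
RegularFrac = Σ Frac (λ x → Regular (den x))

private
  _+K_ _*K_ : RegularFrac → RegularFrac → RegularFrac
  (x , reg) +K (y , reg′) = (x +F y) , *ₚ-regular {den x} {den y} reg reg′
  (x , reg) *K (y , reg′) = (x *F y) , *ₚ-regular {den x} {den y} reg reg′

  -K_ : RegularFrac → RegularFrac
  -K ((a /ₓ b) , reg) = ((-ₚ a) /ₓ b) , reg

  0K 1K : RegularFrac
  0K = 0F , 1ₚ-regular
  1K = 1F , 1ₚ-regular

-- A record, because `_≈F_` unfolds to an equation between coefficients of products, from which the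
-- two fractions cannot be inferred.
record _≈K_ (x y : RegularFrac) : Set where
  constructor equal
  field unequal : proj₁ x ≈F proj₁ y
open _≈K_ public

private
  transK : ∀ {x y z} → x ≈K y → y ≈K z → x ≈K z
  transK {(a /ₓ b) , _} {(c /ₓ d) , reg} {(e /ₓ f) , _} (equal eq) (equal eq′) =
    equal (Cross.cross-trans {a} {b} {c} {d} {e} {f} reg eq eq′)

  +K-comm : ∀ x y → (x +K y) ≈K (y +K x)
  +K-comm ((a /ₓ b) , _) ((c /ₓ d) , _) = equal (Cross.cross-+-comm a b c d)

  *K-comm : ∀ x y → (x *K y) ≈K (y *K x)
  *K-comm ((a /ₓ b) , _) ((c /ₓ d) , _) = equal (Cross.cross-*-comm a b c d)

  +K-identityˡ : ∀ x → (0K +K x) ≈K x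
  +K-identityˡ ((a /ₓ b) , _) = equal (Cross.cross-+-identityˡ a b)

  *K-identityˡ : ∀ x → (1K *K x) ≈K x
  *K-identityˡ ((a /ₓ b) , _) = equal (Cross.cross-*-identityˡ a b)

  inverseˡK : ∀ x → ((-K x) +K x) ≈K 0K
  inverseˡK ((a /ₓ b) , _) = equal (Cross.cross-inverseˡ a b)

  distribʳK : ∀ x y z → ((y +K z) *K x) ≈K ((y *K x) +K (z *K x))
  distribʳK ((e /ₓ f) , _) ((a /ₓ b) , _) ((c /ₓ d) , _) = equal (Cross.cross-distribʳ e f a b c d)

  +K-cong : ∀ {x y u v} → x ≈K y → u ≈K v → (x +K u) ≈K (y +K v)
  +K-cong {(a /ₓ b) , _} {(a′ /ₓ b′) , _} {(c /ₓ d) , _} {(c′ /ₓ d′) , _} (equal eq) (equal eq′) =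
    equal (Cross.cross-+ {a} {b} {a′} {b′} {c} {d} {c′} {d′} eq eq′)

  *K-cong : ∀ {x y u v} → x ≈K y → u ≈K v → (x *K u) ≈K (y *K v)
  *K-cong {(a /ₓ b) , _} {(a′ /ₓ b′) , _} {(c /ₓ d) , _} {(c′ /ₓ d′) , _} (equal eq) (equal eq′) =
    equal (Cross.cross-* {a} {b} {a′} {b′} {c} {d} {c′} {d′} eq eq′)

  +K-assoc : ∀ x y z → ((x +K y) +K z) ≈K (x +K (y +K z))
  +K-assoc ((a /ₓ b) , _) ((c /ₓ d) , _) ((e /ₓ f) , _) = equal (Cross.cross-+-assoc a b c d e f)

  *K-assoc : ∀ x y z → ((x *K y) *K z) ≈K (x *K (y *K z))
  *K-assoc ((a /ₓ b) , _) ((c /ₓ d) , _) ((e /ₓ f) , _) = equal (Cross.cross-*-assoc a b c d e f)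

  -K-cong : ∀ {x y} → x ≈K y → (-K x) ≈K (-K y)
  -K-cong {(a /ₓ b) , _} {(a′ /ₓ b′) , _} (equal eq) = equal (Cross.cross-neg {a} {b} {a′} {b′} eq)

fractionRing : CommutativeRing _ _
fractionRing = record
  { Carrier = RegularFrac
  ; _≈_ = _≈K_ ; _+_ = _+K_ ; _*_ = _*K_ ; -_ = -K_ ; 0# = 0K ; 1# = 1K
  ; isCommutativeRing = record
    { isRing = record
      { +-isAbelianGroup = record
        { isGroup = record
          { isMonoid = record
            { isSemigroup = record
              { isMagma = record
                { isEquivalence = record
                  { refl = equal (λ _ → ≡.refl) ; sym = λ (equal eq) → equal (λ e → ≡.sym (eq e)) ; trans = transK }
                ; ∙-cong = +K-cong }
              ; assoc = +K-assoc }
            ; identity = +K-identityˡ , (λ x → transK (+K-comm x 0K) (+K-identityˡ x)) }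
          ; inverse = inverseˡK , (λ x → transK (+K-comm x (-K x)) (inverseˡK x))
          ; ⁻¹-cong = -K-cong }
        ; comm = +K-comm }
      ; *-cong = *K-cong
      ; *-assoc = *K-assoc
      ; *-identity = *K-identityˡ , (λ x → transK (*K-comm x 1K) (*K-identityˡ x))
      ; distrib = (λ x y z → transK (*K-comm x (y +K z)) (transK (distribʳK x y z) (+K-cong (*K-comm y x) (*K-comm z x)))) , distribʳK }
    ; *-comm = *K-comm } }

embed : LPoly → RegularFrac
embed p = fromPoly p , 1ₚ-regular

private module K = CommutativeRing fractionRing

embed-+ : ∀ p p′ → embed (p +ₚ p′) K.≈ embed p K.+ embed p′
embed-+ p p′ = K.sym (equal (Cross.cross-embed-+ p p′))

embed-* : ∀ p p′ → embed (p *ₚ p′) K.≈ embed p K.* embed p′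
embed-* p p′ = K.sym (equal (λ e → ≡.sym (Cross.cross-embed-* p p′ e)))

isOneMono-sound : ∀ m → isOneMono m ≡ false → m ≢ mono1
isOneMono-sound m () ≡.refl

private
  -- The test is an argument so that proofs can split on it. At `isOneMono m` the underlying
  -- fraction is `factor m` by computation, and likewise for `invFactorIf`; this later identifies
  -- `weight` with `wt` by `refl`.
  factorIf : Mono → Bool → RegularFrac
  factorIf m b = (if b then 1F else fromPoly (oneMinus m)) , regular b
    where
    regular : ∀ b → Regular (den (if b then 1F else fromPoly (oneMinus m)))
    regular true = 1ₚ-regular
    regular false = 1ₚ-regular

  invFactorIf : ∀ m b → isOneMono m ≡ b → RegularFrac
  invFactorIf m b eq = (if b then 1F else (1ₚ /ₓ oneMinus m)) , regular b eq
    where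
    regular : ∀ b → isOneMono m ≡ b → Regular (den (if b then 1F else (1ₚ /ₓ oneMinus m)))
    regular true _ = 1ₚ-regular
    regular false eq = oneMinus-regular m (isOneMono-sound m eq)

  factorIf-inverse : ∀ m b eq → factorIf m b K.* invFactorIf m b eq K.≈ K.1#
  factorIf-inverse m true eq = equal (λ e → ≡.refl)
  factorIf-inverse m false eq = equal (Cross.cross-inverse (oneMinus m))

factorK invFactorK : Mono → RegularFrac
factorK m = factorIf m (isOneMono m)
invFactorK m = invFactorIf m (isOneMono m) ≡.refl

factor-invFactor : ∀ m → factorK m K.* invFactorK m K.≈ K.1#
factor-invFactor m = factorIf-inverse m (isOneMono m) ≡.refl

factorK-false : ∀ m → isOneMono m ≡ false → factorK m K.≈ K.1# K.- embed (monoP m)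
factorK-false m eq = K.trans (K.reflexive (≡.cong (factorIf m) eq)) (K.trans K.refl (embed-+ 1ₚ (-ₚ monoP m)))

factorK-true : ∀ m → isOneMono m ≡ true → factorK m K.≈ K.1#
factorK-true m eq = K.reflexive (≡.cong (factorIf m) eq)

embed-monoMul : ∀ a b → embed (monoP (monoMul a b)) K.≈ embed (monoP a) K.* embed (monoP b)
embed-monoMul a b = embed-* (monoP a) (monoP b)

-- Finite sums and power series

-- One notion for sums and products in a ring, products of series, sums of numbers, and finite
-- conjunctions and disjunctions.
module BigOperator {c ℓ} (M : CommutativeMonoid c ℓ) where
  open CommutativeMonoid M
  open import Algebra.Properties.CommutativeSemigroup commutativeSemigroup using (interchange)
  open Relation.Binary.Reasoning.Setoid setoid

  private variable
    X Y : Set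

  big : List X → (X → Carrier) → Carrier
  big [] f = ε
  big (x ∷ xs) f = f x ∙ big xs f

  big-cong-All : ∀ {f g : X → Carrier} {xs} → All (λ x → f x ≈ g x) xs → big xs f ≈ big xs g
  big-cong-All [] = refl
  big-cong-All (eq ∷ eqs) = ∙-cong eq (big-cong-All eqs)

  big-cong : ∀ {f g : X → Carrier} xs → (∀ x → f x ≈ g x) → big xs f ≈ big xs g
  big-cong [] eq = refl
  big-cong (x ∷ xs) eq = ∙-cong (eq x) (big-cong xs eq)

  big-ε : ∀ (xs : List X) → big xs (λ _ → ε) ≈ ε
  big-ε [] = refl
  big-ε (x ∷ xs) = trans (identityˡ _) (big-ε xs)

  big-∙ : ∀ (xs : List X) f g → big xs (λ x → f x ∙ g x) ≈ big xs f ∙ big xs g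
  big-∙ [] f g = sym (identityˡ ε)
  big-∙ (x ∷ xs) f g = trans (∙-congˡ (big-∙ xs f g)) (interchange _ _ _ _)

  big-++ : ∀ (xs ys : List X) f → big (xs ++ ys) f ≈ big xs f ∙ big ys f
  big-++ [] ys f = sym (identityˡ _)
  big-++ (x ∷ xs) ys f = trans (∙-congˡ (big-++ xs ys f)) (sym (assoc _ _ _))

  big-map : ∀ (h : X → Y) xs f → big (map h xs) f ≡ big xs (f ∘ h)
  big-map h [] f = ≡.refl
  big-map h (x ∷ xs) f = ≡.cong (f (h x) ∙_) (big-map h xs f)

  big-concatMap : ∀ (h : X → List Y) xs f → big (concatMap h xs) f ≈ big xs (λ x → big (h x) f)
  big-concatMap h [] f = refl
  big-concatMap h (x ∷ xs) f = trans (big-++ (h x) (concatMap h xs) f) (∙-congˡ (big-concatMap h xs f))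

  big-swap : ∀ (xs : List X) (ys : List Y) (f : X → Y → Carrier) → big xs (λ x → big ys (f x)) ≈ big ys (λ y → big xs (λ x → f x y))
  big-swap [] ys f = sym (big-ε ys)
  big-swap (x ∷ xs) ys f = trans (∙-congˡ (big-swap xs ys f)) (sym (big-∙ ys (f x) _))

  big-filter : ∀ (p : X → Bool) xs f → big (filterᵇ p xs) f ≈ big xs (λ x → if p x then f x else ε)
  big-filter p [] f = refl
  big-filter p (x ∷ xs) f with p x
  ... | true = ∙-congˡ (big-filter p xs f)
  ... | false = trans (big-filter p xs f) (sym (identityˡ _))

  big-cartesianProduct : ∀ (xs : List X) (ys : List Y) f →
    big (cartesianProduct xs ys) f ≈ big xs (λ x → big ys (λ y → f (x , y)))
  big-cartesianProduct [] ys f = refl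
  big-cartesianProduct (x ∷ xs) ys f =
    trans (big-++ (map (x ,_) ys) _ f) (∙-cong (reflexive (big-map (x ,_) ys f)) (big-cartesianProduct xs ys f))

  big-allFin-suc : ∀ n (f : Fin (suc n) → Carrier) → big (allFin (suc n)) f ≈ f zero ∙ big (allFin n) (f ∘ suc)
  big-allFin-suc n f = ∙-congˡ (reflexive (≡.trans
    (≡.cong (λ xs → big xs f) (≡.sym (map-tabulate (λ i → i) suc))) (big-map suc (allFin n) f)))

  big-allFin-last : ∀ n (f : Fin (suc n) → Carrier) →
    big (allFin (suc n)) f ≈ big (allFin n) (f ∘ inject₁) ∙ f (fromℕ n)
  big-allFin-last zero f = trans (identityʳ _) (sym (identityˡ _))
  big-allFin-last (suc n) f = begin
    big (allFin (suc (suc n))) f ≈⟨ big-allFin-suc (suc n) f ⟩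
    f zero ∙ big (allFin (suc n)) (f ∘ suc) ≈⟨ ∙-congˡ (big-allFin-last n (f ∘ suc)) ⟩
    f zero ∙ (big (allFin n) (f ∘ suc ∘ inject₁) ∙ f (suc (fromℕ n))) ≈⟨ assoc _ _ _ ⟨
    f zero ∙ big (allFin n) (f ∘ inject₁ ∘ suc) ∙ f (fromℕ (suc n)) ≈⟨ ∙-congʳ (big-allFin-suc n (f ∘ inject₁)) ⟨
    _ ∎

module RingSums {c ℓ} (R : CommutativeRing c ℓ) where
  open CommutativeRing R
  module Σ′ = BigOperator +-commutativeMonoid
  module Π′ = BigOperator *-commutativeMonoid
  open Σ′ public using () renaming (big to sum)
  open Π′ public using () renaming (big to product)

  private variable
    X : Set

  *-sum : ∀ x (xs : List X) f → x * sum xs f ≈ sum xs (λ y → x * f y)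
  *-sum x [] f = zeroʳ x
  *-sum x (y ∷ xs) f = trans (distribˡ x _ _) (+-congˡ (*-sum x xs f))

module PowerSeries {c ℓ} (R : CommutativeRing c ℓ) where
  open CommutativeRing R
  open IntegerSolver R
  open Relation.Binary.Reasoning.Setoid setoid

  Series : Set c
  Series = ℕ → Carrier

  infix 4 _≋_
  _≋_ : Series → Series → Set ℓ
  f ≋ g = ∀ n → f n ≈ g n

  infixl 7 _⊛_
  _⊛_ : Series → Series → Series
  (f ⊛ g) zero = f 0 * g 0
  (f ⊛ g) (suc n) = f 0 * g (suc n) + ((f ∘ suc) ⊛ g) n

  δ : Series
  δ zero = 1#
  δ (suc n) = 0#

  ⊛-cong : ∀ {f f′ g g′} → f ≋ f′ → g ≋ g′ → f ⊛ g ≋ f′ ⊛ g′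
  ⊛-cong eq eq′ zero = *-cong (eq 0) (eq′ 0)
  ⊛-cong eq eq′ (suc n) = +-cong (*-cong (eq 0) (eq′ (suc n))) (⊛-cong (eq ∘ suc) eq′ n)

  -- The definition splits off the summand with `f 0`; this is the same recursion from the other
  -- end. Comparing the two gives `⊛-comm`.
  ⊛-last : ∀ f g n → (f ⊛ g) (suc n) ≈ (f ⊛ (g ∘ suc)) n + f (suc n) * g 0
  ⊛-last f g zero = refl
  ⊛-last f g (suc n) = trans (+-congˡ (⊛-last (f ∘ suc) g n)) (sym (+-assoc _ _ _))

  ⊛-comm : ∀ f g → f ⊛ g ≋ g ⊛ f
  ⊛-comm f g zero = *-comm _ _
  ⊛-comm f g (suc n) = begin
    f 0 * g (suc n) + ((f ∘ suc) ⊛ g) n ≈⟨ +-cong (*-comm _ _) (⊛-comm (f ∘ suc) g n) ⟩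
    g (suc n) * f 0 + (g ⊛ (f ∘ suc)) n ≈⟨ +-comm _ _ ⟩
    (g ⊛ (f ∘ suc)) n + g (suc n) * f 0 ≈⟨ ⊛-last g f n ⟨
    _ ∎

  ⊛-zeroˡ : ∀ {f} g → (∀ n → f n ≈ 0#) → ∀ n → (f ⊛ g) n ≈ 0#
  ⊛-zeroˡ g eq zero = trans (*-congʳ (eq 0)) (zeroˡ _)
  ⊛-zeroˡ g eq (suc n) = trans (+-cong (trans (*-congʳ (eq 0)) (zeroˡ _)) (⊛-zeroˡ g (eq ∘ suc) n)) (+-identityˡ 0#)

  ⊛-scaleˡ : ∀ x f g n → ((λ k → x * f k) ⊛ g) n ≈ x * (f ⊛ g) n
  ⊛-scaleˡ x f g zero = *-assoc _ _ _
  ⊛-scaleˡ x f g (suc n) = trans (+-cong (*-assoc _ _ _) (⊛-scaleˡ x (f ∘ suc) g n)) (sym (distribˡ _ _ _))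

  ⊛-distribʳ : ∀ f f′ g n → ((λ k → f k + f′ k) ⊛ g) n ≈ (f ⊛ g) n + (f′ ⊛ g) n
  ⊛-distribʳ f f′ g zero = distribʳ _ _ _
  ⊛-distribʳ f f′ g (suc n) = trans (+-cong (distribʳ _ _ _) (⊛-distribʳ (f ∘ suc) (f′ ∘ suc) g n))
    (solve 4 (λ a b c d → a :+ b :+ (c :+ d) := a :+ c :+ (b :+ d)) refl _ _ _ _)

  ⊛-assoc : ∀ f g h → (f ⊛ g) ⊛ h ≋ f ⊛ (g ⊛ h)
  ⊛-assoc f g h zero = *-assoc _ _ _
  ⊛-assoc f g h (suc n) = begin
    f 0 * g 0 * h (suc n) + ((λ k → f 0 * g (suc k) + ((f ∘ suc) ⊛ g) k) ⊛ h) n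
      ≈⟨ +-congˡ (⊛-distribʳ (λ k → f 0 * g (suc k)) _ h n) ⟩
    f 0 * g 0 * h (suc n) + (((λ k → f 0 * g (suc k)) ⊛ h) n + (((f ∘ suc) ⊛ g) ⊛ h) n)
      ≈⟨ +-congˡ (+-cong (⊛-scaleˡ (f 0) (g ∘ suc) h n) (⊛-assoc (f ∘ suc) g h n)) ⟩
    f 0 * g 0 * h (suc n) + (f 0 * ((g ∘ suc) ⊛ h) n + ((f ∘ suc) ⊛ (g ⊛ h)) n)
      ≈⟨ solve 5 (λ a b c d e → a :* b :* c :+ (a :* d :+ e) := a :* (b :* c :+ d) :+ e) refl _ _ _ _ _ ⟩
    f 0 * (g 0 * h (suc n) + ((g ∘ suc) ⊛ h) n) + ((f ∘ suc) ⊛ (g ⊛ h)) n ∎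

  ⊛-identityˡ : ∀ f → δ ⊛ f ≋ f
  ⊛-identityˡ f zero = *-identityˡ _
  ⊛-identityˡ f (suc n) = trans (+-cong (*-identityˡ _) (⊛-zeroˡ f (λ _ → refl) n)) (+-identityʳ _)

  ⊛-commutativeMonoid : CommutativeMonoid c ℓ
  ⊛-commutativeMonoid = record
    { Carrier = Series ; _≈_ = _≋_ ; _∙_ = _⊛_ ; ε = δ
    ; isCommutativeMonoid = record
      { isMonoid = record
        { isSemigroup = record
          { isMagma = record
            { isEquivalence = record
              { refl = λ _ → refl ; sym = λ eq n → sym (eq n) ; trans = λ eq eq′ n → trans (eq n) (eq′ n) }
            ; ∙-cong = ⊛-cong }
          ; assoc = ⊛-assoc }
        ; identity = ⊛-identityˡ , (λ f n → trans (⊛-comm f δ n) (⊛-identityˡ f n)) }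
      ; comm = ⊛-comm } }

  shift : Series → Series
  shift f zero = 0#
  shift f (suc n) = f n

  -- The series of 1 - x u and of 1 / (1 - x u).
  linear geometric : Carrier → Series
  linear x zero = 1#
  linear x (suc zero) = - x
  linear x (suc (suc n)) = 0#
  geometric x zero = 1#
  geometric x (suc n) = x * geometric x n

  shift-cong : ∀ {f g} → f ≋ g → shift f ≋ shift g
  shift-cong eq zero = refl
  shift-cong eq (suc n) = eq n

  linear-⊛ : ∀ x f n → (linear x ⊛ f) n ≈ f n - x * shift f n
  linear-⊛ x f zero = solve 2 (λ x f → :1 :* f := f :- x :* con (ℤ.+ 0)) refl _ _
  linear-⊛ x f (suc n) = trans (+-congˡ (tail n)) (solve 3 (λ x f g → :1 :* g :+ (:- (x :* f)) := g :- x :* f) refl _ _ _)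
    where
    tail : ∀ n → ((linear x ∘ suc) ⊛ f) n ≈ - (x * f n)
    tail zero = solve 2 (λ x f → (:- x) :* f := :- (x :* f)) refl _ _
    tail (suc n) = trans (+-congˡ (⊛-zeroˡ f (λ _ → refl) n))
      (solve 2 (λ x f → (:- x) :* f :+ con (ℤ.+ 0) := :- (x :* f)) refl _ _)

  geometric-⊛ : ∀ x f n → (geometric x ⊛ f) n ≈ f n + x * shift (geometric x ⊛ f) n
  geometric-⊛ x f zero = solve 2 (λ x f → :1 :* f := f :+ x :* con (ℤ.+ 0)) refl _ _
  geometric-⊛ x f (suc n) = +-cong (*-identityˡ _) (⊛-scaleˡ x (geometric x) f n)

  linear-geometric : ∀ x → linear x ⊛ geometric x ≋ δ
  linear-geometric x n = trans (linear-⊛ x (geometric x) n) (cancel n)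
    where
    cancel : ∀ n → geometric x n - x * shift (geometric x) n ≈ δ n
    cancel zero = solve 1 (λ x → :1 :- x :* con (ℤ.+ 0) := :1) refl x
    cancel (suc n) = -‿inverseʳ _

-- Partial fractions

⊘-injective : ∀ {x y} → y ⊘ x ≡ mono1 → y ≡ x
⊘-injective {x} {y} eq = ≡.trans (≡.sym (monoMul-⊘ x y)) (≡.trans (≡.cong (monoMul x) eq)
  (≡.trans (monoMul-comm x mono1) (monoMul-identityˡ x)))

⊘-distinct : ∀ {x y} → y ≢ x → isOneMono (y ⊘ x) ≡ false
⊘-distinct {x} {y} y≢x with isOneMono (y ⊘ x) in eq
... | false = ≡.refl
... | true = ⊥-elim (y≢x (⊘-injective (eqMono-sound (y ⊘ x) mono1 eq)))

-- What the argument uses of the fractions: the Laurent monomials `μ`, the factors 1 - m with the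
-- vanishing one replaced by 1 (`φ`), and the inverses of these factors (`ψ`).
record Torus {c ℓ} (R : CommutativeRing c ℓ) : Set (c Level.⊔ ℓ) where
  open CommutativeRing R
  field
    μ : Mono → Carrier
    μ-monoMul : ∀ a b → μ (monoMul a b) ≈ μ a * μ b
    μ-mono1 : μ mono1 ≈ 1#
    φ ψ : Mono → Carrier
    φψ : ∀ m → φ m * ψ m ≈ 1#
    φ-one : ∀ m → isOneMono m ≡ true → φ m ≈ 1#
    φ-other : ∀ m → isOneMono m ≡ false → φ m ≈ 1# - μ m

module PartialFractions {c ℓ} {R : CommutativeRing c ℓ} (T : Torus R) where
  open CommutativeRing R
  open Torus T
  open IntegerSolver R
  open RingSums R
  open PowerSeries R
  open Relation.Binary.Reasoning.Setoid setoid

  ψφ : ∀ m → ψ m * φ m ≈ 1#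
  ψφ m = trans (*-comm _ _) (φψ m)

  ψ-one : ∀ m → isOneMono m ≡ true → ψ m ≈ 1#
  ψ-one m eq = begin
    ψ m ≈⟨ *-identityˡ _ ⟨
    1# * ψ m ≈⟨ *-congʳ (φ-one m eq) ⟨
    φ m * ψ m ≈⟨ φψ m ⟩
    1# ∎

  μ-cong : ∀ {a b} → a ≡ b → μ a ≈ μ b
  μ-cong eq = reflexive (≡.cong μ eq)

  μ-inverse : ∀ x → μ x * μ (monoInv x) ≈ 1#
  μ-inverse x = trans (sym (μ-monoMul _ _)) (trans (μ-cong (monoMul-inverseʳ x)) μ-mono1)

  μ-⊘ : ∀ x y → μ x * μ (y ⊘ x) ≈ μ y
  μ-⊘ x y = trans (sym (μ-monoMul _ _)) (μ-cong (monoMul-⊘ x y))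

  ψ-difference : ∀ {x y} → y ≢ x → ψ (y ⊘ x) * (μ x - μ y) ≈ μ x
  ψ-difference {x} {y} y≢x = begin
    ψ (y ⊘ x) * (μ x - μ y) ≈⟨ *-congˡ (+-congˡ (-‿cong (μ-⊘ x y))) ⟨
    ψ (y ⊘ x) * (μ x - μ x * μ (y ⊘ x)) ≈⟨ solve 3 (λ p x y → p :* (x :- x :* y) := x :* (p :* (:1 :- y))) refl _ _ _ ⟩
    μ x * (ψ (y ⊘ x) * (1# - μ (y ⊘ x))) ≈⟨ *-congˡ (*-congˡ (φ-other _ (⊘-distinct y≢x))) ⟨
    μ x * (ψ (y ⊘ x) * φ (y ⊘ x)) ≈⟨ *-congˡ (ψφ _) ⟩
    μ x * 1# ≈⟨ *-identityʳ _ ⟩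
    μ x ∎

  -- The difference s - s′ = s (1 - s′/s) is a product of two units.
  difference-cancel : ∀ {s s′ a b} → s′ ≢ s → (μ s - μ s′) * a ≈ (μ s - μ s′) * b → a ≈ b
  difference-cancel {s} {s′} {a} {b} s′≢s eq = begin
    a ≈⟨ restore a ⟨
    μ (monoInv s) * (ψ (s′ ⊘ s) * ((μ s - μ s′) * a)) ≈⟨ *-congˡ (*-congˡ eq) ⟩
    μ (monoInv s) * (ψ (s′ ⊘ s) * ((μ s - μ s′) * b)) ≈⟨ restore b ⟩
    b ∎
    where
    restore : ∀ a → μ (monoInv s) * (ψ (s′ ⊘ s) * ((μ s - μ s′) * a)) ≈ a
    restore a = begin
      μ (monoInv s) * (ψ (s′ ⊘ s) * ((μ s - μ s′) * a))
        ≈⟨ solve 4 (λ i p d a → i :* (p :* (d :* a)) := i :* (p :* d) :* a) refl _ _ _ _ ⟩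
      μ (monoInv s) * (ψ (s′ ⊘ s) * (μ s - μ s′)) * a ≈⟨ *-congʳ (*-congˡ (ψ-difference s′≢s)) ⟩
      μ (monoInv s) * μ s * a ≈⟨ *-congʳ (trans (*-comm _ _) (μ-inverse s)) ⟩
      1# * a ≈⟨ *-identityˡ a ⟩
      a ∎

  -- Since ψ omits the vanishing factor, the product is 1 / Π (1 - y / x) over the y ≠ x in S.
  interpolate : List Mono → (Mono → Carrier) → Carrier
  interpolate S g = sum S (λ x → g x * product S (λ y → ψ (y ⊘ x)))

  interpolate-cong : ∀ S {g g′} → (∀ x → g x ≈ g′ x) → interpolate S g ≈ interpolate S g′
  interpolate-cong S eq = Σ′.big-cong S (λ x → *-congʳ (eq x))

  -- Over k nodes `interpolate S g` is the divided difference of x^(k-1) g(x), and this is the usual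
  -- recursion of divided differences; dropping a node lowers k, hence the extra factor x on the
  -- right.
  divided-difference : ∀ s s′ S g → Unique (s ∷ s′ ∷ S) →
    (μ s - μ s′) * interpolate (s ∷ s′ ∷ S) g ≈
    interpolate (s ∷ S) (λ x → μ x * g x) - interpolate (s′ ∷ S) (λ x → μ x * g x)
  divided-difference s s′ S g ((s≢s′ ∷ s≢S) ∷ s′≢S ∷ _) = begin
    (μ s - μ s′) * (g s * (ψ (s ⊘ s) * (ψ (s′ ⊘ s) * P s)) + (g s′ * (ψ (s ⊘ s′) * (ψ (s′ ⊘ s′) * P s′)) + Σ″))
      ≈⟨ solve 11 (λ s s′ gs p₁ p₂ q gs′ p₃ p₄ q′ r →
           (s :- s′) :* (gs :* (p₁ :* (p₂ :* q)) :+ (gs′ :* (p₃ :* (p₄ :* q′)) :+ r)) :=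
           p₂ :* (s :- s′) :* gs :* (p₁ :* q) :- p₃ :* (s′ :- s) :* gs′ :* (p₄ :* q′) :+ (s :- s′) :* r)
           refl (μ s) (μ s′) (g s) (ψ (s ⊘ s)) (ψ (s′ ⊘ s)) (P s) (g s′) (ψ (s ⊘ s′)) (ψ (s′ ⊘ s′)) (P s′) Σ″ ⟩
    ψ (s′ ⊘ s) * (μ s - μ s′) * g s * (ψ (s ⊘ s) * P s) - ψ (s ⊘ s′) * (μ s′ - μ s) * g s′ * (ψ (s′ ⊘ s′) * P s′)
      + (μ s - μ s′) * Σ″
      ≈⟨ +-cong (+-cong (*-congʳ (*-congʳ (ψ-difference (s≢s′ ∘ ≡.sym)))) (-‿cong (*-congʳ (*-congʳ (ψ-difference s≢s′))))) rest ⟩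
    H₁ - H₂ + (G₁ - G₂)
      ≈⟨ solve 4 (λ a b c d → a :- b :+ (c :- d) := a :+ c :- (b :+ d)) refl H₁ H₂ G₁ G₂ ⟩
    H₁ + G₁ - (H₂ + G₂) ∎
    where
    P : Mono → Carrier
    P x = product S (λ y → ψ (y ⊘ x))
    Σ″ = sum S (λ x → g x * (ψ (s ⊘ x) * (ψ (s′ ⊘ x) * P x)))
    H₁ = μ s * g s * (ψ (s ⊘ s) * P s)
    H₂ = μ s′ * g s′ * (ψ (s′ ⊘ s′) * P s′)
    G₁ = sum S (λ x → μ x * g x * (ψ (s ⊘ x) * P x))
    G₂ = sum S (λ x → μ x * g x * (ψ (s′ ⊘ x) * P x))
    -- With a = 1/(1 - s/x) and b = 1/(1 - s′/x) one has (s - s′) a b = x (a - b); the subtracted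
    -- term stands on the left here.
    summand : ∀ {x} → s ≢ x → s′ ≢ x →
      (μ s - μ s′) * (g x * (ψ (s ⊘ x) * (ψ (s′ ⊘ x) * P x))) + μ x * g x * (ψ (s′ ⊘ x) * P x) ≈ μ x * g x * (ψ (s ⊘ x) * P x)
    summand {x} s≢x s′≢x = begin
      (μ s - μ s′) * (g x * (a * (b * P x))) + μ x * g x * (b * P x)
        ≈⟨ solve 7 (λ x s s′ g a b p → (s :- s′) :* (g :* (a :* (b :* p))) :+ x :* g :* (b :* p) :=
                     b :* (x :- s′) :* a :* g :* p :- a :* (x :- s) :* b :* g :* p :+ x :* g :* (b :* p))
             refl (μ x) (μ s) (μ s′) (g x) a b (P x) ⟩
      b * (μ x - μ s′) * a * g x * P x - a * (μ x - μ s) * b * g x * P x + μ x * g x * (b * P x)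
        ≈⟨ +-congʳ (+-cong (*-congʳ (*-congʳ (*-congʳ (ψ-difference s′≢x)))) (-‿cong (*-congʳ (*-congʳ (*-congʳ (ψ-difference s≢x)))))) ⟩
      μ x * a * g x * P x - μ x * b * g x * P x + μ x * g x * (b * P x)
        ≈⟨ solve 5 (λ x a b g p → x :* a :* g :* p :- x :* b :* g :* p :+ x :* g :* (b :* p) := x :* g :* (a :* p)) refl (μ x) a b (g x) (P x) ⟩
      μ x * g x * (a * P x) ∎
      where
      a = ψ (s ⊘ x)
      b = ψ (s′ ⊘ x)
    rest : (μ s - μ s′) * Σ″ ≈ G₁ - G₂
    rest = begin
      (μ s - μ s′) * Σ″ ≈⟨ solve 2 (λ a d → a := a :+ d :- d) refl _ G₂ ⟩
      (μ s - μ s′) * Σ″ + G₂ - G₂ ≈⟨ +-congʳ (+-congʳ (*-sum (μ s - μ s′) S _)) ⟩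
      sum S (λ x → (μ s - μ s′) * (g x * (ψ (s ⊘ x) * (ψ (s′ ⊘ x) * P x)))) + G₂ - G₂ ≈⟨ +-congʳ (Σ′.big-∙ S _ _) ⟨
      sum S (λ x → (μ s - μ s′) * (g x * (ψ (s ⊘ x) * (ψ (s′ ⊘ x) * P x))) + μ x * g x * (ψ (s′ ⊘ x) * P x)) - G₂
        ≈⟨ +-congʳ (Σ′.big-cong-All (All.zipWith (λ (p , q) → summand p q) (s≢S , s′≢S))) ⟩
      G₁ - G₂ ∎

  -- u ^ |S| / Π (1 - s u)
  poles : List Mono → Series
  poles = foldr (λ s f → shift (geometric (μ s) ⊛ f)) δ

  poles-suc : ∀ s S m → poles (s ∷ S) (suc m) ≈ poles S m + μ s * poles (s ∷ S) m
  poles-suc s S m = geometric-⊛ (μ s) (poles S) m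

  -- It is (s - s′) u² / ((1 - s u)(1 - s′u)) = u/(1 - s u) - u/(1 - s′u), multiplied by `poles S`:
  -- the recursion of `divided-difference` again.
  poles-difference : ∀ s s′ S m → (μ s - μ s′) * poles (s ∷ s′ ∷ S) m ≈ poles (s ∷ S) m - poles (s′ ∷ S) m
  poles-difference s s′ S zero = solve 2 (λ s s′ → (s :- s′) :* con (ℤ.+ 0) := con (ℤ.+ 0) :- con (ℤ.+ 0)) refl _ _
  poles-difference s s′ S (suc m) = begin
    (μ s - μ s′) * poles (s ∷ s′ ∷ S) (suc m) ≈⟨ *-congˡ (poles-suc s (s′ ∷ S) m) ⟩
    (μ s - μ s′) * (poles (s′ ∷ S) m + μ s * poles (s ∷ s′ ∷ S) m)
      ≈⟨ solve 4 (λ s s′ e f → (s :- s′) :* (e :+ s :* f) := (s :- s′) :* e :+ s :* ((s :- s′) :* f)) refl _ _ _ _ ⟩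
    (μ s - μ s′) * poles (s′ ∷ S) m + μ s * ((μ s - μ s′) * poles (s ∷ s′ ∷ S) m) ≈⟨ +-congˡ (*-congˡ (poles-difference s s′ S m)) ⟩
    (μ s - μ s′) * poles (s′ ∷ S) m + μ s * (poles (s ∷ S) m - poles (s′ ∷ S) m)
      ≈⟨ solve 5 (λ s s′ e f g → (s :- s′) :* e :+ s :* (f :- e) := g :+ s :* f :- (g :+ s′ :* e)) refl _ _ _ _ (poles S m) ⟩
    poles S m + μ s * poles (s ∷ S) m - (poles S m + μ s′ * poles (s′ ∷ S) m)
      ≈⟨ +-cong (poles-suc s S m) (-‿cong (poles-suc s′ S m)) ⟨
    _ ∎

  power power⁻¹ : Mono → Series
  power x = geometric (μ x)
  power⁻¹ x = geometric (μ (monoInv x))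

  -- The divided difference of x^m over k nodes is the complete homogeneous symmetric polynomial of
  -- degree m + 1 - k in them. Both sides satisfy the same recursion. The exponent starts at m + 1,
  -- since at 0 the left side would be a divided difference of 1/x.
  interpolate-power : ∀ s S m → Unique (s ∷ S) →
    interpolate (s ∷ S) (λ x → power x (suc m) * power⁻¹ x (length (s ∷ S))) ≈ poles (s ∷ S) (suc m)
  interpolate-power s [] m _ = begin
    μ s * power s m * (μ (monoInv s) * 1#) * (ψ (s ⊘ s) * 1#) + 0#
      ≈⟨ +-congʳ (*-congˡ (*-congʳ (ψ-one (s ⊘ s) (eqMono-complete (monoMul-inverseʳ s))))) ⟩
    μ s * power s m * (μ (monoInv s) * 1#) * (1# * 1#) + 0#
      ≈⟨ solve 3 (λ s p i → s :* p :* (i :* :1) :* (:1 :* :1) :+ con (ℤ.+ 0) := (s :* i) :* p) refl _ _ _ ⟩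
    μ s * μ (monoInv s) * power s m ≈⟨ *-congʳ (μ-inverse s) ⟩
    1# * power s m ≈⟨ *-identityˡ _ ⟩
    power s m ≈⟨ ⊛-identityˡ (power s) m ⟨
    (δ ⊛ power s) m ≈⟨ ⊛-comm δ (power s) m ⟩
    (power s ⊛ δ) m ∎
  interpolate-power s (s′ ∷ S) m unique@((s≢s′ ∷ s≢S) ∷ s′≢S ∷ S-unique) = difference-cancel (s≢s′ ∘ ≡.sym) (begin
    (μ s - μ s′) * interpolate (s ∷ s′ ∷ S) (λ x → power x (suc m) * power⁻¹ x (2 ℕ.+ length S))
      ≈⟨ divided-difference s s′ S _ unique ⟩
    interpolate (s ∷ S) (λ x → μ x * (power x (suc m) * power⁻¹ x (2 ℕ.+ length S))) -
    interpolate (s′ ∷ S) (λ x → μ x * (power x (suc m) * power⁻¹ x (2 ℕ.+ length S)))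
      ≈⟨ +-cong (interpolate-cong (s ∷ S) absorb) (-‿cong (interpolate-cong (s′ ∷ S) absorb)) ⟩
    interpolate (s ∷ S) (λ x → power x (suc m) * power⁻¹ x (suc (length S))) -
    interpolate (s′ ∷ S) (λ x → power x (suc m) * power⁻¹ x (suc (length S)))
      ≈⟨ +-cong (interpolate-power s S m (s≢S ∷ S-unique)) (-‿cong (interpolate-power s′ S m (s′≢S ∷ S-unique))) ⟩
    poles (s ∷ S) (suc m) - poles (s′ ∷ S) (suc m) ≈⟨ poles-difference s s′ S (suc m) ⟨
    (μ s - μ s′) * poles (s ∷ s′ ∷ S) (suc m) ∎)
    where
    absorb : ∀ x → μ x * (power x (suc m) * power⁻¹ x (2 ℕ.+ length S)) ≈ power x (suc m) * power⁻¹ x (suc (length S))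
    absorb x = begin
      μ x * (power x (suc m) * (μ (monoInv x) * power⁻¹ x (suc (length S))))
        ≈⟨ solve 4 (λ x p i q → x :* (p :* (i :* q)) := x :* i :* (p :* q)) refl _ _ _ _ ⟩
      μ x * μ (monoInv x) * (power x (suc m) * power⁻¹ x (suc (length S))) ≈⟨ *-congʳ (μ-inverse x) ⟩
      1# * (power x (suc m) * power⁻¹ x (suc (length S))) ≈⟨ *-identityˡ _ ⟩
      _ ∎

  -- multiplication by (1 - r u) / u
  zeroStep : Mono → Series → Series
  zeroStep r f m = f (suc m) - μ r * f m

  zeroSteps : List Mono → Series → Series
  zeroSteps R f = foldr zeroStep f R

  zeroSteps-cong : ∀ R {f g} → f ≋ g → zeroSteps R f ≋ zeroSteps R g
  zeroSteps-cong [] eq = eq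
  zeroSteps-cong (r ∷ R) eq m = +-cong (zeroSteps-cong R eq (suc m)) (-‿cong (*-congˡ (zeroSteps-cong R eq m)))

  -- The powers x^|R| turn each factor 1 - r/x into x - r, which is linear in r and in x.
  numerator : List Mono → ℕ → ℕ → Mono → Carrier
  numerator R k m x = power x (suc m) * power⁻¹ x k * power x (length R) * product R (λ r → 1# - μ (r ⊘ x))

  -- Expand x - r for one zero at a time: the x raises m by one and the r is a scalar, just as in
  -- `zeroStep`.
  interpolate-numerator : ∀ R s S m → Unique (s ∷ S) →
    interpolate (s ∷ S) (numerator R (length (s ∷ S)) m) ≈ zeroSteps R (poles (s ∷ S) ∘ suc) m
  interpolate-numerator [] s S m unique = trans
    (interpolate-cong (s ∷ S) (λ x → solve 2 (λ a b → a :* b :* :1 :* :1 := a :* b) refl (power x (suc m)) (power⁻¹ x (length (s ∷ S)))))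
    (interpolate-power s S m unique)
  interpolate-numerator (r ∷ R) s S m unique = begin
    interpolate (s ∷ S) (numerator (r ∷ R) k m) ≈⟨ interpolate-cong (s ∷ S) split ⟩
    interpolate (s ∷ S) (λ x → numerator R k (suc m) x - μ r * numerator R k m x)
      ≈⟨ Σ′.big-cong (s ∷ S) (λ x → solve 4 (λ a b c d → (a :- b :* c) :* d := a :* d :+ (:- b) :* (c :* d)) refl
           (numerator R k (suc m) x) (μ r) (numerator R k m x) (product (s ∷ S) (λ y → ψ (y ⊘ x)))) ⟩
    sum (s ∷ S) (λ x → numerator R k (suc m) x * product (s ∷ S) (λ y → ψ (y ⊘ x))
                       + - μ r * (numerator R k m x * product (s ∷ S) (λ y → ψ (y ⊘ x))))
      ≈⟨ Σ′.big-∙ (s ∷ S) _ _ ⟩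
    interpolate (s ∷ S) (numerator R k (suc m))
      + sum (s ∷ S) (λ x → - μ r * (numerator R k m x * product (s ∷ S) (λ y → ψ (y ⊘ x))))
      ≈⟨ +-congˡ (*-sum (- μ r) (s ∷ S) _) ⟨
    interpolate (s ∷ S) (numerator R k (suc m)) + - μ r * interpolate (s ∷ S) (numerator R k m)
      ≈⟨ +-cong (interpolate-numerator R s S (suc m) unique) (*-congˡ (interpolate-numerator R s S m unique)) ⟩
    zeroSteps R (poles (s ∷ S) ∘ suc) (suc m) + - μ r * zeroSteps R (poles (s ∷ S) ∘ suc) m
      ≈⟨ solve 3 (λ a b c → a :+ (:- b) :* c := a :- b :* c) refl _ _ _ ⟩
    _ ∎
    where
    k = length (s ∷ S)
    split : ∀ x → numerator (r ∷ R) k m x ≈ numerator R k (suc m) x - μ r * numerator R k m x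
    split x = begin
      power x (suc m) * power⁻¹ x k * (μ x * power x (length R)) * ((1# - μ (r ⊘ x)) * p)
        ≈⟨ solve 6 (λ a b x c r p → a :* b :* (x :* c) :* ((:1 :- r) :* p) := x :* a :* b :* c :* p :- (x :* r) :* (a :* b :* c :* p))
             refl (power x (suc m)) (power⁻¹ x k) (μ x) (power x (length R)) (μ (r ⊘ x)) p ⟩
      numerator R k (suc m) x - μ x * μ (r ⊘ x) * numerator R k m x ≈⟨ +-congˡ (-‿cong (*-congʳ (μ-⊘ x r))) ⟩
      numerator R k (suc m) x - μ r * numerator R k m x ∎
      where p = product R (λ r → 1# - μ (r ⊘ x))

  module Series′ = BigOperator ⊛-commutativeMonoid

  shifts : ℕ → Series → Series
  shifts zero f = f
  shifts (suc k) f = shift (shifts k f)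

  ⊛-shift : ∀ f g → f ⊛ shift g ≋ shift (f ⊛ g)
  ⊛-shift f g n = trans (⊛-comm f (shift g) n) (trans (shiftˡ n) (shift-cong (⊛-comm g f) n))
    where
    shiftˡ : shift g ⊛ f ≋ shift (g ⊛ f)
    shiftˡ zero = zeroˡ _
    shiftˡ (suc n) = trans (+-congʳ (zeroˡ _)) (+-identityˡ _)

  ⊛-shifts : ∀ k f g → f ⊛ shifts k g ≋ shifts k (f ⊛ g)
  ⊛-shifts zero f g n = refl
  ⊛-shifts (suc k) f g n = trans (⊛-shift f (shifts k g) n) (shift-cong (⊛-shifts k f g) n)

  poles-product : ∀ S → poles S ≋ shifts (length S) (Series′.big S power)
  poles-product [] n = refl
  poles-product (s ∷ S) = shift-cong (λ n → trans (⊛-cong (λ _ → refl) (poles-product S) n) (⊛-shifts (length S) _ _ n))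

  -- Each of the |R| steps multiplies by 1 - r u and uses up one of the |R| + 1 powers of u, so that
  -- a single shift remains.
  zeroSteps-product : ∀ R f → zeroSteps R (shifts (suc (length R)) f) ≋ shift (Series′.big R (linear ∘ μ) ⊛ f)
  zeroSteps-product [] f = shift-cong (λ n → sym (⊛-identityˡ f n))
  zeroSteps-product (r ∷ R) f m = begin
    zeroStep r (zeroSteps R (shifts (2 ℕ.+ length R) f)) m
      ≈⟨ zeroSteps-cong (r ∷ []) (zeroSteps-cong R (λ n → reflexive (≡.cong (λ h → h n) (shift-shifts (suc (length R)))))) m ⟩
    zeroStep r (zeroSteps R (shifts (suc (length R)) (shift f))) m
      ≈⟨ zeroSteps-cong (r ∷ []) (zeroSteps-product R (shift f)) m ⟩
    zeroStep r (shift (Π ⊛ shift f)) m ≈⟨ linear-⊛ (μ r) (Π ⊛ shift f) m ⟨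
    (linear (μ r) ⊛ (Π ⊛ shift f)) m ≈⟨ ⊛-assoc (linear (μ r)) Π (shift f) m ⟨
    ((linear (μ r) ⊛ Π) ⊛ shift f) m ≈⟨ ⊛-shift (linear (μ r) ⊛ Π) f m ⟩
    _ ∎
    where
    Π = Series′.big R (linear ∘ μ)
    shift-shifts : ∀ k → shift (shifts k f) ≡ shifts k (shift f)
    shift-shifts zero = ≡.refl
    shift-shifts (suc k) = ≡.cong shift (shift-shifts k)

  power-cancel : ∀ x k a → power x (suc (suc a)) * power⁻¹ x (2 ℕ.+ k) * power x k ≈ power x a
  power-cancel x zero a = begin
    μ x * (μ x * p) * (i * (i * 1#)) * 1# ≈⟨ solve 3 (λ x i p → x :* (x :* p) :* (i :* (i :* :1)) :* :1 := x :* i :* (x :* i) :* p) refl _ _ _ ⟩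
    μ x * i * (μ x * i) * p ≈⟨ *-congʳ (*-cong (μ-inverse x) (μ-inverse x)) ⟩
    1# * 1# * p ≈⟨ trans (*-congʳ (*-identityˡ 1#)) (*-identityˡ p) ⟩
    p ∎
    where
    i = μ (monoInv x)
    p = power x a
  power-cancel x (suc k) a = begin
    p * (i * q) * (μ x * r) ≈⟨ solve 5 (λ p i q x r → p :* (i :* q) :* (x :* r) := x :* i :* (p :* q :* r)) refl p i q (μ x) r ⟩
    μ x * i * (p * q * r) ≈⟨ *-congʳ (μ-inverse x) ⟩
    1# * (p * q * r) ≈⟨ *-identityˡ _ ⟩
    p * q * r ≈⟨ power-cancel x k a ⟩
    power x a ∎
    where
    i = μ (monoInv x)
    p = power x (suc (suc a))
    q = power⁻¹ x (2 ℕ.+ k)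
    r = power x k

  -- The left side sums s^a times the coefficient of 1/(1 - s u) in Π (1 - r u) / Π (1 - s u). Since
  -- no r equals an s, each `φ` is the true factor 1 - r/s. The previous lemmas are used at m = a +
  -- 1, where the exponent a + 2 - |S| + |R| of x equals a.
  partial-fractions : ∀ S R a → Unique S → length S ≡ 2 ℕ.+ length R → All (λ r → All (λ s → r ≢ s) S) R →
    sum S (λ s → power s a * (product R (λ r → φ (r ⊘ s)) * product S (λ y → ψ (y ⊘ s)))) ≈
    (Series′.big R (linear ∘ μ) ⊛ Series′.big S power) a
  partial-fractions [] R a _ () _
  partial-fractions S@(s ∷ S₁) R a unique size disjoint = begin
    sum S (λ x → power x a * (product R (λ r → φ (r ⊘ x)) * product S (λ y → ψ (y ⊘ x))))
      ≈⟨ Σ′.big-cong-All (All.tabulate (λ {x} x∈S → trans (*-congˡ (*-congʳ (Π′.big-cong-All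
           (All.map (λ {r} r≢ → φ-other (r ⊘ x) (⊘-distinct (All.lookup r≢ x∈S))) disjoint))))
           (trans (sym (*-assoc _ _ _)) (*-congʳ (*-congʳ (sym (degree x))))))) ⟩
    interpolate S (numerator R (length S) (suc a)) ≈⟨ interpolate-numerator R s S₁ (suc a) unique ⟩
    zeroSteps R (poles S ∘ suc) (suc a) ≈⟨ zeroSteps-cong R (λ n → poles-product S (suc n)) (suc a) ⟩
    zeroSteps R (shifts (length S) P ∘ suc) (suc a)
      ≡⟨ ≡.cong (λ k → zeroSteps R (shifts k P ∘ suc) (suc a)) size ⟩
    zeroSteps R (shifts (suc (length R)) P) (suc a) ≈⟨ zeroSteps-product R P (suc a) ⟩
    _ ∎
    where
    P = Series′.big S power
    degree : ∀ x → power x (suc (suc a)) * power⁻¹ x (length S) * power x (length R) ≈ power x a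
    degree x = trans (reflexive (≡.cong (λ k → power x (suc (suc a)) * power⁻¹ x k * power x (length R)) size)) (power-cancel x (length R) a)

-- The generating series of A and B

module TeslerSeries {c ℓ} {R : CommutativeRing c ℓ} (T : Torus R) where
  open CommutativeRing R
  open Torus T
  open PartialFractions T
  open IntegerSolver R
  open RingSums R
  open PowerSeries R
  open Relation.Binary.Reasoning.Setoid setoid

  q t : Carrier
  q = μ monoQ
  t = μ monoT

  qt-int : ℕ → Carrier
  qt-int m = sum (upTo m) (λ k → μ (+ (m ℕ.∸ 1 ℕ.∸ k) , + k))

  coefA coefB : ℕ → Carrier
  coefA zero = 1#
  coefA (suc m) = - (((1# - q) * (1# - t)) * qt-int (suc m))
  coefB m = qt-int (suc m) - qt-int m

  power-Q : ∀ m → μ (+ m , + 0) ≈ power monoQ m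
  power-Q zero = μ-mono1
  power-Q (suc m) = trans (μ-monoMul monoQ (+ m , + 0)) (*-congˡ (power-Q m))

  qt-int-suc : ∀ m → qt-int (suc m) ≈ power monoQ m + t * qt-int m
  qt-int-suc m = +-cong (power-Q m) (begin
    sum (applyUpTo suc m) g ≡⟨ ≡.cong (λ xs → sum xs g) (≡.sym (map-applyUpTo (λ k → k) suc m)) ⟩
    sum (map suc (upTo m)) g ≡⟨ Σ′.big-map suc (upTo m) g ⟩
    sum (upTo m) (g ∘ suc) ≈⟨ Σ′.big-cong (upTo m) term ⟩
    sum (upTo m) (λ k → t * μ (+ (m ℕ.∸ 1 ℕ.∸ k) , + k)) ≈⟨ *-sum t (upTo m) _ ⟨
    t * qt-int m ∎)
    where
    g : ℕ → Carrier
    g k = μ (+ (m ℕ.∸ k) , + k)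
    term : ∀ k → g (suc k) ≈ t * μ (+ (m ℕ.∸ 1 ℕ.∸ k) , + k)
    term k = trans (μ-cong (≡.cong (λ i → (+ i , + suc k)) (≡.sym (ℕP.∸-+-assoc m 1 k)))) (μ-monoMul monoT _)

  -- The numbers [m+1] have the generating series 1 / ((1 - q u)(1 - t u)), by the recursion
  -- `qt-int-suc`; here u is scaled by x.
  poles-qt : ∀ x → power (monoMul monoT x) ⊛ power (monoMul monoQ x) ≋ λ m → qt-int (suc m) * power x m
  poles-qt x zero = begin
    1# * 1# ≈⟨ solve 0 (:1 :* :1 := (:1 :+ con (+ 0)) :* :1) refl ⟩
    (1# + 0#) * 1# ≈⟨ *-congʳ (+-congʳ (sym μ-mono1)) ⟩
    qt-int 1 * 1# ∎
  poles-qt x (suc m) = begin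
    (power tx ⊛ power qx) (suc m) ≈⟨ geometric-⊛ (μ tx) (power qx) (suc m) ⟩
    power qx (suc m) + μ tx * (power tx ⊛ power qx) m ≈⟨ +-cong (power-monoMul monoQ x (suc m)) (*-cong (μ-monoMul _ _) (poles-qt x m)) ⟩
    power monoQ (suc m) * power x (suc m) + t * μ x * (qt-int (suc m) * power x m)
      ≈⟨ solve 5 (λ p t x c y → p :* (x :* y) :+ t :* x :* (c :* y) := (p :+ t :* c) :* (x :* y)) refl _ _ _ _ _ ⟩
    (power monoQ (suc m) + t * qt-int (suc m)) * power x (suc m) ≈⟨ *-congʳ (qt-int-suc (suc m)) ⟨
    _ ∎
    where
    tx = monoMul monoT x
    qx = monoMul monoQ x
    power-monoMul : ∀ a x k → power (monoMul a x) k ≈ power a k * power x k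
    power-monoMul a x zero = sym (*-identityˡ 1#)
    power-monoMul a x (suc k) = trans (*-cong (μ-monoMul a x) (power-monoMul a x k))
      (solve 4 (λ a x p q → a :* x :* (p :* q) := a :* p :* (x :* q)) refl _ _ _ _)

  seriesA seriesB : Mono → Series
  seriesA x m = coefA m * power x m
  seriesB x m = coefB m * power x m

  seriesB-product : ∀ x →
    linear (μ x) ⊛ (power (monoMul monoT x) ⊛ power (monoMul monoQ x)) ≋ seriesB x
  seriesB-product x m = trans (⊛-cong (λ _ → refl) (poles-qt x) m) (trans (linear-⊛ (μ x) _ m) (coefficient m))
    where
    coefficient : ∀ m → qt-int (suc m) * power x m - μ x * shift (λ m → qt-int (suc m) * power x m) m ≈ seriesB x m
    coefficient zero = solve 2 (λ x c → c :* :1 :- x :* con (+ 0) := (c :- con (+ 0)) :* :1) refl _ _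
    coefficient (suc m) = solve 4 (λ c d x y → c :* (x :* y) :- x :* (d :* y) := (c :- d) :* (x :* y)) refl _ _ _ _

  -- The series of A is that of B times 1 - qtz. This is why the entries next to the diagonal carry
  -- B: for the last box that factor is cancelled by the pole 1 - qt z_{n-1}/z, for all other boxes
  -- it survives.
  seriesA-product : ∀ x → linear (μ (monoMul monoQT x)) ⊛ seriesB x ≋ seriesA x
  seriesA-product x m = trans (linear-⊛ (μ (monoMul monoQT x)) (seriesB x) m) (trans (+-congˡ (-‿cong (*-congʳ qtx))) (coefficient m))
    where
    qtx : μ (monoMul monoQT x) ≈ q * t * μ x
    qtx = trans (μ-monoMul _ _) (*-congʳ (μ-monoMul monoQ monoT))
    coefficient : ∀ m → seriesB x m - q * t * μ x * shift (seriesB x) m ≈ seriesA x m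
    coefficient zero = begin
      (qt-int 1 - 0#) * 1# - q * t * μ x * 0# ≈⟨ +-congʳ (*-congʳ (+-congʳ (+-congʳ μ-mono1))) ⟩
      (1# + 0# - 0#) * 1# - q * t * μ x * 0#
        ≈⟨ solve 3 (λ q t x → (:1 :+ con (+ 0) :- con (+ 0)) :* :1 :- q :* t :* x :* con (+ 0) := :1 :* :1) refl _ _ _ ⟩
      1# * 1# ∎
    coefficient (suc m) = begin
      (qt-int (suc (suc m)) - qt-int (suc m)) * (μ x * y) - q * t * μ x * ((qt-int (suc m) - qt-int m) * y)
        ≈⟨ solve 7 (λ e d c q t x y → (e :- d) :* (x :* y) :- q :* t :* x :* ((d :- c) :* y) :=
             (e :- d :- q :* t :* d :+ q :* (t :* c)) :* (x :* y)) refl _ _ _ _ _ _ _ ⟩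
      (qt-int (suc (suc m)) - d - q * t * d + q * (t * qt-int m)) * (μ x * y) ≈⟨ *-congʳ (+-cong (+-congʳ (+-congʳ (qt-int-suc (suc m)))) (*-congˡ tc)) ⟩
      (q * p + t * d - d - q * t * d + q * (d - p)) * (μ x * y)
        ≈⟨ solve 6 (λ q p t d x y → (q :* p :+ t :* d :- d :- q :* t :* d :+ q :* (d :- p)) :* (x :* y) :=
             (:- ((:1 :- q) :* (:1 :- t) :* d)) :* (x :* y)) refl _ _ _ _ _ _ ⟩
      _ ∎
      where
      y = power x m
      p = power monoQ m
      d = qt-int (suc m)
      -- The recursion of [m] solved for t [m]; with the recursion for [m+2] everything is expressed
      -- by d = [m+1] and p = q^m.
      tc : t * qt-int m ≈ d - p
      tc = begin
        t * qt-int m ≈⟨ solve 2 (λ c p → c := p :+ c :- p) refl _ p ⟩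
        p + t * qt-int m - p ≈⟨ +-congʳ (qt-int-suc m) ⟨
        d - p ∎

-- Telescoping over the cells of a tableau

private variable
  X : Set

any-sound : ∀ (b : X → Bool) xs → any b xs ≡ true → ∃ λ x → b x ≡ true
any-sound b (x ∷ xs) eq with b x in bx
... | true = x , bx
... | false = any-sound b xs eq

any-complete : ∀ (b : X → Bool) {xs x} → x ∈ xs → b x ≡ true → any b xs ≡ true
any-complete b (here ≡.refl) eq rewrite eq = ≡.refl
any-complete b {y ∷ ys} (there x∈ys) eq = ≡.trans (≡.cong (b y ∨_) (any-complete b x∈ys eq)) (∨-zeroʳ (b y))

any-allFin-complete : ∀ {n} (b : Fin n → Bool) i → b i ≡ true → any b (allFin n) ≡ true
any-allFin-complete b i = any-complete b (∈-allFin i)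

≡ᵇ-sound : ∀ {m n} → (m ≡ᵇ n) ≡ true → m ≡ n
≡ᵇ-sound {m} {n} eq = ℕP.≡ᵇ⇒≡ m n (Equivalence.from T-≡ eq)

≡ᵇ-refl : ∀ n → (n ≡ᵇ n) ≡ true
≡ᵇ-refl zero = ≡.refl
≡ᵇ-refl (suc n) = ≡ᵇ-refl n

∧-trueˡ : ∀ {a b} → a ∧ b ≡ true → a ≡ true
∧-trueˡ {true} eq = ≡.refl

∧-trueʳ : ∀ {a b} → a ∧ b ≡ true → b ≡ true
∧-trueʳ {true} eq = eq

eqCell-sound : ∀ x y → eqCell x y ≡ true → x ≡ y
eqCell-sound (r , c) (r′ , c′) eq = ≡.cong₂ _,_ (≡ᵇ-sound (∧-trueˡ eq)) (≡ᵇ-sound (∧-trueʳ {r ≡ᵇ r′} eq))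

eqCell-refl : ∀ x → eqCell x x ≡ true
eqCell-refl (r , c) rewrite ≡ᵇ-refl r = ≡ᵇ-refl c

eqCell-sym : ∀ x y → eqCell x y ≡ eqCell y x
eqCell-sym x y = true-⇔⇒≡ (λ eq → flip (≡.sym (eqCell-sound x y eq))) (λ eq → flip (≡.sym (eqCell-sound y x eq)))
  where
  flip : ∀ {x y} → x ≡ y → eqCell x y ≡ true
  flip {x} ≡.refl = eqCell-refl x

occupied : ∀ {n} → Vec Cell n → Cell → Bool
occupied {n} T x = any (λ j → eqCell (lookup T j) x) (allFin n)

record Tableau {n} (T : Vec Cell n) : Set where
  field
    positive : ∀ i → ∃ λ r → ∃ λ c → lookup T i ≡ (suc r , suc c)
    distinct : ∀ i j → lookup T i ≡ lookup T j → i ≡ j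
    left : ∀ i {r c} → lookup T i ≡ (r , suc (suc c)) → ∃ λ j → toℕ j < toℕ i × lookup T j ≡ (r , suc c)
    down : ∀ i {r c} → lookup T i ≡ (suc (suc r) , c) → ∃ λ j → toℕ j < toℕ i × lookup T j ≡ (suc r , c)

-- The conditions of `addable` are exactly those that `isSYT` imposes on one more, largest, entry;
-- see `isSYT-last`.
addable corner : ∀ {n} → Vec Cell n → Cell → Bool
addable T (r , c) = (not (r ≡ᵇ 0) ∧ not (c ≡ᵇ 0)) ∧ (not (occupied T (r , c))
  ∧ (((c ≡ᵇ 1) ∨ occupied T (r , c ℕ.∸ 1)) ∧ ((r ≡ᵇ 1) ∨ occupied T (r ℕ.∸ 1 , c))))
-- the box diagonally below (r , c) is a removable corner
corner T (r , c) = occupied T (r ℕ.∸ 1 , c ℕ.∸ 1)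
  ∧ (not (occupied T (r , c ℕ.∸ 1)) ∧ not (occupied T (r ℕ.∸ 1 , c)))

diagonal : Cell → Cell
diagonal (r , c) = suc r , suc c

Positive : Cell → Set
Positive x = ∃ λ r → ∃ λ c → x ≡ (suc r , suc c)

cellsUpTo-positive : ∀ N → All Positive (cellsUpTo N)
cellsUpTo-positive N = All.tabulate pos
  where
  pos : ∀ {x} → x ∈ cellsUpTo N → Positive x
  pos x∈ with ∈-cartesianProduct⁻ (map suc (upTo N)) (map suc (upTo N)) x∈
  ... | r∈ , c∈ with ∈-map⁻ suc r∈ | ∈-map⁻ suc c∈
  ... | r , _ , ≡.refl | c , _ , ≡.refl = r , c , ≡.refl

cellsUpTo-complete : ∀ {N r c} → r < N → c < N → (suc r , suc c) ∈ cellsUpTo N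
cellsUpTo-complete r<N c<N = ∈-cartesianProduct⁺ (∈-map⁺ suc (∈-upTo⁺ r<N)) (∈-map⁺ suc (∈-upTo⁺ c<N))

cellsUpTo-unique : ∀ N → Unique (cellsUpTo N)
cellsUpTo-unique N = UniqueP.cartesianProduct⁺ rows rows
  where rows = UniqueP.map⁺ ℕP.suc-injective (UniqueP.upTo⁺ N)

module _ {n} {T : Vec Cell n} where

  occupied-sound : ∀ x → occupied T x ≡ true → ∃ λ i → lookup T i ≡ x
  occupied-sound x eq with any-sound _ (allFin n) eq
  ... | i , eq′ = i , eqCell-sound _ _ eq′

  occupied-complete : ∀ i {x} → lookup T i ≡ x → occupied T x ≡ true
  occupied-complete i ≡.refl = any-allFin-complete _ i (eqCell-refl (lookup T i))

  module _ (tableau : Tableau T) where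
    open Tableau tableau

    unoccupied-row0 : ∀ c → occupied T (0 , c) ≡ false
    unoccupied-row0 c with occupied T (0 , c) in eq
    ... | false = ≡.refl
    ... | true with occupied-sound _ eq
    ... | i , eq′ with positive i
    ... | _ , _ , eq″ with () ← ≡.trans (≡.sym eq′) eq″

    unoccupied-column0 : ∀ r → occupied T (r , 0) ≡ false
    unoccupied-column0 r with occupied T (r , 0) in eq
    ... | false = ≡.refl
    ... | true with occupied-sound _ eq
    ... | i , eq′ with positive i
    ... | _ , _ , eq″ with () ← ≡.trans (≡.sym eq′) eq″

    occupied-left : ∀ r c → occupied T (r , suc c) ≡ true → (c ≡ᵇ 0) ∨ occupied T (r , c) ≡ true
    occupied-left r zero eq = ≡.refl
    occupied-left r (suc c) eq with occupied-sound _ eq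
    ... | i , eq′ with left i eq′
    ... | j , _ , eq″ = occupied-complete j eq″

    occupied-down : ∀ r c → occupied T (suc r , c) ≡ true → (r ≡ᵇ 0) ∨ occupied T (r , c) ≡ true
    occupied-down zero c eq = ≡.refl
    occupied-down (suc r) c eq with occupied-sound _ eq
    ... | i , eq′ with down i eq′
    ... | j , _ , eq″ = occupied-complete j eq″

    -- Going left or down from a box, the labels strictly decrease, so the path is no longer than
    -- the label. Hence the tableau and its outer neighbours fit into a finite grid.
    bounded : ∀ m i → toℕ i < m → proj₁ (lookup T i) ≤ m × proj₂ (lookup T i) ≤ m
    bounded (suc m) i (s≤s i≤m) with lookup T i in eq
    ... | r , c = row r eq , column c eq
      where
      row : ∀ r {c} → lookup T i ≡ (r , c) → r ≤ suc m
      row zero _ = z≤n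
      row (suc zero) _ = s≤s z≤n
      row (suc (suc r)) eq with down i eq
      ... | j , j<i , eq′ = s≤s (≡.subst (λ x → proj₁ x ≤ m) eq′ (proj₁ (bounded m j (ℕP.<-≤-trans j<i i≤m))))
      column : ∀ c {r} → lookup T i ≡ (r , c) → c ≤ suc m
      column zero _ = z≤n
      column (suc zero) _ = s≤s z≤n
      column (suc (suc c)) eq with left i eq
      ... | j , j<i , eq′ = s≤s (≡.subst (λ x → proj₂ x ≤ m) eq′ (proj₂ (bounded m j (ℕP.<-≤-trans j<i i≤m))))

module SelectedTerms {a ℓ} (M : CommutativeMonoid a ℓ) where
  open CommutativeMonoid M
  open BigOperator M
  open Relation.Binary.Reasoning.Setoid setoid

  big-select : ∀ (b : X → Bool) {y} xs → Unique xs → (∀ {i j} → b i ≡ true → b j ≡ true → i ≡ j) →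
               big xs (λ i → if b i then y else ε) ≈ (if any b xs then y else ε)
  big-select b [] _ _ = refl
  big-select b {y} (x ∷ xs) (x∉ ∷ unique) inj with b x in bx
  ... | false = trans (identityˡ _) (big-select b xs unique inj)
  ... | true = trans (∙-congˡ (trans (big-cong-All (All.map absent x∉)) (big-ε xs))) (identityʳ _)
    where
    absent : ∀ {z} → x ≢ z → (if b z then y else ε) ≈ ε
    absent {z} x≢z with b z in bz
    ... | false = refl
    ... | true = ⊥-elim (x≢z (inj bx bz))

  big-single : ∀ (f : Cell → Carrier) x G → Unique G → x ∈ G → big G (λ g → if eqCell x g then f g else ε) ≈ f x
  big-single f x G unique x∈G = begin
    big G (λ g → if eqCell x g then f g else ε) ≈⟨ big-cong G rewrite-f ⟩
    big G (λ g → if eqCell x g then f x else ε)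
      ≈⟨ big-select (eqCell x) G unique (λ p q → ≡.trans (≡.sym (eqCell-sound x _ p)) (eqCell-sound x _ q)) ⟩
    (if any (eqCell x) G then f x else ε) ≡⟨ ≡.cong (if_then f x else ε) (any-complete (eqCell x) x∈G (eqCell-refl x)) ⟩
    f x ∎
    where
    rewrite-f : ∀ g → (if eqCell x g then f g else ε) ≈ (if eqCell x g then f x else ε)
    rewrite-f g with eqCell x g in eq
    ... | false = refl
    ... | true = reflexive (≡.cong f (≡.sym (eqCell-sound x g eq)))

  -- Passes from labels to cells: as `h` is injective, every cell of the grid is hit at most once.
  big-image : ∀ {n} (f : Cell → Carrier) (h : Fin n → Cell) G → Unique G → (∀ i → h i ∈ G) →
              (∀ i j → h i ≡ h j → i ≡ j) →
              big (allFin n) (λ i → f (h i)) ≈ big G (λ g → if any (λ i → eqCell (h i) g) (allFin n) then f g else ε)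
  big-image {n} f h G unique h∈G inj = begin
    big (allFin n) (λ i → f (h i)) ≈⟨ big-cong (allFin n) (λ i → big-single f (h i) G unique (h∈G i)) ⟨
    big (allFin n) (λ i → big G (λ g → if eqCell (h i) g then f g else ε)) ≈⟨ big-swap (allFin n) G _ ⟩
    big G (λ g → big (allFin n) (λ i → if eqCell (h i) g then f g else ε))
      ≈⟨ big-cong G (λ g → big-select (λ i → eqCell (h i) g) (allFin n) (UniqueP.allFin⁺ n)
           (λ {i} {j} p q → inj i j (≡.trans (eqCell-sound _ g p) (≡.sym (eqCell-sound _ g q))))) ⟩
    _ ∎

module Telescoping {a ℓ} (M : CommutativeMonoid a ℓ) where
  open CommutativeMonoid M
  open BigOperator M
  open SelectedTerms M
  open Relation.Binary.Reasoning.Setoid setoid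
  open import Algebra.Solver.CommutativeMonoid M using (solve; _⊜_; _⊕_; id)

  -- Exponent of the factor of a cell: a, b, c, d say whether the cell, its left, lower and diagonal
  -- neighbours are occupied, and o₁, o₂ whether it lies in the first column, the first row.
  exponents : ∀ {x y} → x ∙ y ≈ ε → ∀ o₁ o₂ a b c d →
    (a ≡ true → o₁ ∨ b ≡ true) → (a ≡ true → o₂ ∨ c ≡ true) →
    (b ≡ true → o₂ ∨ d ≡ true) → (c ≡ true → o₁ ∨ d ≡ true) →
    (o₁ ≡ true → b ∨ d ≡ false) → (o₂ ≡ true → c ∨ d ≡ false) →
    ((if a then x else ε) ∙ (if d then x else ε)) ∙ ((if b then y else ε) ∙ (if c then y else ε)) ≈
    (if o₂ ∧ o₁ then x else ε) ∙ ((if d ∧ (not b ∧ not c) then x else ε) ∙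
      (if not a ∧ ((o₁ ∨ b) ∧ (o₂ ∨ c)) then y else ε))
  exponents {x} {y} xy = go
    where
    xx∙yy : (x ∙ x) ∙ (y ∙ y) ≈ ε
    xx∙yy = trans (solve 2 (λ x y → (x ⊕ x) ⊕ (y ⊕ y) ⊜ (x ⊕ y) ⊕ (x ⊕ y)) refl x y) (trans (∙-cong xy xy) (identityˡ ε))
    εx∙yy : (ε ∙ x) ∙ (y ∙ y) ≈ y
    εx∙yy = trans (solve 2 (λ x y → (id ⊕ x) ⊕ (y ⊕ y) ⊜ (x ⊕ y) ⊕ y) refl x y) (trans (∙-congʳ xy) (identityˡ y))
    εεεε : (ε ∙ ε) ∙ (ε ∙ ε) ≈ ε
    εεεε = trans (∙-cong (identityˡ ε) (identityˡ ε)) (identityˡ ε)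
    εεε : ε ∙ (ε ∙ ε) ≈ ε
    εεε = trans (identityˡ _) (identityˡ ε)
    εεz : ∀ {z} → ε ∙ (ε ∙ z) ≈ z
    εεz = trans (identityˡ _) (identityˡ _)
    go : ∀ o₁ o₂ a b c d →
      (a ≡ true → o₁ ∨ b ≡ true) → (a ≡ true → o₂ ∨ c ≡ true) →
      (b ≡ true → o₂ ∨ d ≡ true) → (c ≡ true → o₁ ∨ d ≡ true) →
      (o₁ ≡ true → b ∨ d ≡ false) → (o₂ ≡ true → c ∨ d ≡ false) →
      ((if a then x else ε) ∙ (if d then x else ε)) ∙ ((if b then y else ε) ∙ (if c then y else ε)) ≈
      (if o₂ ∧ o₁ then x else ε) ∙ ((if d ∧ (not b ∧ not c) then x else ε) ∙
        (if not a ∧ ((o₁ ∨ b) ∧ (o₂ ∨ c)) then y else ε))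
    go true o₂ a true c d _ _ _ _ h _ with () ← h ≡.refl
    go true o₂ a false c true _ _ _ _ h _ with () ← h ≡.refl
    go true true a false true false _ _ _ _ _ h with () ← h ≡.refl
    go true true true false false false _ _ _ _ _ _ = solve 1 (λ x → (x ⊕ id) ⊕ (id ⊕ id) ⊜ x ⊕ (id ⊕ id)) refl x
    go true true false false false false _ _ _ _ _ _ =
      trans εεεε (sym (trans (∙-congˡ (identityˡ y)) xy))
    go true false true false false false _ h _ _ _ _ with () ← h ≡.refl
    go true false true false true false _ _ _ _ _ _ =
      trans (solve 2 (λ x y → (x ⊕ id) ⊕ (id ⊕ y) ⊜ x ⊕ y) refl x y) (trans xy (sym εεε))
    go true false false false false false _ _ _ _ _ _ = trans εεεε (sym εεε)
    go true false false false true false _ _ _ _ _ _ = ∙-cong (identityˡ ε) refl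
    go false true a b true d _ _ _ _ _ h with () ← h ≡.refl
    go false true a b false true _ _ _ _ _ h with () ← h ≡.refl
    go false true true false false false h _ _ _ _ _ with () ← h ≡.refl
    go false true true true false false _ _ _ _ _ _ =
      trans (solve 2 (λ x y → (x ⊕ id) ⊕ (y ⊕ id) ⊜ x ⊕ y) refl x y) (trans xy (sym εεε))
    go false true false false false false _ _ _ _ _ _ = trans εεεε (sym εεε)
    go false true false true false false _ _ _ _ _ _ = solve 1 (λ y → (id ⊕ id) ⊕ (y ⊕ id) ⊜ id ⊕ (id ⊕ y)) refl y
    go false false true false c d h _ _ _ _ _ with () ← h ≡.refl
    go false false true true false d _ h _ _ _ _ with () ← h ≡.refl
    go false false true true true false _ _ h _ _ _ with () ← h ≡.refl
    go false false true true true true _ _ _ _ _ _ = trans xx∙yy (sym εεε)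
    go false false false true c false _ _ h _ _ _ with () ← h ≡.refl
    go false false false false true false _ _ _ h _ _ with () ← h ≡.refl
    go false false false false false false _ _ _ _ _ _ = trans εεεε (sym εεε)
    go false false false false false true _ _ _ _ _ _ = solve 1 (λ x → (id ⊕ x) ⊕ (id ⊕ id) ⊜ id ⊕ (x ⊕ id)) refl x
    go false false false false true true _ _ _ _ _ _ =
      trans (solve 2 (λ x y → (id ⊕ x) ⊕ (id ⊕ y) ⊜ x ⊕ y) refl x y) (trans xy (sym εεε))
    go false false false true false true _ _ _ _ _ _ =
      trans (solve 2 (λ x y → (id ⊕ x) ⊕ (y ⊕ id) ⊜ x ⊕ y) refl x y) (trans xy (sym εεε))
    go false false false true true true _ _ _ _ _ _ = trans εx∙yy (sym εεz)

  module _ {n} {T : Vec Cell n} (tableau : Tableau T) (N : ℕ) (n<N : suc n ≤ N)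
           (f g : Cell → Carrier) (fg : ∀ x → f x ∙ g x ≈ ε) where
    open Tableau tableau

    private
      G = cellsUpTo N

      image : (h : ℕ → ℕ) (h′ : ℕ → ℕ) (k : Cell → Carrier) →
        (∀ i → (h (proj₁ (lookup T i)) , h′ (proj₂ (lookup T i))) ∈ G) →
        (∀ {x y} → h x ≡ h y → x ≡ y) → (∀ {x y} → h′ x ≡ h′ y → x ≡ y) →
        big (allFin n) (λ i → k (h (proj₁ (lookup T i)) , h′ (proj₂ (lookup T i)))) ≈
        big G (λ x → if any (λ i → eqCell (h (proj₁ (lookup T i)) , h′ (proj₂ (lookup T i))) x) (allFin n) then k x else ε)
      image h h′ k ∈G inj inj′ = big-image k _ G (cellsUpTo-unique N) ∈G
        (λ i j eq → distinct i j (≡.cong₂ _,_ (inj (,-injectiveˡ eq)) (inj′ (,-injectiveʳ eq))))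

      within : ∀ {r c} i → lookup T i ≡ (suc r , suc c) → suc r < N × suc c < N
      within i eq with bounded tableau n i (FinP.toℕ<n i)
      ... | r≤ , c≤ rewrite eq = ℕP.<-≤-trans (s≤s r≤) n<N , ℕP.<-≤-trans (s≤s c≤) n<N

      here∈ : ∀ i → lookup T i ∈ G
      here∈ i with lookup T i in eq | positive i
      ... | _ | r , c , ≡.refl with within i eq
      ... | r< , c< = cellsUpTo-complete (ℕP.<-trans (ℕP.n<1+n r) r<) (ℕP.<-trans (ℕP.n<1+n c) c<)

      right∈ : ∀ i → (proj₁ (lookup T i) , suc (proj₂ (lookup T i))) ∈ G
      right∈ i with lookup T i in eq | positive i
      ... | _ | r , c , ≡.refl with within i eq
      ... | r< , c< = cellsUpTo-complete (ℕP.<-trans (ℕP.n<1+n r) r<) c<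

      up∈ : ∀ i → (suc (proj₁ (lookup T i)) , proj₂ (lookup T i)) ∈ G
      up∈ i with lookup T i in eq | positive i
      ... | _ | r , c , ≡.refl with within i eq
      ... | r< , c< = cellsUpTo-complete r< (ℕP.<-trans (ℕP.n<1+n c) c<)

    diagonal∈ : ∀ i → diagonal (lookup T i) ∈ G
    diagonal∈ i with lookup T i in eq | positive i
    ... | _ | r , c , ≡.refl with within i eq
    ... | r< , c< = cellsUpTo-complete r< c<

    -- Collect the factors by cell instead of by box. A cell receives `f` for itself and for its
    -- diagonal neighbour if occupied, `g` for its left and its lower neighbour. These cancel except
    -- at (1 , 1) and along the rim of the diagram, as `exponents` checks. The bound on `N` keeps
    -- the neighbours of all boxes inside the grid.
    telescope : big (allFin n) (λ i → let (r , c) = lookup T i in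
                  (f (r , c) ∙ f (suc r , suc c)) ∙ (g (r , suc c) ∙ g (suc r , c))) ≈
                f (1 , 1) ∙ (big G (λ x → if corner T x then f x else ε) ∙ big G (λ x → if addable T x then g x else ε))
    telescope = begin
      big (allFin n) (λ i → (f (p i) ∙ f (diagonal (p i))) ∙ (g (right i) ∙ g (up i)))
        ≈⟨ trans (big-∙ (allFin n) _ _) (∙-cong (big-∙ (allFin n) _ _) (big-∙ (allFin n) _ _)) ⟩
      (big (allFin n) (λ i → f (p i)) ∙ big (allFin n) (λ i → f (diagonal (p i)))) ∙
      (big (allFin n) (λ i → g (right i)) ∙ big (allFin n) (λ i → g (up i)))
        ≈⟨ ∙-cong (∙-cong (image (λ x → x) (λ x → x) f here∈ (λ eq → eq) (λ eq → eq))
                          (image suc suc f diagonal∈ ℕP.suc-injective ℕP.suc-injective))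
                  (∙-cong (image (λ x → x) suc g right∈ (λ eq → eq) ℕP.suc-injective)
                          (image suc (λ x → x) g up∈ ℕP.suc-injective (λ eq → eq))) ⟩
      (big G (sel f (λ x → x) (λ x → x)) ∙ big G (sel f suc suc)) ∙ (big G (sel g (λ x → x) suc) ∙ big G (sel g suc (λ x → x)))
        ≈⟨ trans (big-∙ G _ _) (∙-cong (big-∙ G _ _) (big-∙ G _ _)) ⟨
      big G (λ x → (sel f (λ x → x) (λ x → x) x ∙ sel f suc suc x) ∙ (sel g (λ x → x) suc x ∙ sel g suc (λ x → x) x))
        ≈⟨ big-cong-All (All.map cell (cellsUpTo-positive N)) ⟩
      big G (λ x → (if eqCell x (1 , 1) then f x else ε) ∙ ((if corner T x then f x else ε) ∙ (if addable T x then g x else ε)))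
        ≈⟨ trans (big-∙ G _ _) (∙-congˡ (big-∙ G _ _)) ⟩
      big G (λ x → if eqCell x (1 , 1) then f x else ε) ∙
      (big G (λ x → if corner T x then f x else ε) ∙ big G (λ x → if addable T x then g x else ε))
        ≈⟨ ∙-congʳ (trans (big-cong G (λ x → reflexive (≡.cong (if_then f x else ε) (eqCell-sym x (1 , 1)))))
                          (big-single f (1 , 1) G (cellsUpTo-unique N) (cellsUpTo-complete 0<N 0<N))) ⟩
      _ ∎
      where
      0<N : 0 < N
      0<N = ℕP.<-≤-trans (s≤s z≤n) n<N
      p : Fin n → Cell
      p = lookup T
      right up : Fin n → Cell
      right i = proj₁ (p i) , suc (proj₂ (p i))
      up i = suc (proj₁ (p i)) , proj₂ (p i)
      sel : (Cell → Carrier) → (ℕ → ℕ) → (ℕ → ℕ) → Cell → Carrier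
      sel k h h′ x = if any (λ i → eqCell (h (proj₁ (p i)) , h′ (proj₂ (p i))) x) (allFin n) then k x else ε
      cell : ∀ {x} → Positive x →
        (sel f (λ x → x) (λ x → x) x ∙ sel f suc suc x) ∙ (sel g (λ x → x) suc x ∙ sel g suc (λ x → x) x) ≈
        (if eqCell x (1 , 1) then f x else ε) ∙ ((if corner T x then f x else ε) ∙ (if addable T x then g x else ε))
      cell (r , c , ≡.refl) = exponents (fg _) (c ≡ᵇ 0) (r ≡ᵇ 0)
        (occupied T (suc r , suc c)) (occupied T (suc r , c)) (occupied T (r , suc c)) (occupied T (r , c))
        (occupied-left tableau (suc r) c) (occupied-down tableau r (suc c)) (occupied-down tableau r c) (occupied-left tableau r c)
        column0 row0
        where
        column0 : (c ≡ᵇ 0) ≡ true → occupied T (suc r , c) ∨ occupied T (r , c) ≡ false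
        column0 eq rewrite ≡ᵇ-sound {c} eq | unoccupied-column0 tableau (suc r) = unoccupied-column0 tableau r
        row0 : (r ≡ᵇ 0) ≡ true → occupied T (r , suc c) ∨ occupied T (r , c) ≡ false
        row0 eq rewrite ≡ᵇ-sound {r} eq | unoccupied-row0 tableau (suc c) = unoccupied-row0 tableau c

-- The sum over the positions of a new box

¬true⇒false : ∀ {b} → (b ≡ true → ⊥) → b ≡ false
¬true⇒false {false} _ = ≡.refl
¬true⇒false {true} h = ⊥-elim (h ≡.refl)

-- A box above the last one, or to its right, would have to be supported by a box with a smaller
-- label than its own; but that support is the last one, with the largest label.
corner-last : ∀ {n} {T : Vec Cell (suc n)} → Tableau T → corner T (diagonal (lookup T (fromℕ n))) ≡ true
corner-last {n} {T} tableau = goal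
  where
  open Tableau tableau
  z = lookup T (fromℕ n)
  not-before-last : ∀ (i j : Fin (suc n)) → toℕ j < toℕ i → lookup T j ≡ z → ⊥
  not-before-last i j j<i eq with distinct j (fromℕ n) eq
  ... | ≡.refl = ℕP.<⇒≱ j<i (ℕP.≤-trans (ℕP.≤-pred (FinP.toℕ<n i)) (ℕP.≤-reflexive (≡.sym (FinP.toℕ-fromℕ n))))
  up-free : occupied T (suc (proj₁ z) , proj₂ z) ≡ false
  up-free = ¬true⇒false contradict
    where
    contradict : occupied T (suc (proj₁ z) , proj₂ z) ≡ true → ⊥
    contradict occ with positive (fromℕ n) | occupied-sound {T = T} _ occ
    ... | r , c , eqz | i , eqi with down i {r} {proj₂ z} (≡.trans eqi (≡.cong (λ x → suc (proj₁ x) , proj₂ z) eqz))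
    ... | j , j<i , eqj = not-before-last i j j<i (≡.trans eqj (≡.cong (λ x → x , proj₂ z) (≡.sym (≡.cong proj₁ eqz))))
  right-free : occupied T (proj₁ z , suc (proj₂ z)) ≡ false
  right-free = ¬true⇒false contradict
    where
    contradict : occupied T (proj₁ z , suc (proj₂ z)) ≡ true → ⊥
    contradict occ with positive (fromℕ n) | occupied-sound {T = T} _ occ
    ... | r , c , eqz | i , eqi with left i {proj₁ z} {c} (≡.trans eqi (≡.cong (λ x → proj₁ z , suc (proj₂ x)) eqz))
    ... | j , j<i , eqj = not-before-last i j j<i (≡.trans eqj (≡.cong (λ x → proj₁ z , x) (≡.sym (≡.cong proj₂ eqz))))
  goal : occupied T z ∧ (not (occupied T (suc (proj₁ z) , proj₂ z)) ∧ not (occupied T (proj₁ z , suc (proj₂ z)))) ≡ true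
  goal rewrite occupied-complete {T = T} (fromℕ n) ≡.refl | up-free | right-free = ≡.refl

-- The corner of the last box is left out because its zero is cancelled by the pole 1 - qt
-- z_{n-1}/z.
otherCorner : ∀ {n} → Vec Cell (suc n) → Cell → Bool
otherCorner {n} T x = corner T x ∧ not (eqCell (diagonal (lookup T (fromℕ n))) x)

-- Left of a corner position the cell is free, whereas an addable cell outside the first column
-- needs it occupied; the first column contains no corner position. Thus no zero of Φ is a pole.
addable-corner-disjoint : ∀ {n} {T : Vec Cell n} → Tableau T → ∀ {x y} → Positive x → corner T x ≡ true → addable T y ≡ true → x ≢ y
addable-corner-disjoint {T = T} tableau (r , zero , ≡.refl) cor add ≡.refl
  rewrite unoccupied-column0 tableau r with () ← cor
addable-corner-disjoint {T = T} tableau (r , suc c , ≡.refl) cor add ≡.refl =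
  clash {occupied T (suc r , suc c)} (∧-trueˡ (∧-trueʳ {occupied T (r , suc c)} cor))
        (∧-trueˡ (∧-trueʳ {not (occupied T (suc r , suc (suc c)))} add))
  where
  clash : ∀ {b} → not b ≡ true → b ≡ true → ⊥
  clash {true} () _
  clash {false} _ ()

zMono-injective : ∀ {x y} → Positive x → Positive y → zMono x ≡ zMono y → x ≡ y
zMono-injective (_ , _ , ≡.refl) (_ , _ , ≡.refl) ≡.refl = ≡.refl

zMono-right : ∀ {x} → Positive x → zMono (proj₁ x , suc (proj₂ x)) ≡ monoMul monoQ (zMono x)
zMono-right (_ , _ , ≡.refl) = ≡.refl

zMono-up : ∀ {x} → Positive x → zMono (suc (proj₁ x) , proj₂ x) ≡ monoMul monoT (zMono x)
zMono-up (_ , _ , ≡.refl) = ≡.refl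

zMono-diagonal : ∀ {x} → Positive x → zMono (diagonal x) ≡ monoMul monoQT (zMono x)
zMono-diagonal (_ , _ , ≡.refl) = ≡.refl

unique-map : ∀ {A B : Set} {P : A → Set} (f : A → B) → (∀ {x y} → P x → P y → f x ≡ f y → x ≡ y) →
             ∀ {xs} → All P xs → Unique xs → Unique (map f xs)
unique-map f inj [] [] = []
unique-map f inj (px ∷ pxs) (x∉ ∷ unique) =
  AllP.map⁺ (All.zipWith (λ (py , x≢y) → x≢y ∘ inj px py) (pxs , x∉)) ∷ unique-map f inj pxs unique

module NextBox {n} {T : Vec Cell (suc n)} (tableau : Tableau T) (N : ℕ) (n<N : suc (suc n) ≤ N) where

  private
    G = cellsUpTo N
    z = lookup T (fromℕ n)

  newBoxes otherCorners : List Cell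
  newBoxes = filterᵇ (addable T) G
  otherCorners = filterᵇ (otherCorner T) G

  module _ {a ℓ} (M : CommutativeMonoid a ℓ) where
    open CommutativeMonoid M
    open BigOperator M
    open SelectedTerms M
    open Telescoping M
    open Relation.Binary.Reasoning.Setoid setoid
    open import Algebra.Solver.CommutativeMonoid M using (solve; _⊜_; _⊕_)

    boxFactor : (f g : Cell → Carrier) → Cell → Carrier
    boxFactor f g (r , c) = (f (r , c) ∙ f (suc r , suc c)) ∙ (g (r , suc c) ∙ g (suc r , c))

    -- The last two factors stand for the denominators 1 - 1/z and 1 - qt z_{n-1}/z, with `z` here
    -- the last box of `T`. The first cancels the `f (1 , 1)` left over by `telescope`, the second
    -- the corner of the last box.
    telescope-step : ∀ f g → (∀ x → f x ∙ g x ≈ ε) →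
      big otherCorners f ∙ big newBoxes g ≈
      big (allFin (suc n)) (λ i → boxFactor f g (lookup T i)) ∙ (g (1 , 1) ∙ g (diagonal z))
    telescope-step f g fg = sym (begin
      big (allFin (suc n)) (λ i → boxFactor f g (lookup T i)) ∙ (g (1 , 1) ∙ g (diagonal z))
        ≈⟨ ∙-congʳ (telescope tableau N n<N f g fg) ⟩
      (f (1 , 1) ∙ (big G (λ x → if corner T x then f x else ε) ∙ S)) ∙ (g (1 , 1) ∙ g (diagonal z))
        ≈⟨ ∙-congʳ (∙-congˡ (∙-congʳ (trans (big-cong G split) (big-∙ G _ _)))) ⟩
      (f (1 , 1) ∙ ((big G (λ x → if eqCell (diagonal z) x then f x else ε) ∙ R) ∙ S)) ∙ (g (1 , 1) ∙ g (diagonal z))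
        ≈⟨ ∙-congʳ (∙-congˡ (∙-congʳ (∙-congʳ (big-single f (diagonal z) G (cellsUpTo-unique N) (diagonal∈ tableau N n<N f g fg (fromℕ n)))))) ⟩
      (f (1 , 1) ∙ ((f (diagonal z) ∙ R) ∙ S)) ∙ (g (1 , 1) ∙ g (diagonal z))
        ≈⟨ solve 6 (λ f₁ f₂ r s g₁ g₂ → (f₁ ⊕ ((f₂ ⊕ r) ⊕ s)) ⊕ (g₁ ⊕ g₂) ⊜ (f₁ ⊕ g₁) ⊕ ((f₂ ⊕ g₂) ⊕ (r ⊕ s)))
             refl (f (1 , 1)) (f (diagonal z)) R S (g (1 , 1)) (g (diagonal z)) ⟩
      (f (1 , 1) ∙ g (1 , 1)) ∙ ((f (diagonal z) ∙ g (diagonal z)) ∙ (R ∙ S)) ≈⟨ ∙-cong (fg _) (∙-congʳ (fg _)) ⟩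
      ε ∙ (ε ∙ (R ∙ S)) ≈⟨ trans (identityˡ _) (identityˡ _) ⟩
      R ∙ S ≈⟨ ∙-cong (big-filter (otherCorner T) G f) (big-filter (addable T) G g) ⟨
      _ ∎)
      where
      R = big G (λ x → if otherCorner T x then f x else ε)
      S = big G (λ x → if addable T x then g x else ε)
      split : ∀ x → (if corner T x then f x else ε) ≈
                    (if eqCell (diagonal z) x then f x else ε) ∙ (if otherCorner T x then f x else ε)
      split x with eqCell (diagonal z) x in eq | corner T x in cor
      ... | false | true = sym (identityˡ _)
      ... | false | false = sym (identityˡ _)
      ... | true | true = sym (identityʳ _)
      ... | true | false with () ← ≡.trans (≡.sym cor) (≡.trans (≡.cong (corner T) (≡.sym (eqCell-sound (diagonal z) x eq))) (corner-last tableau))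

  -- Telescoping in the integers with weights 1 and -1: every box contributes 1 + 1 - 1 - 1 = 0, and
  -- only the two extra factors are left, giving -2.
  newBoxes-count : length newBoxes ≡ 2 ℕ.+ length otherCorners
  newBoxes-count = ≡.sym (ℤP.+-injective (begin
    + (2 ℕ.+ length otherCorners) ≡⟨ ℤP.+-comm (+ 2) (+ length otherCorners) ⟩
    + length otherCorners ℤ.+ + 2 ≡⟨ lem (+ length otherCorners) (+ length newBoxes) ⟩
    (+ length otherCorners ℤ.- + length newBoxes) ℤ.+ (+ length newBoxes ℤ.+ + 2) ≡⟨ ≡.cong (ℤ._+ (+ length newBoxes ℤ.+ + 2)) difference ⟩
    -[1+ 1 ] ℤ.+ (+ length newBoxes ℤ.+ + 2) ≡⟨ lem₂ (+ length newBoxes) ⟩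
    + length newBoxes ∎))
    where
    open ≡.≡-Reasoning
    open BigOperator ℤP.+-0-commutativeMonoid
    lem : ∀ r s → r ℤ.+ + 2 ≡ (r ℤ.- s) ℤ.+ (s ℤ.+ + 2)
    lem = solve-∀
    lem₂ : ∀ s → -[1+ 1 ] ℤ.+ (s ℤ.+ + 2) ≡ s
    lem₂ = solve-∀
    big-1 : ∀ (xs : List Cell) → big xs (λ _ → + 1) ≡ + length xs
    big-1 [] = ≡.refl
    big-1 (x ∷ xs) = ≡.cong (λ k → + 1 ℤ.+ k) (big-1 xs)
    big--1 : ∀ (xs : List Cell) → big xs (λ _ → -[1+ 0 ]) ≡ ℤ.- (+ length xs)
    big--1 [] = ≡.refl
    big--1 (x ∷ xs) = ≡.trans (≡.cong (λ k → -[1+ 0 ] ℤ.+ k) (big--1 xs)) (≡.sym (ℤP.neg-distrib-+ (+ 1) (+ length xs)))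
    difference : + length otherCorners ℤ.- + length newBoxes ≡ -[1+ 1 ]
    difference = begin
      + length otherCorners ℤ.- + length newBoxes ≡⟨ ≡.cong₂ ℤ._+_ (big-1 otherCorners) (big--1 newBoxes) ⟨
      big otherCorners (λ _ → + 1) ℤ.+ big newBoxes (λ _ → -[1+ 0 ])
        ≡⟨ telescope-step ℤP.+-0-commutativeMonoid (λ _ → + 1) (λ _ → -[1+ 0 ]) (λ _ → ≡.refl) ⟩
      big (allFin (suc n)) (λ _ → + 0) ℤ.+ -[1+ 1 ] ≡⟨ ≡.cong (ℤ._+ -[1+ 1 ]) (big-ε (allFin (suc n))) ⟩
      _ ∎

  module _ {c ℓ} {R : CommutativeRing c ℓ} (torus : Torus R) where
    open CommutativeRing R
    open Torus torus
    open PartialFractions torus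
    open TeslerSeries torus
    open RingSums R
    open PowerSeries R
    open Relation.Binary.Reasoning.Setoid setoid

    private
      S′ = map zMono newBoxes
      R′ = map zMono otherCorners

    filter-positive : ∀ p → All Positive (filterᵇ p G)
    filter-positive p = AllP.filter⁺ (T? ∘ p) (cellsUpTo-positive N)

    filter-holds : ∀ (p : Cell → Bool) → All (λ x → p x ≡ true) (filterᵇ p G)
    filter-holds p = All.map (Equivalence.to T-≡) (AllP.all-filter (T? ∘ p) G)

    private
      S-unique : Unique S′
      S-unique = unique-map zMono zMono-injective (filter-positive (addable T)) (UniqueP.filter⁺ (T? ∘ addable T) (cellsUpTo-unique N))

      disjoint : All (λ r → All (λ s → r ≢ s) S′) R′
      disjoint = AllP.map⁺ (All.zipWith (λ (pos , cor) → AllP.map⁺ (All.zipWith (λ (pos′ , add) eq →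
        addable-corner-disjoint tableau pos (∧-trueˡ cor) add (zMono-injective pos pos′ eq))
        (filter-positive (addable T) , filter-holds (addable T))))
        (filter-positive (otherCorner T) , filter-holds (otherCorner T)))

    -- The growth of the weight when a box with monomial s is appended: Φ at u = 1/s with its
    -- vanishing factors omitted, grouped by boxes.
    nextBox : Mono → Carrier
    nextBox s = product (allFin (suc n)) (λ i → boxFactor *-commutativeMonoid (λ x → φ (zMono x ⊘ s)) (λ x → ψ (zMono x ⊘ s)) (lookup T i))
                * (ψ (mono1 ⊘ s) * ψ (zMono (diagonal z) ⊘ s))

    -- The expansion of Φ at u = 0; `power mono1` is 1 / (1 - u).
    nextBoxSeries : Series
    nextBoxSeries = (Series′.big (allFin n) (λ i → seriesA (zMono (lookup T (inject₁ i)))) ⊛ seriesB (zMono z)) ⊛ power mono1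

    private
      module S⊛ = CommutativeMonoid ⊛-commutativeMonoid
      series : Cell → Series
      series = boxFactor ⊛-commutativeMonoid (linear ∘ μ ∘ zMono) (power ∘ zMono)

      series-B : ∀ {x} → Positive x → series x ≋ linear (μ (zMono (diagonal x))) ⊛ seriesB (zMono x)
      series-B {x} pos = S⊛.trans regroup (⊛-cong (λ _ → refl) (seriesB-product (zMono x)))
        where
        open import Algebra.Solver.CommutativeMonoid ⊛-commutativeMonoid using (solve; _⊜_; _⊕_)
        regroup : series x ≋ linear (μ (zMono (diagonal x))) ⊛ (linear (μ (zMono x)) ⊛ (power (monoMul monoT (zMono x)) ⊛ power (monoMul monoQ (zMono x))))
        regroup rewrite zMono-right pos | zMono-up pos =
          solve 4 (λ l d p q → (l ⊕ d) ⊕ (p ⊕ q) ⊜ d ⊕ (l ⊕ (q ⊕ p))) S⊛.refl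
            (linear (μ (zMono x))) (linear (μ (zMono (diagonal x)))) (power (monoMul monoQ (zMono x))) (power (monoMul monoT (zMono x)))

      series-A : ∀ {x} → Positive x → series x ≋ seriesA (zMono x)
      series-A {x} pos = S⊛.trans (series-B pos) (S⊛.trans
        (⊛-cong (λ k → reflexive (≡.cong (λ m → linear (μ m) k) (zMono-diagonal pos))) (λ _ → refl)) (seriesA-product (zMono x)))

    nextBoxSeries-product : Series′.big R′ (linear ∘ μ) ⊛ Series′.big S′ power ≋ nextBoxSeries
    nextBoxSeries-product = S⊛.trans (⊛-cong (S⊛.reflexive (Series′.big-map zMono otherCorners (linear ∘ μ)))
                                              (S⊛.reflexive (Series′.big-map zMono newBoxes power)))
      (S⊛.trans (telescope-step ⊛-commutativeMonoid (linear ∘ μ ∘ zMono) (power ∘ zMono) (λ x → linear-geometric (μ (zMono x))))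
      (S⊛.trans (⊛-cong (S⊛.trans (Series′.big-allFin-last n (λ i → series (lookup T i)))
                           (⊛-cong (Series′.big-cong (allFin n) (λ i → series-A (positive (inject₁ i)))) (series-B (positive (fromℕ n))))) (λ _ → refl))
      regroup))
      where
      open Tableau tableau
      open import Algebra.Solver.CommutativeMonoid ⊛-commutativeMonoid using (solve; _⊜_; _⊕_)
      A⋯ = Series′.big (allFin n) (λ i → seriesA (zMono (lookup T (inject₁ i))))
      l = linear (μ (zMono (diagonal z)))
      p = power (zMono (diagonal z))
      -- The zero 1 - qt z u belonging to the last box meets the pole at the same place.
      regroup : (A⋯ ⊛ (l ⊛ seriesB (zMono z))) ⊛ (power mono1 ⊛ p) ≋ (A⋯ ⊛ seriesB (zMono z)) ⊛ power mono1
      regroup = S⊛.trans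
        (solve 5 (λ a l b o p → (a ⊕ (l ⊕ b)) ⊕ (o ⊕ p) ⊜ (l ⊕ p) ⊕ ((a ⊕ b) ⊕ o)) S⊛.refl A⋯ l (seriesB (zMono z)) (power mono1) p)
        (S⊛.trans (⊛-cong (linear-geometric (μ (zMono (diagonal z)))) (λ _ → refl)) (⊛-identityˡ _))

    -- Telescoping enters twice: for the values at each pole s, and, after the partial fractions,
    -- for the series in u.
    nextBox-sum : ∀ a → sum G (λ x → if addable T x then power (zMono x) a * nextBox (zMono x) else 0#) ≈ nextBoxSeries a
    nextBox-sum a = begin
      sum G (λ x → if addable T x then power (zMono x) a * nextBox (zMono x) else 0#) ≈⟨ Σ′.big-filter (addable T) G _ ⟨
      sum newBoxes (λ x → power (zMono x) a * nextBox (zMono x)) ≡⟨ Σ′.big-map zMono newBoxes (λ s → power s a * nextBox s) ⟨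
      sum S′ (λ s → power s a * nextBox s)
        ≈⟨ Σ′.big-cong S′ (λ s → *-congˡ (trans (*-cong (reflexive (Π′.big-map zMono otherCorners _)) (reflexive (Π′.big-map zMono newBoxes _)))
             (telescope-step *-commutativeMonoid (λ x → φ (zMono x ⊘ s)) (λ x → ψ (zMono x ⊘ s)) (λ x → φψ _)))) ⟨
      sum S′ (λ s → power s a * (product R′ (λ r → φ (r ⊘ s)) * product S′ (λ y → ψ (y ⊘ s))))
        ≈⟨ partial-fractions S′ R′ a S-unique size disjoint ⟩
      (Series′.big R′ (linear ∘ μ) ⊛ Series′.big S′ power) a ≈⟨ nextBoxSeries-product a ⟩
      nextBoxSeries a ∎
      where
      size : length S′ ≡ 2 ℕ.+ length R′
      size rewrite length-map zMono newBoxes | length-map zMono otherCorners = newBoxes-count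

-- Splitting off the last index

lookup-inject₁ : ∀ {X : Set} {n} (xs : Vec X n) x i → lookup (xs ∷ʳ x) (inject₁ i) ≡ lookup xs i
lookup-inject₁ (y ∷ xs) x zero = ≡.refl
lookup-inject₁ (y ∷ xs) x (suc i) = lookup-inject₁ xs x i

lookup-fromℕ : ∀ {X : Set} {n} (xs : Vec X n) x → lookup (xs ∷ʳ x) (fromℕ n) ≡ x
lookup-fromℕ [] x = ≡.refl
lookup-fromℕ (y ∷ xs) x = lookup-fromℕ xs x

<ᵇ-true : ∀ {m n} → m < n → (m <ᵇ n) ≡ true
<ᵇ-true m<n = Equivalence.to T-≡ (ℕP.<⇒<ᵇ m<n)

<ᵇ-sound : ∀ {m n} → (m <ᵇ n) ≡ true → m < n
<ᵇ-sound {m} {n} eq = ℕP.<ᵇ⇒< m n (Equivalence.from T-≡ eq)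

<ᵇ-false : ∀ {m n} → n ≤ m → (m <ᵇ n) ≡ false
<ᵇ-false n≤m = ¬true⇒false (λ eq → ℕP.<⇒≱ (<ᵇ-sound eq) n≤m)

≡ᵇ-false : ∀ {m n} → m ≢ n → (m ≡ᵇ n) ≡ false
≡ᵇ-false m≢n = ¬true⇒false (λ eq → m≢n (≡ᵇ-sound eq))

module _ {n} (i : Fin n) where
  inject₁-<ᵇ-last : (toℕ (inject₁ i) <ᵇ toℕ (fromℕ n)) ≡ true
  inject₁-<ᵇ-last rewrite FinP.toℕ-inject₁ i | FinP.toℕ-fromℕ n = <ᵇ-true (FinP.toℕ<n i)

  last-<ᵇ-inject₁ : (toℕ (fromℕ n) <ᵇ toℕ (inject₁ i)) ≡ false
  last-<ᵇ-inject₁ rewrite FinP.toℕ-inject₁ i | FinP.toℕ-fromℕ n = <ᵇ-false (ℕP.<⇒≤ (FinP.toℕ<n i))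

  inject₁-≡ᵇ-last : (toℕ (inject₁ i) ≡ᵇ toℕ (fromℕ n)) ≡ false
  inject₁-≡ᵇ-last rewrite FinP.toℕ-inject₁ i | FinP.toℕ-fromℕ n = ≡ᵇ-false (ℕP.<⇒≢ (FinP.toℕ<n i))

  last-≡ᵇ-inject₁ : (toℕ (fromℕ n) ≡ᵇ toℕ (inject₁ i)) ≡ false
  last-≡ᵇ-inject₁ rewrite FinP.toℕ-inject₁ i | FinP.toℕ-fromℕ n = ≡ᵇ-false (λ eq → ℕP.<⇒≢ (FinP.toℕ<n i) (≡.sym eq))

last-<ᵇ-last : ∀ n → (toℕ (fromℕ n) <ᵇ toℕ (fromℕ n)) ≡ false
last-<ᵇ-last n = <ᵇ-false {toℕ (fromℕ n)} ℕP.≤-refl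

inject₁-<ᵇ : ∀ {n} (i j : Fin n) → (toℕ (inject₁ i) <ᵇ toℕ (inject₁ j)) ≡ (toℕ i <ᵇ toℕ j)
inject₁-<ᵇ i j = ≡.cong₂ _<ᵇ_ (FinP.toℕ-inject₁ i) (FinP.toℕ-inject₁ j)

inject₁-≡ᵇ : ∀ {n} (i j : Fin n) → (toℕ (inject₁ i) ≡ᵇ toℕ (inject₁ j)) ≡ (toℕ i ≡ᵇ toℕ j)
inject₁-≡ᵇ i j = ≡.cong₂ _≡ᵇ_ (FinP.toℕ-inject₁ i) (FinP.toℕ-inject₁ j)

-- The Boolean tests become big operators so that `big-allFin-last` can split off the last index.
module And = BigOperator ∧-commutativeMonoid
module Or = BigOperator ∨-commutativeMonoid

all-big : ∀ {X : Set} (p : X → Bool) xs → all p xs ≡ And.big xs p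
all-big p [] = ≡.refl
all-big p (x ∷ xs) = ≡.cong (p x ∧_) (all-big p xs)

any-big : ∀ {X : Set} (p : X → Bool) xs → any p xs ≡ Or.big xs p
any-big p [] = ≡.refl
any-big p (x ∷ xs) = ≡.cong (p x ∨_) (any-big p xs)

And-sound : ∀ {n} (p : Fin n → Bool) → And.big (allFin n) p ≡ true → ∀ i → p i ≡ true
And-sound {n} p eq i = go (allFin n) eq (∈-allFin i)
  where
  go : ∀ xs → And.big xs p ≡ true → ∀ {x} → x ∈ xs → p x ≡ true
  go (x ∷ xs) eq (here ≡.refl) = ∧-trueˡ eq
  go (x ∷ xs) eq (there x∈) = go xs (∧-trueʳ {p x} eq) x∈

not-Or : ∀ {X : Set} (p : X → Bool) xs → not (Or.big xs p) ≡ And.big xs (not ∘ p)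
not-Or p [] = ≡.refl
not-Or p (x ∷ xs) with p x
... | true = ≡.refl
... | false = not-Or p xs

-- Standard tableaux with one box appended

positiveᵇ : Cell → Bool
positiveᵇ (r , c) = not (r ≡ᵇ 0) ∧ not (c ≡ᵇ 0)

module _ {n} (T : Vec Cell n) where
  separated : Fin n → Fin n → Bool
  separated i j = not (eqCell (lookup T i) (lookup T j)) ∨ (toℕ i ≡ᵇ toℕ j)

  occupiedBefore : Fin n → Cell → Bool
  occupiedBefore i x = any (λ j → (toℕ j <ᵇ toℕ i) ∧ eqCell (lookup T j) x) (allFin n)

  -- The occupancy test is a parameter because it changes: for the entry appended to `T`, being
  -- occupied by a smaller label means being occupied in `T`.
  supportedBy : (Cell → Bool) → Cell → Bool
  supportedBy occ (r , c) = ((c ≡ᵇ 1) ∨ occ (r , c ℕ.∸ 1)) ∧ ((r ≡ᵇ 1) ∨ occ (r ℕ.∸ 1 , c))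

  isSYT-big : isSYT T ≡ And.big (allFin n) (λ i → positiveᵇ (lookup T i))
    ∧ (And.big (allFin n) (λ i → And.big (allFin n) (separated i))
    ∧ And.big (allFin n) (λ i → supportedBy (occupiedBefore i) (lookup T i)))
  isSYT-big = ≡.cong₂ _∧_ (all-big _ (allFin n)) (≡.cong₂ _∧_
    (≡.trans (all-big _ (cartesianProduct (allFin n) (allFin n))) (And.big-cartesianProduct (allFin n) (allFin n) _))
    (all-big _ (allFin n)))

  tableau-of : isSYT T ≡ true → Tableau T
  tableau-of eq = record { positive = positive ; distinct = distinct ; left = left ; down = down }
    where
    valid = ≡.trans (≡.sym isSYT-big) eq
    part₂₃ = ∧-trueʳ {And.big (allFin n) (λ i → positiveᵇ (lookup T i))} valid
    supp : ∀ i → supportedBy (occupiedBefore i) (lookup T i) ≡ true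
    supp = And-sound _ (∧-trueʳ {And.big (allFin n) (λ i → And.big (allFin n) (separated i))} part₂₃)
    positive : ∀ i → Positive (lookup T i)
    positive i with lookup T i | And-sound _ (∧-trueˡ valid) i
    ... | zero , _ | ()
    ... | suc r , zero | ()
    ... | suc r , suc c | _ = r , c , ≡.refl
    distinct : ∀ i j → lookup T i ≡ lookup T j → i ≡ j
    distinct i j eq = FinP.toℕ-injective (≡ᵇ-sound (use (And-sound _ (And-sound _ (∧-trueˡ part₂₃) i) j)))
      where
      use : separated i j ≡ true → (toℕ i ≡ᵇ toℕ j) ≡ true
      use sep rewrite eq | eqCell-refl (lookup T j) = sep
    before : ∀ i x → occupiedBefore i x ≡ true → ∃ λ j → toℕ j < toℕ i × lookup T j ≡ x
    before i x occ with any-sound _ (allFin n) occ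
    ... | j , eq = j , <ᵇ-sound (∧-trueˡ eq) , eqCell-sound _ _ (∧-trueʳ {toℕ j <ᵇ toℕ i} eq)
    left : ∀ i {r c} → lookup T i ≡ (r , suc (suc c)) → ∃ λ j → toℕ j < toℕ i × lookup T j ≡ (r , suc c)
    left i eq = before i _ (∧-trueˡ (≡.subst (λ x → supportedBy (occupiedBefore i) x ≡ true) eq (supp i)))
    down : ∀ i {r c} → lookup T i ≡ (suc (suc r) , c) → ∃ λ j → toℕ j < toℕ i × lookup T j ≡ (suc r , c)
    down i {r} {c} eq = before i _ (∧-trueʳ {(c ≡ᵇ 1) ∨ occupiedBefore i (suc (suc r) , c ℕ.∸ 1)}
      (≡.subst (λ x → supportedBy (occupiedBefore i) x ≡ true) eq (supp i)))

module _ {n} (T : Vec Cell n) (s : Cell) where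

  separated-last : And.big (allFin (suc n)) (λ i → And.big (allFin (suc n)) (separated (T ∷ʳ s) i)) ≡
                   And.big (allFin n) (λ i → And.big (allFin n) (separated T i)) ∧ not (occupied T s)
  separated-last = begin
    And.big (allFin (suc n)) (λ i → And.big (allFin (suc n)) (separated (T ∷ʳ s) i))
      ≡⟨ And.big-allFin-last n _ ⟩
    And.big (allFin n) (λ i → And.big (allFin (suc n)) (separated (T ∷ʳ s) (inject₁ i))) ∧ And.big (allFin (suc n)) (separated (T ∷ʳ s) (fromℕ n))
      ≡⟨ ≡.cong₂ _∧_ (And.big-cong (allFin n) (λ i → And.big-allFin-last n _)) (And.big-allFin-last n _) ⟩
    And.big (allFin n) (λ i → And.big (allFin n) (λ j → separated (T ∷ʳ s) (inject₁ i) (inject₁ j)) ∧ separated (T ∷ʳ s) (inject₁ i) (fromℕ n))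
      ∧ (And.big (allFin n) (λ j → separated (T ∷ʳ s) (fromℕ n) (inject₁ j)) ∧ separated (T ∷ʳ s) (fromℕ n) (fromℕ n))
      ≡⟨ ≡.cong₂ _∧_
           (And.big-cong (allFin n) (λ i → ≡.cong₂ _∧_ (And.big-cong (allFin n) (inner i)) (outer₁ i)))
           (≡.cong₂ _∧_ (And.big-cong (allFin n) outer₂) corner-case) ⟩
    And.big (allFin n) (λ i → And.big (allFin n) (separated T i) ∧ not (eqCell (lookup T i) s))
      ∧ (And.big (allFin n) (λ j → not (eqCell (lookup T j) s)) ∧ true)
      ≡⟨ ≡.cong (_∧ (And.big (allFin n) (λ j → not (eqCell (lookup T j) s)) ∧ true)) (And.big-∙ (allFin n) _ _) ⟩
    (D ∧ And.big (allFin n) (λ j → not (eqCell (lookup T j) s))) ∧ (And.big (allFin n) (λ j → not (eqCell (lookup T j) s)) ∧ true)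
      ≡⟨ collapse D _ ⟩
    D ∧ And.big (allFin n) (λ j → not (eqCell (lookup T j) s))
      ≡⟨ ≡.cong (D ∧_) (≡.trans (≡.cong not (any-big _ (allFin n))) (not-Or _ (allFin n))) ⟨
    D ∧ not (occupied T s) ∎
    where
    open ≡.≡-Reasoning
    D = And.big (allFin n) (λ i → And.big (allFin n) (separated T i))
    -- The new entry is compared with each old one in both orders, and the two comparisons are the
    -- same condition.
    collapse : ∀ d x → (d ∧ x) ∧ (x ∧ true) ≡ d ∧ x
    collapse false x = ≡.refl
    collapse true false = ≡.refl
    collapse true true = ≡.refl
    inner : ∀ i j → separated (T ∷ʳ s) (inject₁ i) (inject₁ j) ≡ separated T i j
    inner i j rewrite lookup-inject₁ T s i | lookup-inject₁ T s j | inject₁-≡ᵇ i j = ≡.refl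
    outer₁ : ∀ i → separated (T ∷ʳ s) (inject₁ i) (fromℕ n) ≡ not (eqCell (lookup T i) s)
    outer₁ i rewrite lookup-inject₁ T s i | lookup-fromℕ T s | inject₁-≡ᵇ-last i = ∨-identityʳ _
    outer₂ : ∀ j → separated (T ∷ʳ s) (fromℕ n) (inject₁ j) ≡ not (eqCell (lookup T j) s)
    outer₂ j rewrite lookup-inject₁ T s j | lookup-fromℕ T s | last-≡ᵇ-inject₁ j =
      ≡.trans (∨-identityʳ _) (≡.cong not (eqCell-sym s (lookup T j)))
    corner-case : separated (T ∷ʳ s) (fromℕ n) (fromℕ n) ≡ true
    corner-case rewrite ≡ᵇ-refl (toℕ (fromℕ n)) = ∨-zeroʳ _

  occupiedBefore-inject₁ : ∀ i x → occupiedBefore (T ∷ʳ s) (inject₁ i) x ≡ occupiedBefore T i x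
  occupiedBefore-inject₁ i x = begin
    occupiedBefore (T ∷ʳ s) (inject₁ i) x ≡⟨ any-big _ (allFin (suc n)) ⟩
    Or.big (allFin (suc n)) (λ j → (toℕ j <ᵇ toℕ (inject₁ i)) ∧ eqCell (lookup (T ∷ʳ s) j) x) ≡⟨ Or.big-allFin-last n _ ⟩
    _ ≡⟨ ≡.cong₂ _∨_ (Or.big-cong (allFin n) (λ j → ≡.cong₂ _∧_ (inject₁-<ᵇ j i) (≡.cong (λ y → eqCell y x) (lookup-inject₁ T s j))))
                     (≡.cong (_∧ eqCell (lookup (T ∷ʳ s) (fromℕ n)) x) (last-<ᵇ-inject₁ i)) ⟩
    Or.big (allFin n) (λ j → (toℕ j <ᵇ toℕ i) ∧ eqCell (lookup T j) x) ∨ false ≡⟨ ∨-identityʳ _ ⟩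
    Or.big (allFin n) (λ j → (toℕ j <ᵇ toℕ i) ∧ eqCell (lookup T j) x) ≡⟨ any-big _ (allFin n) ⟨
    occupiedBefore T i x ∎
    where open ≡.≡-Reasoning

  occupiedBefore-last : ∀ x → occupiedBefore (T ∷ʳ s) (fromℕ n) x ≡ occupied T x
  occupiedBefore-last x = begin
    occupiedBefore (T ∷ʳ s) (fromℕ n) x ≡⟨ any-big _ (allFin (suc n)) ⟩
    Or.big (allFin (suc n)) (λ j → (toℕ j <ᵇ toℕ (fromℕ n)) ∧ eqCell (lookup (T ∷ʳ s) j) x) ≡⟨ Or.big-allFin-last n _ ⟩
    _ ≡⟨ ≡.cong₂ _∨_ (Or.big-cong (allFin n) (λ j → ≡.cong₂ _∧_ (inject₁-<ᵇ-last j) (≡.cong (λ y → eqCell y x) (lookup-inject₁ T s j))))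
                     (≡.cong (_∧ eqCell (lookup (T ∷ʳ s) (fromℕ n)) x) (last-<ᵇ-last n)) ⟩
    Or.big (allFin n) (λ j → eqCell (lookup T j) x) ∨ false ≡⟨ ∨-identityʳ _ ⟩
    Or.big (allFin n) (λ j → eqCell (lookup T j) x) ≡⟨ any-big _ (allFin n) ⟨
    occupied T x ∎
    where open ≡.≡-Reasoning

  isSYT-last : isSYT (T ∷ʳ s) ≡ isSYT T ∧ addable T s
  isSYT-last = begin
    isSYT (T ∷ʳ s) ≡⟨ isSYT-big (T ∷ʳ s) ⟩
    _ ≡⟨ ≡.cong₂ _∧_
           (≡.trans (And.big-allFin-last n (λ i → positiveᵇ (lookup (T ∷ʳ s) i))) (≡.cong₂ _∧_
             (And.big-cong (allFin n) (λ i → ≡.cong positiveᵇ (lookup-inject₁ T s i))) (≡.cong positiveᵇ (lookup-fromℕ T s))))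
           (≡.cong₂ _∧_ separated-last (≡.trans (And.big-allFin-last n (λ i → supportedBy (T ∷ʳ s) (occupiedBefore (T ∷ʳ s) i) (lookup (T ∷ʳ s) i))) (≡.cong₂ _∧_
             (And.big-cong (allFin n) (λ i → ≡.trans
               (≡.cong (supportedBy (T ∷ʳ s) (occupiedBefore (T ∷ʳ s) (inject₁ i))) (lookup-inject₁ T s i))
               (≡.cong₂ (λ a b → ((proj₂ (lookup T i) ≡ᵇ 1) ∨ a) ∧ ((proj₁ (lookup T i) ≡ᵇ 1) ∨ b)) (occupiedBefore-inject₁ i _) (occupiedBefore-inject₁ i _))))
             (≡.trans (≡.cong (supportedBy (T ∷ʳ s) (occupiedBefore (T ∷ʳ s) (fromℕ n))) (lookup-fromℕ T s))
               (≡.cong₂ (λ a b → ((proj₂ s ≡ᵇ 1) ∨ a) ∧ ((proj₁ s ≡ᵇ 1) ∨ b)) (occupiedBefore-last _) (occupiedBefore-last _)))))) ⟩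
    (P ∧ positiveᵇ s) ∧ ((D ∧ not (occupied T s)) ∧ (S ∧ supportedBy T (occupied T) s))
      ≡⟨ solve 6 (λ p p′ d x u u′ → (p ⊕ p′) ⊕ ((d ⊕ x) ⊕ (u ⊕ u′)) ⊜ (p ⊕ (d ⊕ u)) ⊕ (p′ ⊕ (x ⊕ u′))) ≡.refl
           P (positiveᵇ s) D (not (occupied T s)) S (supportedBy T (occupied T) s) ⟩
    (P ∧ (D ∧ S)) ∧ addable T s ≡⟨ ≡.cong (_∧ addable T s) (isSYT-big T) ⟨
    isSYT T ∧ addable T s ∎
    where
    open ≡.≡-Reasoning
    open import Algebra.Solver.CommutativeMonoid ∧-commutativeMonoid using (solve; _⊜_; _⊕_)
    P = And.big (allFin n) (λ i → positiveᵇ (lookup T i))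
    D = And.big (allFin n) (λ i → And.big (allFin n) (separated T i))
    S = And.big (allFin n) (λ i → supportedBy T (occupiedBefore T i) (lookup T i))

-- Enumerations of vectors and of pairs of indices, split at the last index

module LastPair {a ℓ} (M : CommutativeMonoid a ℓ) where
  open CommutativeMonoid M
  open BigOperator M
  open Relation.Binary.Reasoning.Setoid setoid

  big-allVecs-last : ∀ {X : Set} n (L : List X) (f : Vec X (suc n) → Carrier) →
    big (allVecs (suc n) L) f ≈ big (allVecs n L) (λ T → big L (λ s → f (T ∷ʳ s)))
  big-allVecs-suc : ∀ {X : Set} n (L : List X) (f : Vec X (suc n) → Carrier) →
    big (allVecs (suc n) L) f ≈ big L (λ x → big (allVecs n L) (λ T → f (x ∷ T)))
  big-allVecs-suc n L f = trans (big-concatMap _ L f) (big-cong L (λ x → reflexive (big-map (x ∷_) (allVecs n L) f)))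
  big-allVecs-last zero L f = trans (big-allVecs-suc zero L f) (trans (big-cong L (λ x → identityʳ _)) (sym (identityʳ _)))
  big-allVecs-last (suc n) L f = begin
    big (allVecs (suc (suc n)) L) f ≈⟨ big-allVecs-suc (suc n) L f ⟩
    big L (λ x → big (allVecs (suc n) L) (λ T → f (x ∷ T))) ≈⟨ big-cong L (λ x → big-allVecs-last n L (λ T → f (x ∷ T))) ⟩
    big L (λ x → big (allVecs n L) (λ T → big L (λ s → f (x ∷ (T ∷ʳ s))))) ≈⟨ big-allVecs-suc n L (λ T → big L (λ s → f (T ∷ʳ s))) ⟨
    _ ∎

  private
    -- Serves both for i < j and for j = i + 1: in neither relation can the last index come first.
    big-pairs-last : ∀ n (p : Fin (suc n) × Fin (suc n) → Bool) f →
      (∀ i → p (fromℕ n , inject₁ i) ≡ false) → p (fromℕ n , fromℕ n) ≡ false →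
      big (filterᵇ p (cartesianProduct (allFin (suc n)) (allFin (suc n)))) f ≈
      big (cartesianProduct (allFin n) (allFin n)) (λ (i , j) → if p (inject₁ i , inject₁ j) then f (inject₁ i , inject₁ j) else ε) ∙
      big (allFin n) (λ i → if p (inject₁ i , fromℕ n) then f (inject₁ i , fromℕ n) else ε)
    big-pairs-last n p f p₁ p₂ = begin
      big (filterᵇ p (cartesianProduct (allFin (suc n)) (allFin (suc n)))) f
        ≈⟨ trans (big-filter p (cartesianProduct (allFin (suc n)) (allFin (suc n))) f) (big-cartesianProduct (allFin (suc n)) (allFin (suc n)) g) ⟩
      big (allFin (suc n)) (λ i → big (allFin (suc n)) (λ j → g (i , j)))
        ≈⟨ trans (big-allFin-last n _) (∙-cong (big-cong (allFin n) (λ i → big-allFin-last n _)) (big-allFin-last n _)) ⟩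
      big (allFin n) (λ i → big (allFin n) (λ j → g (inject₁ i , inject₁ j)) ∙ g (inject₁ i , fromℕ n)) ∙
      (big (allFin n) (λ j → g (fromℕ n , inject₁ j)) ∙ g (fromℕ n , fromℕ n))
        ≈⟨ ∙-cong (big-∙ (allFin n) _ _) (trans (∙-cong (trans (big-cong (allFin n) (λ j → reflexive (≡.cong (if_then _ else ε) (p₁ j)))) (big-ε (allFin n)))
             (reflexive (≡.cong (if_then _ else ε) p₂))) (identityˡ ε)) ⟩
      (big (allFin n) (λ i → big (allFin n) (λ j → g (inject₁ i , inject₁ j))) ∙ big (allFin n) (λ i → g (inject₁ i , fromℕ n))) ∙ ε
        ≈⟨ identityʳ _ ⟩
      big (allFin n) (λ i → big (allFin n) (λ j → g (inject₁ i , inject₁ j))) ∙ big (allFin n) (λ i → g (inject₁ i , fromℕ n))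
        ≈⟨ ∙-congʳ (big-cartesianProduct (allFin n) (allFin n) _) ⟨
      _ ∎
      where
      g : Fin (suc n) × Fin (suc n) → Carrier
      g x = if p x then f x else ε

  private
    lt succ : ∀ {n} → Fin n × Fin n → Bool
    lt (i , j) = toℕ i <ᵇ toℕ j
    succ (i , j) = toℕ j ≡ᵇ suc (toℕ i)

    if-cong : ∀ {b b′} x → b ≡ b′ → (if b then x else ε) ≈ (if b′ then x else ε)
    if-cong x eq = reflexive (≡.cong (if_then x else ε) eq)

  big-pairsLt-last : ∀ n f → big (pairsLt (suc n)) f ≈
    big (pairsLt n) (λ (i , j) → f (inject₁ i , inject₁ j)) ∙ big (allFin n) (λ i → f (inject₁ i , fromℕ n))
  big-pairsLt-last n f = trans (big-pairs-last n lt f last-<ᵇ-inject₁ (last-<ᵇ-last n)) (∙-cong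
    (trans (big-cong (cartesianProduct (allFin n) (allFin n)) (λ (i , j) → if-cong (f (inject₁ i , inject₁ j)) (inject₁-<ᵇ i j)))
      (sym (big-filter lt (cartesianProduct (allFin n) (allFin n)) (λ (i , j) → f (inject₁ i , inject₁ j)))))
    (big-cong (allFin n) (λ i → if-cong (f (inject₁ i , fromℕ n)) (inject₁-<ᵇ-last i))))

  big-pairsSucc-last : ∀ n f → big (pairsSucc (suc (suc n))) f ≈
    big (pairsSucc (suc n)) (λ (i , j) → f (inject₁ i , inject₁ j)) ∙ f (inject₁ (fromℕ n) , fromℕ (suc n))
  big-pairsSucc-last n f = trans
    (big-pairs-last (suc n) succ f (λ i → ≡.trans (≡.cong₂ (λ x y → x ≡ᵇ suc y) (FinP.toℕ-inject₁ i) (FinP.toℕ-fromℕ (suc n))) (≡ᵇ-false (ℕP.<⇒≢ (ℕP.<-trans (FinP.toℕ<n i) (ℕP.n<1+n (suc n))))))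
       (≡ᵇ-false (ℕP.<⇒≢ (ℕP.n<1+n (toℕ (fromℕ (suc n))))))) (∙-cong
    (trans (big-cong (cartesianProduct (allFin (suc n)) (allFin (suc n))) (λ (i , j) → if-cong (f (inject₁ i , inject₁ j))
        (≡.cong₂ (λ x y → y ≡ᵇ suc x) (FinP.toℕ-inject₁ i) (FinP.toℕ-inject₁ j))))
      (sym (big-filter succ (cartesianProduct (allFin (suc n)) (allFin (suc n))) (λ (i , j) → f (inject₁ i , inject₁ j)))))
    (begin
      big (allFin (suc n)) (λ i → if toℕ (fromℕ (suc n)) ≡ᵇ suc (toℕ (inject₁ i)) then f (inject₁ i , fromℕ (suc n)) else ε)
        ≈⟨ big-allFin-last n (λ i → if toℕ (fromℕ (suc n)) ≡ᵇ suc (toℕ (inject₁ i)) then f (inject₁ i , fromℕ (suc n)) else ε) ⟩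
      _ ≈⟨ ∙-cong (trans (big-cong (allFin n) (λ i → if-cong (f (inject₁ (inject₁ i) , fromℕ (suc n))) (not-succ i))) (big-ε (allFin n)))
             (if-cong (f (inject₁ (fromℕ n) , fromℕ (suc n))) is-succ) ⟩
      ε ∙ f (inject₁ (fromℕ n) , fromℕ (suc n)) ≈⟨ identityˡ _ ⟩
      _ ∎))
    where
    not-succ : ∀ (i : Fin n) → (toℕ (fromℕ (suc n)) ≡ᵇ suc (toℕ (inject₁ (inject₁ i)))) ≡ false
    not-succ i rewrite FinP.toℕ-inject₁ (inject₁ i) = last-≡ᵇ-inject₁ i
    is-succ : (toℕ (fromℕ (suc n)) ≡ᵇ suc (toℕ (inject₁ (fromℕ n)))) ≡ true
    is-succ rewrite FinP.toℕ-inject₁ (fromℕ n) = ≡ᵇ-refl (toℕ (fromℕ n))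

-- The recursion for tableaux

module Natural = BigOperator ℕP.+-0-commutativeMonoid

total : ∀ {n} → Vec ℕ n → ℕ
total {n} m = Natural.big (allFin n) (lookup m)

-- With bounds of the form `suc α` this says k + x ≤ α, and the guard k ≤ α makes the truncated
-- subtraction exact.
<ᵇ-split : ∀ k x α → (k ℕ.+ x <ᵇ suc α) ≡ (k <ᵇ suc α) ∧ (x <ᵇ suc (α ℕ.∸ k))
<ᵇ-split zero x α = ≡.refl
<ᵇ-split (suc k) x zero = ≡.refl
<ᵇ-split (suc k) x (suc α) = <ᵇ-split k x α

module BigUpTo {a ℓ} (M : CommutativeMonoid a ℓ) where
  open CommutativeMonoid M
  open BigOperator M

  big-upTo-suc : ∀ n f → big (upTo (suc n)) f ≈ f 0 ∙ big (upTo n) (f ∘ suc)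
  big-upTo-suc n f = ∙-congˡ (reflexive (≡.trans
    (≡.cong (λ xs → big xs f) (≡.sym (map-applyUpTo (λ k → k) suc n))) (big-map suc (upTo n) f)))

module TableauSum {c ℓ} {R : CommutativeRing c ℓ} (torus : Torus R) where
  open CommutativeRing R hiding (zero)
  open Torus torus
  open PartialFractions torus
  open TeslerSeries torus
  open RingSums R
  open PowerSeries R
  open IntegerSolver R
  open Relation.Binary.Reasoning.Setoid setoid
  private
    module S⊛ = CommutativeMonoid ⊛-commutativeMonoid
    module Σᴸ = LastPair +-commutativeMonoid
    module Πᴸ = LastPair *-commutativeMonoid

  if-cong : ∀ b {x y} → x ≈ y → (if b then x else 0#) ≈ (if b then y else 0#)
  if-cong true eq = eq
  if-cong false eq = refl

  *-if : ∀ x b y → x * (if b then y else 0#) ≈ (if b then x * y else 0#)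
  *-if x true y = refl
  *-if x false y = zeroʳ x

  if-∧ : ∀ b b′ x → (if b ∧ b′ then x else 0#) ≈ (if b then (if b′ then x else 0#) else 0#)
  if-∧ true b′ x = refl
  if-∧ false b′ x = refl

  if-sum : ∀ {X : Set} b (xs : List X) f → (if b then sum xs f else 0#) ≈ sum xs (λ x → if b then f x else 0#)
  if-sum true xs f = refl
  if-sum false xs f = sym (Σ′.big-ε xs)

  -- The sum runs to the fixed bound `b` under a guard, rather than to α, to match enumerations
  -- whose range does not depend on α.
  ⊛-sum : ∀ α b f g → α ≤ b → (f ⊛ g) α ≈ sum (upTo (suc b)) (λ k → if k <ᵇ suc α then f k * g (α ℕ.∸ k) else 0#)
  ⊛-sum zero b f g _ = sym (trans (BigUpTo.big-upTo-suc +-commutativeMonoid b (λ k → if k <ᵇ 1 then f k * g (0 ℕ.∸ k) else 0#))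
    (trans (+-congˡ (Σ′.big-ε (upTo b))) (+-identityʳ _)))
  ⊛-sum (suc α) (suc b) f g (s≤s α≤b) = sym (trans
    (BigUpTo.big-upTo-suc +-commutativeMonoid (suc b) (λ k → if k <ᵇ suc (suc α) then f k * g (suc α ℕ.∸ k) else 0#))
    (+-congˡ (sym (⊛-sum α b (f ∘ suc) g α≤b))))

  power-mono1 : ∀ k → power mono1 k ≈ 1#
  power-mono1 zero = refl
  power-mono1 (suc k) = trans (*-cong μ-mono1 (power-mono1 k)) (*-identityˡ 1#)

  -- the last factor Σ uᵏ turns an equality of degrees into an inequality
  coefficient-of-product : ∀ n (h : Fin n → Series) α b → α ≤ b →
    (Series′.big (allFin n) h ⊛ power mono1) α ≈
    sum (allVecs n (upTo (suc b))) (λ m → if total m <ᵇ suc α then product (allFin n) (λ i → h i (lookup m i)) else 0#)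
  coefficient-of-product zero h α b _ = trans (⊛-identityˡ (power mono1) α) (trans (power-mono1 α) (sym (+-identityʳ 1#)))
  coefficient-of-product (suc n) h α b α≤b = begin
    (Series′.big (allFin (suc n)) h ⊛ power mono1) α ≈⟨ ⊛-cong (Series′.big-allFin-suc n h) (λ _ → refl) α ⟩
    ((h zero ⊛ H) ⊛ power mono1) α ≈⟨ ⊛-assoc (h zero) H (power mono1) α ⟩
    (h zero ⊛ (H ⊛ power mono1)) α ≈⟨ ⊛-sum α b (h zero) _ α≤b ⟩
    sum U (λ k → if k <ᵇ suc α then h zero k * (H ⊛ power mono1) (α ℕ.∸ k) else 0#)
      ≈⟨ Σ′.big-cong U (λ k → trans (if-cong (k <ᵇ suc α)
           (trans (*-congˡ (coefficient-of-product n (h ∘ suc) (α ℕ.∸ k) b (ℕP.≤-trans (ℕP.m∸n≤m α k) α≤b))) (*-sum (h zero k) (allVecs n U) _)))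
           (trans (if-sum (k <ᵇ suc α) (allVecs n U) _) (Σ′.big-cong (allVecs n U) (term k)))) ⟩
    sum U (λ k → sum (allVecs n U) (λ m → F′ (k ∷ m))) ≈⟨ Σᴸ.big-allVecs-suc n U F′ ⟨
    sum (allVecs (suc n) U) F′ ∎
    where
    U = upTo (suc b)
    H = Series′.big (allFin n) (h ∘ suc)
    F′ : Vec ℕ (suc n) → Carrier
    F′ m = if total m <ᵇ suc α then product (allFin (suc n)) (λ i → h i (lookup m i)) else 0#
    term : ∀ k m → (if k <ᵇ suc α then h zero k * (if total m <ᵇ suc (α ℕ.∸ k) then product (allFin n) (λ i → h (suc i) (lookup m i)) else 0#) else 0#)
                   ≈ F′ (k ∷ m)
    term k m = begin
      (if k <ᵇ suc α then h zero k * (if total m <ᵇ suc (α ℕ.∸ k) then P else 0#) else 0#)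
        ≈⟨ if-cong (k <ᵇ suc α) (*-if (h zero k) (total m <ᵇ suc (α ℕ.∸ k)) P) ⟩
      (if k <ᵇ suc α then (if total m <ᵇ suc (α ℕ.∸ k) then h zero k * P else 0#) else 0#)
        ≈⟨ if-∧ (k <ᵇ suc α) (total m <ᵇ suc (α ℕ.∸ k)) (h zero k * P) ⟨
      (if (k <ᵇ suc α) ∧ (total m <ᵇ suc (α ℕ.∸ k)) then h zero k * P else 0#)
        ≡⟨ ≡.cong (if_then h zero k * P else 0#) (≡.trans (≡.sym (<ᵇ-split k (total m) α))
             (≡.cong (_<ᵇ suc α) (≡.sym (Natural.big-allFin-suc n (lookup (k ∷ m)))))) ⟩
      (if total (k ∷ m) <ᵇ suc α then h zero k * P else 0#)
        ≈⟨ if-cong (total (k ∷ m) <ᵇ suc α) (sym (Π′.big-allFin-suc n (λ i → h i (lookup (k ∷ m) i)))) ⟩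
      F′ (k ∷ m) ∎
      where P = product (allFin n) (λ i → h (suc i) (lookup m i))

  -- Unlike `zPow` it includes label 1, whose box has monomial 1; appending a box is then uniform in
  -- n.
  monomial : ∀ {n} → Vec ℕ n → Vec Cell n → Carrier
  monomial {n} a T = product (allFin n) (λ i → power (zMono (lookup T i)) (lookup a i))

  successorFactor pairFactor : Mono → Mono → Carrier
  successorFactor x y = ψ (monoInv y) * ψ (monoMul monoQT (x ⊘ y))
  pairFactor x y = (φ (x ⊘ y) * φ (monoMul monoQT (x ⊘ y))) * (ψ (monoMul monoQ (x ⊘ y)) * ψ (monoMul monoT (x ⊘ y)))

  weight : ∀ {n} → Vec Cell n → Carrier
  weight {n} T = product (pairsSucc n) (λ (i , j) → successorFactor (z i) (z j)) * product (pairsLt n) (λ (i , j) → pairFactor (z i) (z j))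
    where
    z : Fin n → Mono
    z i = zMono (lookup T i)

  monomial-last : ∀ {n} (a : Vec ℕ n) α T s → monomial (a ∷ʳ α) (T ∷ʳ s) ≈ monomial a T * power (zMono s) α
  monomial-last {n} a α T s = trans (Π′.big-allFin-last n _) (*-cong
    (Π′.big-cong (allFin n) (λ i → reflexive (≡.cong₂ (λ x k → power (zMono x) k) (lookup-inject₁ T s i) (lookup-inject₁ a α i))))
    (reflexive (≡.cong₂ (λ x k → power (zMono x) k) (lookup-fromℕ T s) (lookup-fromℕ a α))))

  -- Since q, t and qt times the monomial of a box are the monomials of its right, upper and
  -- diagonal neighbours, the new pair factors are the `boxFactor`s of `nextBox`.
  weight-last : ∀ {n} {T : Vec Cell (suc n)} (tableau : Tableau T) N (n<N : suc (suc n) ≤ N) s →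
    weight (T ∷ʳ s) ≈ weight T * NextBox.nextBox tableau N n<N torus (zMono s)
  weight-last {n} {T} tableau N n<N s = begin
    weight (T ∷ʳ s) ≈⟨ *-cong (Πᴸ.big-pairsSucc-last n _) (Πᴸ.big-pairsLt-last (suc n) _) ⟩
    _ ≈⟨ *-cong (*-cong (Π′.big-cong (pairsSucc (suc n)) (λ (i , j) → reflexive (≡.cong₂ (λ x y → successorFactor (zMono x) (zMono y)) (lookup-inject₁ T s i) (lookup-inject₁ T s j))))
                        (reflexive (≡.cong₂ (λ x y → successorFactor (zMono x) (zMono y)) (lookup-inject₁ T s (fromℕ n)) (lookup-fromℕ T s))))
                (*-cong (Π′.big-cong (pairsLt (suc n)) (λ (i , j) → reflexive (≡.cong₂ (λ x y → pairFactor (zMono x) (zMono y)) (lookup-inject₁ T s i) (lookup-inject₁ T s j))))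
                        (Π′.big-cong (allFin (suc n)) (λ i → reflexive (≡.cong₂ (λ x y → pairFactor (zMono x) (zMono y)) (lookup-inject₁ T s i) (lookup-fromℕ T s))))) ⟩
    (A₁ * successorFactor (zMono (lookup T (fromℕ n))) (zMono s)) * (A₂ * product (allFin (suc n)) (λ i → pairFactor (zMono (lookup T i)) (zMono s)))
      ≈⟨ solve 4 (λ a b c d → (a :* b) :* (c :* d) := (a :* c) :* (d :* b)) refl _ _ _ _ ⟩
    weight T * (product (allFin (suc n)) (λ i → pairFactor (zMono (lookup T i)) (zMono s)) * successorFactor (zMono (lookup T (fromℕ n))) (zMono s))
      ≈⟨ *-congˡ (*-cong (Π′.big-cong (allFin (suc n)) box) (*-cong (reflexive (≡.cong ψ (≡.sym (monoMul-identityˡ _))))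
           (reflexive (≡.cong ψ (shifted monoQT (zMono (lookup T (fromℕ n))) (zMono-diagonal (positive (fromℕ n)))))))) ⟩
    _ ∎
    where
    open Tableau tableau
    A₁ = product (pairsSucc (suc n)) (λ (i , j) → successorFactor (zMono (lookup T i)) (zMono (lookup T j)))
    A₂ = product (pairsLt (suc n)) (λ (i , j) → pairFactor (zMono (lookup T i)) (zMono (lookup T j)))
    shifted : ∀ m x {y} → y ≡ monoMul m x → monoMul m (x ⊘ zMono s) ≡ y ⊘ zMono s
    shifted m x eq = ≡.trans (≡.sym (monoMul-assoc m x _)) (≡.cong (_⊘ zMono s) (≡.sym eq))
    box : ∀ i → pairFactor (zMono (lookup T i)) (zMono s) ≈
      NextBox.boxFactor tableau N n<N *-commutativeMonoid (λ x → φ (zMono x ⊘ zMono s)) (λ x → ψ (zMono x ⊘ zMono s)) (lookup T i)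
    box i = *-cong (*-congˡ (reflexive (≡.cong φ (shifted monoQT (zMono (lookup T i)) (zMono-diagonal (positive i))))))
      (*-cong (reflexive (≡.cong ψ (shifted monoQ (zMono (lookup T i)) (zMono-right (positive i))))) (reflexive (≡.cong ψ (shifted monoT (zMono (lookup T i)) (zMono-up (positive i))))))

  -- The weight of the entry in row i of the last column of a matrix with n + 1 rows. The test is
  -- written as in `teslerWeight`; on the tableau side it singles out the last of n boxes.
  columnCoef : ∀ {n} → Fin n → ℕ → Carrier
  columnCoef {n} i m = if toℕ (fromℕ n) ≡ᵇ suc (toℕ (inject₁ i)) then coefB m else coefA m

  columnSeries : ∀ {n} → Vec Cell n → Fin n → Series
  columnSeries T i m = columnCoef i m * power (zMono (lookup T i)) m

  stepSeries : ∀ {n} → Vec Cell n → Series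
  stepSeries {n} T = Series′.big (allFin n) (columnSeries T) ⊛ power mono1

  stepSeries-nextBox : ∀ {n} {T : Vec Cell (suc n)} (tableau : Tableau T) N (n<N : suc (suc n) ≤ N) →
    NextBox.nextBoxSeries tableau N n<N torus ≋ stepSeries T
  stepSeries-nextBox {n} {T} tableau N n<N = ⊛-cong (S⊛.sym (S⊛.trans (Series′.big-allFin-last n (columnSeries T))
    (⊛-cong (Series′.big-cong (allFin n) (λ i m → *-congʳ (reflexive (≡.cong (if_then coefB m else coefA m) (not-succ i)))))
            (λ m → *-congʳ (reflexive (≡.cong (if_then coefB m else coefA m) is-succ)))))) (λ _ → refl)
    where
    not-succ : ∀ (i : Fin n) → (toℕ (fromℕ (suc n)) ≡ᵇ suc (toℕ (inject₁ (inject₁ i)))) ≡ false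
    not-succ i rewrite FinP.toℕ-inject₁ (inject₁ i) = last-≡ᵇ-inject₁ i
    is-succ : (toℕ (fromℕ (suc n)) ≡ᵇ suc (toℕ (inject₁ (fromℕ n)))) ≡ true
    is-succ rewrite FinP.toℕ-inject₁ (fromℕ n) = ≡ᵇ-refl (toℕ (fromℕ n))

  module _ (N : ℕ) where
    private
      G = cellsUpTo N

    boxes-sum : ∀ {n} {T : Vec Cell n} → Tableau T → suc n ≤ N → ∀ α →
      sum G (λ s → if addable T s then power (zMono s) α * weight (T ∷ʳ s) else 0#) ≈ weight T * stepSeries T α
    -- The empty tableau has no last box. Its only addable cell is (1 , 1), with monomial 1, and the
    -- series is just 1 / (1 - u), all of whose coefficients are 1.
    boxes-sum {zero} {[]} tableau n<N α = begin
      sum G (λ s → if addable [] s then power (zMono s) α * weight (s ∷ []) else 0#)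
        ≈⟨ Σ′.big-cong-All (All.map first-box (cellsUpTo-positive N)) ⟩
      sum G (λ s → if eqCell (1 , 1) s then power (zMono s) α * (1# * 1#) else 0#)
        ≈⟨ SelectedTerms.big-single +-commutativeMonoid (λ s → power (zMono s) α * (1# * 1#)) (1 , 1) G (cellsUpTo-unique N) (cellsUpTo-complete n<N n<N) ⟩
      power mono1 α * (1# * 1#) ≈⟨ *-comm _ _ ⟩
      (1# * 1#) * power mono1 α ≈⟨ *-congˡ (⊛-identityˡ (power mono1) α) ⟨
      _ ∎
      where
      first-box : ∀ {s} → Positive s → (if addable [] s then power (zMono s) α * weight (s ∷ []) else 0#) ≈
                                        (if eqCell (1 , 1) s then power (zMono s) α * (1# * 1#) else 0#)
      first-box (zero , zero , ≡.refl) = refl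
      first-box (zero , suc c , ≡.refl) = refl
      first-box (suc r , zero , ≡.refl) = refl
      first-box (suc r , suc c , ≡.refl) = refl
    boxes-sum {suc n} {T} tableau n<N α = begin
      sum G (λ s → if addable T s then power (zMono s) α * weight (T ∷ʳ s) else 0#)
        ≈⟨ Σ′.big-cong G (λ s → trans (if-cong (addable T s) (regroup s)) (sym (*-if (weight T) (addable T s) _))) ⟩
      sum G (λ s → weight T * (if addable T s then power (zMono s) α * next (zMono s) else 0#)) ≈⟨ *-sum (weight T) G _ ⟨
      weight T * sum G (λ s → if addable T s then power (zMono s) α * next (zMono s) else 0#)
        ≈⟨ *-congˡ (trans (NextBox.nextBox-sum tableau N n<N torus α) (stepSeries-nextBox tableau N n<N α)) ⟩
      weight T * stepSeries T α ∎
      where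
      next = NextBox.nextBox tableau N n<N torus
      regroup : ∀ s → power (zMono s) α * weight (T ∷ʳ s) ≈ weight T * (power (zMono s) α * next (zMono s))
      regroup s = trans (*-congˡ (weight-last tableau N n<N s)) (solve 3 (λ p w x → p :* (w :* x) := w :* (p :* x)) refl _ _ _)

    tableauSum : ∀ {n} → Vec ℕ n → Carrier
    tableauSum {n} a = sum (allVecs n G) (λ T → if isSYT T then monomial a T * weight T else 0#)

    tableauSum-last : ∀ {n} (a : Vec ℕ n) α → suc n ≤ N →
      tableauSum (a ∷ʳ α) ≈ sum (allVecs n G) (λ T → if isSYT T then (monomial a T * weight T) * stepSeries T α else 0#)
    tableauSum-last {n} a α n<N = trans (Σᴸ.big-allVecs-last n G _) (Σ′.big-cong (allVecs n G) last-box)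
      where
      last-box : ∀ T → sum G (λ s → if isSYT (T ∷ʳ s) then monomial (a ∷ʳ α) (T ∷ʳ s) * weight (T ∷ʳ s) else 0#) ≈
                       (if isSYT T then (monomial a T * weight T) * stepSeries T α else 0#)
      last-box T = trans (Σ′.big-cong G (λ s → trans (reflexive (≡.cong (if_then monomial (a ∷ʳ α) (T ∷ʳ s) * weight (T ∷ʳ s) else 0#) (isSYT-last T s))) (if-∧ (isSYT T) (addable T s) _)))
        (trans (sym (if-sum (isSYT T) G _)) (if-tableau (isSYT T) ≡.refl))
        where
        term : Cell → Carrier
        term s = if addable T s then monomial (a ∷ʳ α) (T ∷ʳ s) * weight (T ∷ʳ s) else 0#
        if-tableau : ∀ b → isSYT T ≡ b → (if b then sum G term else 0#) ≈ (if b then (monomial a T * weight T) * stepSeries T α else 0#)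
        if-tableau false _ = refl
        if-tableau true eq = begin
          sum G term ≈⟨ Σ′.big-cong G (λ s → trans (if-cong (addable T s) (trans (*-congʳ (monomial-last a α T s)) (*-assoc _ _ _)))
                          (sym (*-if (monomial a T) (addable T s) _))) ⟩
          sum G (λ s → monomial a T * (if addable T s then power (zMono s) α * weight (T ∷ʳ s) else 0#)) ≈⟨ *-sum (monomial a T) G _ ⟨
          monomial a T * sum G (λ s → if addable T s then power (zMono s) α * weight (T ∷ʳ s) else 0#)
            ≈⟨ *-congˡ (boxes-sum (tableau-of T eq) n<N α) ⟩
          monomial a T * (weight T * stepSeries T α) ≈⟨ *-assoc _ _ _ ⟨
          (monomial a T * weight T) * stepSeries T α ∎

    power-+ : ∀ x k l → power x (k ℕ.+ l) ≈ power x k * power x l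
    power-+ x zero l = sym (*-identityˡ _)
    power-+ x (suc k) l = trans (*-congˡ (power-+ x k l)) (sym (*-assoc _ _ _))

    -- A coefficient of `columnSeries T i` at m_i is independent of `T` up to the power z_i^(m_i).
    -- That power joins the monomial and raises a_i by m_i; the rest leaves the sum over tableaux.
    tableauSum-recursion : ∀ {n} (a : Vec ℕ n) α b → α ≤ b → suc n ≤ N →
      tableauSum (a ∷ʳ α) ≈ sum (allVecs n (upTo (suc b))) (λ m → if total m <ᵇ suc α
        then product (allFin n) (λ i → columnCoef i (lookup m i)) * tableauSum (zipWith ℕ._+_ a m) else 0#)
    tableauSum-recursion {n} a α b α≤b n<N = begin
      tableauSum (a ∷ʳ α) ≈⟨ tableauSum-last a α n<N ⟩
      sum (allVecs n G) (λ T → if isSYT T then (monomial a T * weight T) * stepSeries T α else 0#)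
        ≈⟨ Σ′.big-cong (allVecs n G) (λ T → trans (if-cong (isSYT T) (trans (*-congˡ (coefficient-of-product n (columnSeries T) α b α≤b)) (*-sum (monomial a T * weight T) V _)))
             (if-sum (isSYT T) V _)) ⟩
      sum (allVecs n G) (λ T → sum V (λ m → if isSYT T then (monomial a T * weight T) * (if total m <ᵇ suc α then product (allFin n) (λ i → columnSeries T i (lookup m i)) else 0#) else 0#))
        ≈⟨ Σ′.big-swap (allVecs n G) V _ ⟩
      sum V (λ m → sum (allVecs n G) (λ T → if isSYT T then (monomial a T * weight T) * (if total m <ᵇ suc α then product (allFin n) (λ i → columnSeries T i (lookup m i)) else 0#) else 0#))
        ≈⟨ Σ′.big-cong V (λ m → trans (Σ′.big-cong (allVecs n G) (term m)) (trans (sym (if-sum (total m <ᵇ suc α) (allVecs n G) _))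
             (if-cong (total m <ᵇ suc α) (sym (*-sum (C m) (allVecs n G) _))))) ⟩
      _ ∎
      where
      V = allVecs n (upTo (suc b))
      C : Vec ℕ n → Carrier
      C m = product (allFin n) (λ i → columnCoef i (lookup m i))
      term : ∀ m T → (if isSYT T then (monomial a T * weight T) * (if total m <ᵇ suc α then product (allFin n) (λ i → columnSeries T i (lookup m i)) else 0#) else 0#)
                   ≈ (if total m <ᵇ suc α then C m * (if isSYT T then monomial (zipWith ℕ._+_ a m) T * weight T else 0#) else 0#)
      term m T with isSYT T | total m <ᵇ suc α
      ... | false | false = refl
      ... | false | true = sym (zeroʳ _)
      ... | true | false = zeroʳ _
      ... | true | true = begin
        (monomial a T * weight T) * product (allFin n) (λ i → columnSeries T i (lookup m i)) ≈⟨ *-congˡ (Π′.big-∙ (allFin n) _ _) ⟩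
        (monomial a T * weight T) * (C m * monomial m T) ≈⟨ solve 4 (λ x w c y → (x :* w) :* (c :* y) := c :* ((x :* y) :* w)) refl _ _ _ _ ⟩
        C m * ((monomial a T * monomial m T) * weight T) ≈⟨ *-congˡ (*-congʳ (Π′.big-∙ (allFin n) _ _)) ⟨
        C m * (product (allFin n) (λ i → power (zMono (lookup T i)) (lookup a i) * power (zMono (lookup T i)) (lookup m i)) * weight T)
          ≈⟨ *-congˡ (*-congʳ (Π′.big-cong (allFin n) (λ i → trans (sym (power-+ _ (lookup a i) (lookup m i)))
               (reflexive (≡.cong (power (zMono (lookup T i))) (≡.sym (lookup-zipWith ℕ._+_ i a m))))))) ⟩
        C m * (monomial (zipWith ℕ._+_ a m) T * weight T) ∎

-- The recursion for Tesler matrices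

extend : ∀ {X : Set} {n} → Vec (Vec X n) n → Vec X n → Vec X n → X → Vec (Vec X (suc n)) (suc n)
extend M col row d = zipWith _∷ʳ_ M col ∷ʳ (row ∷ʳ d)

sumℕ-filter : ∀ {X : Set} (p : X → Bool) xs (f : X → ℕ) → sumℕ (map f (filterᵇ p xs)) ≡ Natural.big xs (λ x → if p x then f x else 0)
sumℕ-filter p xs f = ≡.trans (go (filterᵇ p xs)) (Natural.big-filter p xs f)
  where
  go : ∀ ys → sumℕ (map f ys) ≡ Natural.big ys f
  go [] = ≡.refl
  go (y ∷ ys) = ≡.cong (f y ℕ.+_) (go ys)

module _ {n} (a : Vec ℕ n) (M : Vec (Vec ℕ n) n) where
  lowerZero : Fin n → Fin n → Bool
  lowerZero i j = not (toℕ j <ᵇ toℕ i) ∨ (entry M i j ≡ᵇ 0)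

  balanced : Fin n → Bool
  balanced i = (entry M i i ℕ.+ Natural.big (allFin n) (λ j → if toℕ j <ᵇ toℕ i then entry M j i else 0)) ≡ᵇ
               (lookup a i ℕ.+ Natural.big (allFin n) (λ j → if toℕ i <ᵇ toℕ j then entry M i j else 0))

  isTesler-big : isTesler a M ≡ And.big (allFin n) (λ i → And.big (allFin n) (lowerZero i)) ∧ And.big (allFin n) balanced
  isTesler-big = ≡.cong₂ _∧_
    (≡.trans (all-big _ (cartesianProduct (allFin n) (allFin n))) (And.big-cartesianProduct (allFin n) (allFin n) _))
    (≡.trans (all-big _ (allFin n)) (And.big-cong (allFin n) (λ i → ≡.cong₂ (λ x y → (entry M i i ℕ.+ x) ≡ᵇ (lookup a i ℕ.+ y))
      (sumℕ-filter (λ j → toℕ j <ᵇ toℕ i) (allFin n) (λ j → entry M j i)) (sumℕ-filter (λ j → toℕ i <ᵇ toℕ j) (allFin n) (λ j → entry M i j)))))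

module _ {n} (M : Vec (Vec ℕ n) n) (col row : Vec ℕ n) (d : ℕ) where
  private M⁺ = extend M col row d

  entry-inner : ∀ i j → entry M⁺ (inject₁ i) (inject₁ j) ≡ entry M i j
  entry-inner i j rewrite lookup-inject₁ (zipWith _∷ʳ_ M col) (row ∷ʳ d) i | lookup-zipWith _∷ʳ_ i M col =
    lookup-inject₁ (lookup M i) (lookup col i) j

  entry-column : ∀ i → entry M⁺ (inject₁ i) (fromℕ n) ≡ lookup col i
  entry-column i rewrite lookup-inject₁ (zipWith _∷ʳ_ M col) (row ∷ʳ d) i | lookup-zipWith _∷ʳ_ i M col =
    lookup-fromℕ (lookup M i) (lookup col i)

  entry-row : ∀ j → entry M⁺ (fromℕ n) (inject₁ j) ≡ lookup row j
  entry-row j rewrite lookup-fromℕ (zipWith _∷ʳ_ M col) (row ∷ʳ d) = lookup-inject₁ row d j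

  entry-corner : entry M⁺ (fromℕ n) (fromℕ n) ≡ d
  entry-corner rewrite lookup-fromℕ (zipWith _∷ʳ_ M col) (row ∷ʳ d) = lookup-fromℕ row d

  private
    if-cong₂ : ∀ {b b′} {x x′ : ℕ} → b ≡ b′ → x ≡ x′ → (if b then x else 0) ≡ (if b′ then x′ else 0)
    if-cong₂ ≡.refl ≡.refl = ≡.refl

  module _ (a : Vec ℕ n) (α : ℕ) where
    private a⁺ = a ∷ʳ α

    lowerZero-extend : And.big (allFin (suc n)) (λ i → And.big (allFin (suc n)) (lowerZero a⁺ M⁺ i)) ≡
      And.big (allFin n) (λ i → And.big (allFin n) (lowerZero a M i)) ∧ And.big (allFin n) (λ j → lookup row j ≡ᵇ 0)
    lowerZero-extend = begin
      And.big (allFin (suc n)) (λ i → And.big (allFin (suc n)) (lowerZero a⁺ M⁺ i))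
        ≡⟨ And.big-allFin-last n (λ i → And.big (allFin (suc n)) (lowerZero a⁺ M⁺ i)) ⟩
      And.big (allFin n) (λ i → And.big (allFin (suc n)) (lowerZero a⁺ M⁺ (inject₁ i))) ∧ And.big (allFin (suc n)) (lowerZero a⁺ M⁺ (fromℕ n))
        ≡⟨ ≡.cong₂ _∧_
             (And.big-cong (allFin n) (λ i → ≡.trans (And.big-allFin-last n (lowerZero a⁺ M⁺ (inject₁ i)))
               (≡.trans (≡.cong₂ _∧_ (And.big-cong (allFin n) (inner i)) (right i)) (∧-identityʳ _))))
             (≡.trans (And.big-allFin-last n (lowerZero a⁺ M⁺ (fromℕ n)))
               (≡.trans (≡.cong₂ _∧_ (And.big-cong (allFin n) bottom) corner-case) (∧-identityʳ _))) ⟩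
      _ ∎
      where
      open ≡.≡-Reasoning
      inner : ∀ i j → lowerZero a⁺ M⁺ (inject₁ i) (inject₁ j) ≡ lowerZero a M i j
      inner i j = ≡.cong₂ (λ b x → not b ∨ (x ≡ᵇ 0)) (inject₁-<ᵇ j i) (entry-inner i j)
      right : ∀ i → lowerZero a⁺ M⁺ (inject₁ i) (fromℕ n) ≡ true
      right i rewrite last-<ᵇ-inject₁ i = ≡.refl
      bottom : ∀ j → lowerZero a⁺ M⁺ (fromℕ n) (inject₁ j) ≡ (lookup row j ≡ᵇ 0)
      bottom j = ≡.cong₂ (λ b x → not b ∨ (x ≡ᵇ 0)) (inject₁-<ᵇ-last j) (entry-row j)
      corner-case : lowerZero a⁺ M⁺ (fromℕ n) (fromℕ n) ≡ true
      corner-case rewrite last-<ᵇ-last n = ≡.refl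

    -- The entry in the last column is part of the outflow of row i, on the same side of the
    -- equation as a_i; added to it, it turns the condition into that of the smaller matrix.
    balanced-inject₁ : ∀ i → balanced a⁺ M⁺ (inject₁ i) ≡ balanced (zipWith ℕ._+_ a col) M i
    balanced-inject₁ i = ≡.cong₂ _≡ᵇ_
      (≡.cong₂ ℕ._+_ (entry-inner i i) (≡.trans (Natural.big-allFin-last n (λ j → if toℕ j <ᵇ toℕ (inject₁ i) then entry M⁺ j (inject₁ i) else 0))
        (≡.trans (≡.cong₂ ℕ._+_ (Natural.big-cong (allFin n) (λ j → if-cong₂ (inject₁-<ᵇ j i) (entry-inner j i)))
                                (if-cong₂ (last-<ᵇ-inject₁ i) (entry-row i))) (ℕP.+-identityʳ _))))
      (begin
        lookup a⁺ (inject₁ i) ℕ.+ Natural.big (allFin (suc n)) (λ j → if toℕ (inject₁ i) <ᵇ toℕ j then entry M⁺ (inject₁ i) j else 0)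
          ≡⟨ ≡.cong₂ ℕ._+_ (lookup-inject₁ a α i) (≡.trans (Natural.big-allFin-last n (λ j → if toℕ (inject₁ i) <ᵇ toℕ j then entry M⁺ (inject₁ i) j else 0))
               (≡.cong₂ ℕ._+_ (Natural.big-cong (allFin n) (λ j → if-cong₂ (inject₁-<ᵇ i j) (entry-inner i j))) (if-cong₂ (inject₁-<ᵇ-last i) (entry-column i)))) ⟩
        lookup a i ℕ.+ (S ℕ.+ lookup col i) ≡⟨ ≡.cong (lookup a i ℕ.+_) (ℕP.+-comm S _) ⟩
        lookup a i ℕ.+ (lookup col i ℕ.+ S) ≡⟨ ℕP.+-assoc (lookup a i) _ S ⟨
        lookup a i ℕ.+ lookup col i ℕ.+ S ≡⟨ ≡.cong (ℕ._+ S) (lookup-zipWith ℕ._+_ i a col) ⟨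
        _ ∎)
      where
      open ≡.≡-Reasoning
      S = Natural.big (allFin n) (λ j → if toℕ i <ᵇ toℕ j then entry M i j else 0)

    balanced-last : balanced a⁺ M⁺ (fromℕ n) ≡ (d ℕ.+ total col ≡ᵇ α)
    balanced-last = ≡.cong₂ _≡ᵇ_
      (≡.cong₂ ℕ._+_ entry-corner (≡.trans (Natural.big-allFin-last n (λ j → if toℕ j <ᵇ toℕ (fromℕ n) then entry M⁺ j (fromℕ n) else 0))
        (≡.trans (≡.cong₂ ℕ._+_ (Natural.big-cong (allFin n) (λ j → if-cong₂ (inject₁-<ᵇ-last j) (entry-column j)))
                                (if-cong₂ (last-<ᵇ-last n) ≡.refl)) (ℕP.+-identityʳ _))))
      (≡.trans (≡.cong₂ ℕ._+_ (lookup-fromℕ a α) (≡.trans (Natural.big-allFin-last n (λ j → if toℕ (fromℕ n) <ᵇ toℕ j then entry M⁺ (fromℕ n) j else 0))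
        (≡.cong₂ ℕ._+_ (≡.trans (Natural.big-cong (allFin n) (λ j → if-cong₂ (last-<ᵇ-inject₁ j) ≡.refl)) (Natural.big-ε (allFin n)))
                       (if-cong₂ (last-<ᵇ-last n) ≡.refl)))) (ℕP.+-identityʳ α))

    isTesler-extend : isTesler a⁺ M⁺ ≡ isTesler (zipWith ℕ._+_ a col) M ∧ (And.big (allFin n) (λ j → lookup row j ≡ᵇ 0) ∧ (d ℕ.+ total col ≡ᵇ α))
    isTesler-extend = begin
      isTesler a⁺ M⁺ ≡⟨ isTesler-big a⁺ M⁺ ⟩
      _ ≡⟨ ≡.cong₂ _∧_ lowerZero-extend (≡.trans (And.big-allFin-last n (balanced a⁺ M⁺)) (≡.cong₂ _∧_ (And.big-cong (allFin n) balanced-inject₁) balanced-last)) ⟩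
      (L ∧ Q) ∧ (E ∧ (d ℕ.+ total col ≡ᵇ α))
        ≡⟨ solve 4 (λ l q e x → (l ⊕ q) ⊕ (e ⊕ x) ⊜ (l ⊕ e) ⊕ (q ⊕ x)) ≡.refl L Q E (d ℕ.+ total col ≡ᵇ α) ⟩
      (L ∧ E) ∧ (Q ∧ (d ℕ.+ total col ≡ᵇ α)) ≡⟨ ≡.cong (_∧ (Q ∧ (d ℕ.+ total col ≡ᵇ α))) (isTesler-big (zipWith ℕ._+_ a col) M) ⟨
      _ ∎
      where
      open ≡.≡-Reasoning
      open import Algebra.Solver.CommutativeMonoid ∧-commutativeMonoid using (solve; _⊜_; _⊕_)
      L = And.big (allFin n) (λ i → And.big (allFin n) (lowerZero a M i))
      Q = And.big (allFin n) (λ j → lookup row j ≡ᵇ 0)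
      E = And.big (allFin n) (balanced (zipWith ℕ._+_ a col) M)

module TeslerRecursion {c ℓ} {R : CommutativeRing c ℓ} (torus : Torus R) where
  open CommutativeRing R hiding (zero)
  open Torus torus
  open TeslerSeries torus
  open TableauSum torus
  open RingSums R
  open Relation.Binary.Reasoning.Setoid setoid
  private
    module Σᴸ = LastPair +-commutativeMonoid
    module Πᴸ = LastPair *-commutativeMonoid

  matrixWeight : ∀ {n} → Vec (Vec ℕ n) n → Carrier
  matrixWeight {n} M = product (pairsLt n) (λ (i , j) → if toℕ j ≡ᵇ suc (toℕ i) then coefB (entry M i j) else coefA (entry M i j))

  private
    coef : Bool → ℕ → Carrier
    coef b m = if b then coefB m else coefA m

  matrixWeight-extend : ∀ {n} (M : Vec (Vec ℕ n) n) col row d →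
    matrixWeight (extend M col row d) ≈ matrixWeight M * product (allFin n) (λ i → columnCoef i (lookup col i))
  matrixWeight-extend {n} M col row d = trans (Πᴸ.big-pairsLt-last n (λ (i , j) → coef (toℕ j ≡ᵇ suc (toℕ i)) (entry (extend M col row d) i j)))
    (*-cong (Π′.big-cong (pairsLt n) (λ (i , j) → reflexive (≡.cong₂ coef
              (≡.cong₂ (λ x y → y ≡ᵇ suc x) (FinP.toℕ-inject₁ i) (FinP.toℕ-inject₁ j)) (entry-inner M col row d i j))))
            (Π′.big-cong (allFin n) (λ i → reflexive (≡.cong (coef (toℕ (fromℕ n) ≡ᵇ suc (toℕ (inject₁ i)))) (entry-column M col row d i)))))

  sum-rows : ∀ {X : Set} k n (L : List X) (f : Vec (Vec X (suc n)) k → Carrier) →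
    sum (allVecs k (allVecs (suc n) L)) f ≈ sum (allVecs k (allVecs n L)) (λ M → sum (allVecs k L) (λ col → f (zipWith _∷ʳ_ M col)))
  sum-rows zero n L f = +-congʳ (sym (+-identityʳ _))
  sum-rows (suc k) n L f = begin
    sum (allVecs (suc k) (allVecs (suc n) L)) f ≈⟨ Σᴸ.big-allVecs-suc k (allVecs (suc n) L) f ⟩
    sum (allVecs (suc n) L) (λ r → sum (allVecs k (allVecs (suc n) L)) (λ V → f (r ∷ V))) ≈⟨ Σᴸ.big-allVecs-last n L _ ⟩
    sum (allVecs n L) (λ r → sum L (λ x → sum (allVecs k (allVecs (suc n) L)) (λ V → f ((r ∷ʳ x) ∷ V))))
      ≈⟨ Σ′.big-cong (allVecs n L) (λ r → trans (Σ′.big-cong L (λ x → sum-rows k n L (λ V → f ((r ∷ʳ x) ∷ V)))) (Σ′.big-swap L (allVecs k (allVecs n L)) _)) ⟩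
    sum (allVecs n L) (λ r → sum (allVecs k (allVecs n L)) (λ M → sum L (λ x → sum (allVecs k L) (λ col → f ((r ∷ʳ x) ∷ zipWith _∷ʳ_ M col)))))
      ≈⟨ Σ′.big-cong (allVecs n L) (λ r → Σ′.big-cong (allVecs k (allVecs n L)) (λ M → Σᴸ.big-allVecs-suc k L (λ col → f (zipWith _∷ʳ_ (r ∷ M) col)))) ⟨
    sum (allVecs n L) (λ r → sum (allVecs k (allVecs n L)) (λ M → sum (allVecs (suc k) L) (λ col → f (zipWith _∷ʳ_ (r ∷ M) col))))
      ≈⟨ Σᴸ.big-allVecs-suc k (allVecs n L) _ ⟨
    _ ∎

  sum-matrices : ∀ {X : Set} n (L : List X) (f : Vec (Vec X (suc n)) (suc n) → Carrier) →
    sum (allVecs (suc n) (allVecs (suc n) L)) f ≈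
    sum (allVecs n (allVecs n L)) (λ M → sum (allVecs n L) (λ col → sum (allVecs n L) (λ row → sum L (λ d → f (extend M col row d)))))
  sum-matrices n L f = begin
    sum (allVecs (suc n) (allVecs (suc n) L)) f ≈⟨ Σᴸ.big-allVecs-last n (allVecs (suc n) L) f ⟩
    sum (allVecs n (allVecs (suc n) L)) (λ V → sum (allVecs (suc n) L) (λ r → f (V ∷ʳ r)))
      ≈⟨ Σ′.big-cong (allVecs n (allVecs (suc n) L)) (λ V → Σᴸ.big-allVecs-last n L (λ r → f (V ∷ʳ r))) ⟩
    sum (allVecs n (allVecs (suc n) L)) (λ V → sum (allVecs n L) (λ row → sum L (λ d → f (V ∷ʳ (row ∷ʳ d))))) ≈⟨ sum-rows n n L _ ⟩
    _ ∎

  -- Entries below the diagonal must vanish, so exactly one of the enumerated last rows survives.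
  sum-zero-row : ∀ n b y → sum (allVecs n (upTo (suc b))) (λ row → if And.big (allFin n) (λ j → lookup row j ≡ᵇ 0) then y else 0#) ≈ y
  sum-zero-row zero b y = +-identityʳ y
  sum-zero-row (suc n) b y = begin
    sum (allVecs (suc n) U) (λ row → if zeros row then y else 0#) ≈⟨ Σᴸ.big-allVecs-suc n U (λ row → if zeros row then y else 0#) ⟩
    sum U (λ x → sum (allVecs n U) (λ row → if zeros (x ∷ row) then y else 0#))
      ≈⟨ Σ′.big-cong U (λ x → Σ′.big-cong (allVecs n U) (λ row → reflexive (≡.cong (if_then y else 0#) (And.big-allFin-suc n (λ j → lookup (x ∷ row) j ≡ᵇ 0))))) ⟩
    sum U (λ x → sum (allVecs n U) (λ row → if (x ≡ᵇ 0) ∧ zeros row then y else 0#))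
      ≈⟨ BigUpTo.big-upTo-suc +-commutativeMonoid b (λ x → sum (allVecs n U) (λ row → if (x ≡ᵇ 0) ∧ zeros row then y else 0#)) ⟩
    sum (allVecs n U) (λ row → if zeros row then y else 0#) + sum (upTo b) (λ x → sum (allVecs n U) (λ row → 0#))
      ≈⟨ +-cong (sum-zero-row n b y) (trans (Σ′.big-cong (upTo b) (λ _ → Σ′.big-ε (allVecs n U))) (Σ′.big-ε (upTo b))) ⟩
    y + 0# ≈⟨ +-identityʳ y ⟩
    y ∎
    where
    U = upTo (suc b)
    zeros : ∀ {n} → Vec ℕ n → Bool
    zeros {n} row = And.big (allFin n) (λ j → lookup row j ≡ᵇ 0)

  -- The diagonal entry d takes up what the last column leaves of α: it is α - k when k ≤ α, and
  -- lies in the range because α ≤ b. So the equation for the last row becomes the guard k ≤ α, as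
  -- it does for tableaux through 1 / (1 - u).
  sum-diagonal : ∀ k α b y → α ≤ b → sum (upTo (suc b)) (λ d → if d ℕ.+ k ≡ᵇ α then y else 0#) ≈ (if k <ᵇ suc α then y else 0#)
  sum-diagonal k α b y α≤b = trans
    (SelectedTerms.big-select +-commutativeMonoid (λ d → d ℕ.+ k ≡ᵇ α) (upTo (suc b)) (UniqueP.upTo⁺ (suc b))
      (λ {i} {j} p q → ℕP.+-cancelʳ-≡ k i j (≡.trans (≡ᵇ-sound p) (≡.sym (≡ᵇ-sound q)))))
    (reflexive (≡.cong (if_then y else 0#) (true-⇔⇒≡ to from)))
    where
    to : _ → (k <ᵇ suc α) ≡ true
    to eq with any-sound (λ d → d ℕ.+ k ≡ᵇ α) (upTo (suc b)) eq
    ... | d , eq′ = <ᵇ-true (s≤s (ℕP.≤-trans (ℕP.m≤n+m k d) (ℕP.≤-reflexive (≡ᵇ-sound eq′))))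
    from : (k <ᵇ suc α) ≡ true → _
    from lt = any-complete (λ d → d ℕ.+ k ≡ᵇ α) (∈-upTo⁺ (s≤s (ℕP.≤-trans (ℕP.m∸n≤m α k) α≤b)))
      (≡.trans (≡.cong (_≡ᵇ α) (ℕP.m∸n+n≡m (ℕP.≤-pred (<ᵇ-sound {k} {suc α} lt)))) (≡ᵇ-refl α))

  matrixSum : ∀ {n} → ℕ → Vec ℕ n → Carrier
  matrixSum {n} b a = sum (allVecs n (allVecs n (upTo (suc b)))) (λ M → if isTesler a M then matrixWeight M else 0#)

  matrixSum-recursion : ∀ {n} (a : Vec ℕ n) α b → α ≤ b →
    matrixSum b (a ∷ʳ α) ≈ sum (allVecs n (upTo (suc b))) (λ m → if total m <ᵇ suc α
      then product (allFin n) (λ i → columnCoef i (lookup m i)) * matrixSum b (zipWith ℕ._+_ a m) else 0#)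
  matrixSum-recursion {n} a α b α≤b = begin
    matrixSum b (a ∷ʳ α) ≈⟨ sum-matrices n U _ ⟩
    sum 𝓜 (λ M → sum V (λ col → sum V (λ row → sum U (λ d →
      if isTesler (a ∷ʳ α) (extend M col row d) then matrixWeight (extend M col row d) else 0#))))
      ≈⟨ Σ′.big-cong 𝓜 (λ M → Σ′.big-cong V (inner M)) ⟩
    sum 𝓜 (λ M → sum V (λ col → if isTesler (zipWith ℕ._+_ a col) M then (if total col <ᵇ suc α then matrixWeight M * C col else 0#) else 0#))
      ≈⟨ Σ′.big-swap 𝓜 V _ ⟩
    sum V (λ col → sum 𝓜 (λ M → if isTesler (zipWith ℕ._+_ a col) M then (if total col <ᵇ suc α then matrixWeight M * C col else 0#) else 0#))
      ≈⟨ Σ′.big-cong V (λ col → trans (Σ′.big-cong 𝓜 (λ M → commute (isTesler (zipWith ℕ._+_ a col) M) (total col <ᵇ suc α) (matrixWeight M) (C col)))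
           (trans (sym (if-sum (total col <ᵇ suc α) 𝓜 _)) (if-cong (total col <ᵇ suc α) (sym (*-sum (C col) 𝓜 _))))) ⟩
    _ ∎
    where
    U = upTo (suc b)
    V = allVecs n U
    𝓜 = allVecs n V
    C : Vec ℕ n → Carrier
    C m = product (allFin n) (λ i → columnCoef i (lookup m i))
    commute : ∀ p q w x → (if p then (if q then w * x else 0#) else 0#) ≈ (if q then x * (if p then w else 0#) else 0#)
    commute true true w x = *-comm w x
    commute true false w x = refl
    commute false true w x = sym (zeroʳ x)
    commute false false w x = refl
    inner : ∀ M col → sum V (λ row → sum U (λ d → if isTesler (a ∷ʳ α) (extend M col row d) then matrixWeight (extend M col row d) else 0#)) ≈
      (if isTesler (zipWith ℕ._+_ a col) M then (if total col <ᵇ suc α then matrixWeight M * C col else 0#) else 0#)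
    inner M col = begin
      sum V (λ row → sum U (λ d → if isTesler (a ∷ʳ α) (extend M col row d) then matrixWeight (extend M col row d) else 0#))
        ≈⟨ Σ′.big-cong V (λ row → trans (Σ′.big-cong U (λ d → simplify row d)) (sym (if-sum₂ row))) ⟩
      sum V (λ row → if P then (if Q row then sum U (λ d → if d ℕ.+ total col ≡ᵇ α then w else 0#) else 0#) else 0#)
        ≈⟨ Σ′.big-cong V (λ row → if-cong P (if-cong (Q row) (sum-diagonal (total col) α b w α≤b))) ⟩
      sum V (λ row → if P then (if Q row then (if total col <ᵇ suc α then w else 0#) else 0#) else 0#)
        ≈⟨ if-sum P V _ ⟨
      (if P then sum V (λ row → if Q row then (if total col <ᵇ suc α then w else 0#) else 0#) else 0#)
        ≈⟨ if-cong P (sum-zero-row n b _) ⟩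
      _ ∎
      where
      P = isTesler (zipWith ℕ._+_ a col) M
      Q : Vec ℕ n → Bool
      Q row = And.big (allFin n) (λ j → lookup row j ≡ᵇ 0)
      w = matrixWeight M * C col
      simplify : ∀ row d → (if isTesler (a ∷ʳ α) (extend M col row d) then matrixWeight (extend M col row d) else 0#) ≈
                           (if P then (if Q row then (if d ℕ.+ total col ≡ᵇ α then w else 0#) else 0#) else 0#)
      simplify row d = trans (if-cong (isTesler (a ∷ʳ α) (extend M col row d)) (matrixWeight-extend M col row d))
        (trans (reflexive (≡.cong (if_then w else 0#) (isTesler-extend M col row d a α)))
        (trans (if-∧ P (Q row ∧ (d ℕ.+ total col ≡ᵇ α)) w) (if-cong P (if-∧ (Q row) (d ℕ.+ total col ≡ᵇ α) w))))
      if-sum₂ : ∀ row → (if P then (if Q row then sum U (λ d → if d ℕ.+ total col ≡ᵇ α then w else 0#) else 0#) else 0#) ≈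
                        sum U (λ d → if P then (if Q row then (if d ℕ.+ total col ≡ᵇ α then w else 0#) else 0#) else 0#)
      if-sum₂ row = trans (if-cong P (if-sum (Q row) U _)) (if-sum P U _)

  total-last : ∀ {n} (a : Vec ℕ n) α → total (a ∷ʳ α) ≡ total a ℕ.+ α
  total-last {n} a α = ≡.trans (Natural.big-allFin-last n (lookup (a ∷ʳ α)))
    (≡.cong₂ ℕ._+_ (Natural.big-cong (allFin n) (lookup-inject₁ a α)) (lookup-fromℕ a α))

  total-zipWith : ∀ {n} (a m : Vec ℕ n) → total (zipWith ℕ._+_ a m) ≡ total a ℕ.+ total m
  total-zipWith {n} a m = ≡.trans (Natural.big-cong (allFin n) (λ i → lookup-zipWith ℕ._+_ i a m)) (Natural.big-∙ (allFin n) (lookup a) (lookup m))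

  -- Both sides satisfy one recursion with the same coefficients. The bounds persist because n drops
  -- and the total of a + m is at most that of a plus α, the total before the step.
  tableauSum-matrixSum : ∀ N b n (a : Vec ℕ n) → n ≤ N → total a ≤ b → tableauSum N a ≈ matrixSum b a
  tableauSum-matrixSum N b zero [] _ _ = +-congʳ (trans (*-identityˡ _) (*-identityˡ _))
  tableauSum-matrixSum N b (suc n) a⁺ n<N total≤b with initLast a⁺
  ... | a , α , ≡.refl = begin
    tableauSum N (a ∷ʳ α) ≈⟨ tableauSum-recursion N a α b α≤b n<N ⟩
    sum V (λ m → if total m <ᵇ suc α then C m * tableauSum N (zipWith ℕ._+_ a m) else 0#) ≈⟨ Σ′.big-cong V induction ⟩
    sum V (λ m → if total m <ᵇ suc α then C m * matrixSum b (zipWith ℕ._+_ a m) else 0#) ≈⟨ matrixSum-recursion a α b α≤b ⟨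
    matrixSum b (a ∷ʳ α) ∎
    where
    V = allVecs n (upTo (suc b))
    C : Vec ℕ n → Carrier
    C m = product (allFin n) (λ i → columnCoef i (lookup m i))
    bound′ : total a ℕ.+ α ≤ b
    bound′ = ≡.subst (_≤ b) (total-last a α) total≤b
    α≤b : α ≤ b
    α≤b = ℕP.≤-trans (ℕP.m≤n+m α (total a)) bound′
    induction : ∀ m → (if total m <ᵇ suc α then C m * tableauSum N (zipWith ℕ._+_ a m) else 0#) ≈
                      (if total m <ᵇ suc α then C m * matrixSum b (zipWith ℕ._+_ a m) else 0#)
    induction m with total m <ᵇ suc α in eq
    ... | false = refl
    ... | true = *-congˡ (tableauSum-matrixSum N b n (zipWith ℕ._+_ a m) (ℕP.<⇒≤ n<N)
      (ℕP.≤-trans (ℕP.≤-reflexive (total-zipWith a m)) (ℕP.≤-trans (ℕP.+-monoʳ-≤ (total a) (ℕP.≤-pred (<ᵇ-sound eq))) bound′)))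

-- The theorem for fractions of Laurent polynomials

fractionTorus : Torus fractionRing
fractionTorus = record
  { μ = embed ∘ monoP
  ; μ-monoMul = embed-monoMul
  ; μ-mono1 = CommutativeRing.refl fractionRing
  ; φ = factorK
  ; ψ = invFactorK
  ; φψ = factor-invFactor
  ; φ-one = factorK-true
  ; φ-other = factorK-false }

open RingSums fractionRing
open TableauSum fractionTorus
open TeslerSeries fractionTorus
open TeslerRecursion fractionTorus
open PartialFractions fractionTorus using (power; μ-cong)
open Torus fractionTorus
open Relation.Binary.Reasoning.Setoid K.setoid

-- The operations of `fractionRing` are `_+F_` and `_*F_` on the underlying fractions, so the
-- projections agree on the nose and the result transfers to `F` by substitution.
sumF-fractions : ∀ {X : Set} {f : X → Frac} {g : X → RegularFrac} → (∀ x → proj₁ (g x) ≡ f x) →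
                 ∀ xs → proj₁ (sum xs g) ≡ sumF (map f xs)
sumF-fractions eq [] = ≡.refl
sumF-fractions eq (x ∷ xs) = ≡.cong₂ _+F_ (eq x) (sumF-fractions eq xs)

prodF-fractions : ∀ {X : Set} {f : X → Frac} {g : X → RegularFrac} → (∀ x → proj₁ (g x) ≡ f x) →
                  ∀ xs → proj₁ (product xs g) ≡ prodF (map f xs)
prodF-fractions eq [] = ≡.refl
prodF-fractions eq (x ∷ xs) = ≡.cong₂ _*F_ (eq x) (prodF-fractions eq xs)

weight-wt : ∀ {n} (T : Vec Cell n) → proj₁ (weight T) ≡ wt T
weight-wt {n} T = ≡.cong₂ _*F_ (prodF-fractions (λ _ → ≡.refl) (pairsSucc n)) (prodF-fractions (λ _ → ≡.refl) (pairsLt n))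

F-fraction : ∀ {n} (a : Vec ℕ n) → RegularFrac
F-fraction {n} a = sum (SYTs n) (λ T → μ (zPow a T) K.* weight T)

F-fraction-F : ∀ {n} (a : Vec ℕ n) → proj₁ (F-fraction a) ≡ F a
F-fraction-F {n} a = sumF-fractions (λ T → ≡.cong (fromPoly (monoP (zPow a T)) *F_) (weight-wt T)) (SYTs n)

μ-foldr : ∀ {X : Set} (g : X → Mono) xs → μ (foldr monoMul mono1 (map g xs)) K.≈ product xs (μ ∘ g)
μ-foldr g [] = K.refl
μ-foldr g (x ∷ xs) = K.trans (μ-monoMul (g x) (foldr monoMul mono1 (map g xs))) (K.*-congˡ {μ (g x)} {μ (foldr monoMul mono1 (map g xs))} {product xs (μ ∘ g)} (μ-foldr g xs))

μ-power : ∀ k e → μ (+ k ℤ.* proj₁ e , + k ℤ.* proj₂ e) K.≈ power e k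
μ-power zero e = K.refl
μ-power (suc k) e@(e₁ , e₂) = begin
  μ (+ suc k ℤ.* e₁ , + suc k ℤ.* e₂) ≈⟨ μ-cong (≡.cong₂ _,_ (ℤP.suc-* (+ k) e₁) (ℤP.suc-* (+ k) e₂)) ⟩
  μ (monoMul e (+ k ℤ.* e₁ , + k ℤ.* e₂)) ≈⟨ μ-monoMul e _ ⟩
  μ e K.* μ (+ k ℤ.* e₁ , + k ℤ.* e₂) ≈⟨ K.*-congˡ {μ e} {μ (+ k ℤ.* e₁ , + k ℤ.* e₂)} {power e k} (μ-power k e) ⟩
  power e (suc k) ∎

-- Any box other than (1 , 1) needs a smaller label to its left or below it.
first-box : ∀ {n} {T : Vec Cell n} → Tableau T → ∀ i → (toℕ i ≡ᵇ 0) ≡ true → lookup T i ≡ (1 , 1)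
first-box {T = T} tableau i i≡0 with Tableau.positive tableau i
... | zero , zero , eq = eq
... | suc r , c , eq with Tableau.down tableau i eq
... | j , j<i , _ with () ← ≡.subst (toℕ j <_) (≡ᵇ-sound i≡0) j<i
first-box {T = T} tableau i i≡0 | zero , suc c , eq with Tableau.left tableau i eq
... | j , j<i , _ with () ← ≡.subst (toℕ j <_) (≡ᵇ-sound i≡0) j<i

zPow-monomial : ∀ {n} (a : Vec ℕ n) {T : Vec Cell n} → Tableau T → μ (zPow a T) K.≈ monomial a T
zPow-monomial {n} a {T} tableau = begin
  μ (zPow a T) ≈⟨ μ-foldr exponent (filterᵇ later (allFin n)) ⟩
  product (filterᵇ later (allFin n)) (μ ∘ exponent) ≈⟨ Π′.big-filter later (allFin n) (μ ∘ exponent) ⟩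
  product (allFin n) (λ i → if later i then μ (exponent i) else K.1#) ≈⟨ Π′.big-cong (allFin n) entryFactor ⟩
  monomial a T ∎
  where
  later : Fin n → Bool
  later i = not (toℕ i ≡ᵇ 0)
  exponent : Fin n → Mono
  exponent i = + lookup a i ℤ.* proj₁ (zMono (lookup T i)) , + lookup a i ℤ.* proj₂ (zMono (lookup T i))
  entryFactor : ∀ i → (if later i then μ (exponent i) else K.1#) K.≈ power (zMono (lookup T i)) (lookup a i)
  entryFactor i with toℕ i ≡ᵇ 0 in i≡0
  ... | false = μ-power (lookup a i) (zMono (lookup T i))
  ... | true = K.sym (K.trans (K.reflexive (≡.cong (λ x → power (zMono x) (lookup a i)) (first-box tableau i i≡0))) (power-mono1 (lookup a i)))

F-fraction-tableauSum : ∀ {n} (a : Vec ℕ n) → F-fraction a K.≈ tableauSum n a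
F-fraction-tableauSum {n} a = K.trans (Σ′.big-filter isSYT (allVecs n (cellsUpTo n)) (λ T → μ (zPow a T) K.* weight T))
  (Σ′.big-cong (allVecs n (cellsUpTo n)) (λ T → term T (isSYT T) ≡.refl))
  where
  term : ∀ T b → isSYT T ≡ b → (if b then μ (zPow a T) K.* weight T else K.0#) K.≈ (if b then monomial a T K.* weight T else K.0#)
  term T false _ = K.refl
  term T true eq = K.*-congʳ {weight T} {μ (zPow a T)} {monomial a T} (zPow-monomial a (tableau-of T eq))

embed-sumₚ : ∀ {X : Set} (f : X → LPoly) xs → embed (sumₚ (map f xs)) K.≈ sum xs (embed ∘ f)
embed-sumₚ f [] = K.refl
embed-sumₚ f (x ∷ xs) = K.trans (embed-+ (f x) (sumₚ (map f xs))) (K.+-congˡ {embed (f x)} {embed (sumₚ (map f xs))} {sum xs (embed ∘ f)} (embed-sumₚ f xs))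

embed-prodₚ : ∀ {X : Set} (f : X → LPoly) xs → embed (prodₚ (map f xs)) K.≈ product xs (embed ∘ f)
embed-prodₚ f [] = K.refl
embed-prodₚ f (x ∷ xs) = K.trans (embed-* (f x) (prodₚ (map f xs))) (K.*-congˡ {embed (f x)} {embed (prodₚ (map f xs))} {product xs (embed ∘ f)} (embed-prodₚ f xs))

embed-monomials : ∀ {X : Set} (e : X → Mono) xs → embed (map (λ x → + 1 , e x) xs) K.≈ sum xs (μ ∘ e)
embed-monomials e [] = K.refl
embed-monomials e (x ∷ xs) = K.trans (embed-+ (monoP (e x)) (map (λ x → + 1 , e x) xs)) (K.+-congˡ {μ (e x)} {embed (map (λ x → + 1 , e x) xs)} {sum xs (μ ∘ e)} (embed-monomials e xs))

embed-qtInt : ∀ m → embed (qtInt m) K.≈ qt-int m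
embed-qtInt m = embed-monomials (λ k → + (m ℕ.∸ 1 ℕ.∸ k) , + k) (upTo m)

embed-oneMinus : ∀ m → embed (oneMinus m) K.≈ K.1# K.- μ m
embed-oneMinus m = embed-+ 1ₚ (-ₚ monoP m)

embed-A : ∀ m → embed (A m) K.≈ coefA m
embed-A zero = K.refl
embed-A (suc m) = K.-‿cong (K.trans (embed-* (oneMinus monoQ *ₚ oneMinus monoT) (qtInt (suc m)))
  (K.*-cong (K.trans (embed-* (oneMinus monoQ) (oneMinus monoT)) (K.*-cong (embed-oneMinus monoQ) (embed-oneMinus monoT))) (embed-qtInt (suc m))))

embed-B : ∀ m → embed (B m) K.≈ coefB m
embed-B m = K.trans (embed-+ (qtInt (suc m)) (-ₚ qtInt m)) (K.+-cong (embed-qtInt (suc m)) (K.-‿cong (embed-qtInt m)))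

embed-teslerWeight : ∀ {n} (M : Vec (Vec ℕ n) n) → embed (teslerWeight M) K.≈ matrixWeight M
embed-teslerWeight {n} M = K.trans (embed-prodₚ _ (pairsLt n)) (Π′.big-cong (pairsLt n) (λ (i , j) → factorWeight (toℕ j ≡ᵇ suc (toℕ i)) (entry M i j)))
  where
  factorWeight : ∀ b m → embed (if b then B m else A m) K.≈ (if b then coefB m else coefA m)
  factorWeight true = embed-B
  factorWeight false = embed-A

total-sumℕ : ∀ {n} (a : Vec ℕ n) → total a ≡ sumℕ (toList a)
total-sumℕ [] = ≡.refl
total-sumℕ {suc n} (x ∷ a) = ≡.trans (Natural.big-allFin-suc n (lookup (x ∷ a))) (≡.cong (x ℕ.+_) (total-sumℕ a))

embed-teslerSum : ∀ {n} (a : Vec ℕ n) → embed (teslerSum a) K.≈ matrixSum (sumℕ (toList a)) a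
embed-teslerSum {n} a = K.trans (embed-sumₚ teslerWeight (teslers a)) (K.trans (Σ′.big-cong (teslers a) embed-teslerWeight)
  (Σ′.big-filter (isTesler a) (allVecs n (allVecs n (upTo (suc (sumℕ (toList a)))))) matrixWeight))

theorem2p9 : (n : ℕ) → 1 ≤ n → (a : Vec ℕ n) → F a ≈F fromPoly (teslerSum a)
theorem2p9 n _ a = ≡.subst (_≈F fromPoly (teslerSum a)) (F-fraction-F a) (unequal (begin
  F-fraction a ≈⟨ F-fraction-tableauSum a ⟩
  -- The fixed bounds take the values built into `SYTs n` and `teslers a`: the grid has side n, and
  -- entries are at most the total of `a`.
  tableauSum n a ≈⟨ tableauSum-matrixSum n (sumℕ (toList a)) n a ℕP.≤-refl (ℕP.≤-reflexive (total-sumℕ a)) ⟩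
  matrixSum (sumℕ (toList a)) a ≈⟨ embed-teslerSum a ⟨
  embed (teslerSum a) ∎))
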